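{- For every fixed integer $k\ge 3$, $f(s,k)-g(k)=\Theta(\frac{1}{s})$ as $s\to\infty$. In particular, for $k\in\{3,4\}$, $f(s,k) = \frac{1}{(k-1)^{k-1}} + \Theta(\frac{1}{s})$, and for any $k$ for which $g(k)=\frac{1}{(k-1)^{k-1}}$ holds, $f(s,k) = \frac{1}{(k-1)^{k-1}} + \Theta(\frac{1}{s})$.
   Context: For an integer $s\ge 1$ let $\Sigma_s=\{0,1,\ldots,s-1\}$ with its natural total order. An $n$-word over $\Sigma_s$ is a sequence $w=(w_1,\ldots,w_n)\in(\Sigma_s)^n$. A subword is a subsequence $w_{i_1}\cdots w_{i_k}$ with $i_1<\cdots<i_k$ (counted by position sets); it is monotone if it is non-decreasing or non-increasing. Let $m(k,w)$ be the number of monotone $k$-subwords of $w$, $f(s,k,n)=\min_{w\in(\Sigma_s)^n} m(k,w)/\binom{n}{k}$, and $f(s,k)=\lim_{n\to\infty} f(s,k,n)$. Let $g(k,n)$ be the minimum, over all permutations $\pi$ of $[n]$ (viewed as $n$-words), of the number of monotone $k$-subwords of $\pi$ divided by $\binom nk$, and $g(k)=\lim_{n\to\infty}g(k,n)$. (It is known that $g(3)=\frac14$ and $g(4)=\frac1{27}$.) The $\Theta$ constants may depend on $k$. -}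

module Defs where

open import Data.Bool using (Bool; true; false; _∧_; _∨_)
open import Data.Nat as ℕ using (ℕ; zero; suc; _≤ᵇ_; _⊓_)
open import Data.Nat.Combinatorics using (_C_)
open import Data.List using (List; []; _∷_; [_]; map; _++_; concatMap; foldr; upTo)
open import Data.Integer using (+_)
open import Data.Rational using (ℚ; 0ℚ; 1ℚ; _/_; _+_; _-_; _*_; _≤_; _<_; ∣_∣)
open import Data.Product using (Σ; _×_; ∃-syntax)

subs : {A : Set} → ℕ → List A → List (List A)
subs zero _ = [ [] ]
subs (suc k) [] = []
subs (suc k) (x ∷ xs) = map (x ∷_) (subs k xs) ++ subs (suc k) xs

nondec : List ℕ → Bool
nondec [] = true
nondec (x ∷ []) = true
nondec (x ∷ y ∷ r) = (x ≤ᵇ y) ∧ nondec (y ∷ r)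

noninc : List ℕ → Bool
noninc [] = true
noninc (x ∷ []) = true
noninc (x ∷ y ∷ r) = (y ≤ᵇ x) ∧ noninc (y ∷ r)

monotone : List ℕ → Bool
monotone u = nondec u ∨ noninc u

countB : {A : Set} → (A → Bool) → List A → ℕ
countB p [] = 0
countB p (x ∷ xs) with p x
... | true  = suc (countB p xs)
... | false = countB p xs

m : ℕ → List ℕ → ℕ
m k w = countB monotone (subs k w)

words : ℕ → ℕ → List (List ℕ)
words s zero = [ [] ]
words s (suc n) = concatMap (λ a → map (a ∷_) (words s n)) (upTo s)

inserts : ℕ → List ℕ → List (List ℕ)
inserts x [] = [ x ∷ [] ]
inserts x (y ∷ ys) = (x ∷ y ∷ ys) ∷ map (y ∷_) (inserts x ys)

perms : List ℕ → List (List ℕ)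
perms [] = [ [] ]
perms (x ∷ xs) = concatMap (inserts x) (perms xs)

-- minimum of a list (all lists used below are nonempty)
minL : List ℕ → ℕ
minL [] = 0
minL (x ∷ xs) = foldr _⊓_ x xs

-- a / b as a rational, with the convention a / 0 = 0 (only relevant when n < k)
ratio : ℕ → ℕ → ℚ
ratio a zero = 0ℚ
ratio a (suc b) = (+ a) / suc b

inv : ℕ → ℚ
inv zero = 0ℚ
inv (suc t) = (+ 1) / suc t

f : ℕ → ℕ → ℕ → ℚ
f s k n = ratio (minL (map (m k) (words s n))) (n C k)

-- g(k,n): permutations of [n], realised on the values 0,…,n-1 (order-isomorphic)
g : ℕ → ℕ → ℚ
g k n = ratio (minL (map (m k) (perms (upTo n)))) (n C k)

Converges : (ℕ → ℚ) → ℚ → Set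
Converges a L = ∀ (ε : ℚ) → 0ℚ < ε → ∃[ N ] (∀ n → N ℕ.≤ n → ∣ a n - L ∣ ≤ ε)

-- lo ≤ lim_{n→∞} a n ≤ hi  (for a sequence whose limit exists),
-- expressed without reals: eventually a n lies in [lo - ε, hi + ε], for every ε > 0
LimBetween : (ℕ → ℚ) → ℚ → ℚ → Set
LimBetween a lo hi = ∀ (ε : ℚ) → 0ℚ < ε →
  ∃[ N ] (∀ n → N ℕ.≤ n → (lo - ε ≤ a n) × (a n ≤ hi + ε))

-- x(s) := lim_{n→∞} a s n  is Θ(1/s) as s → ∞
ThetaInv : (ℕ → ℕ → ℚ) → Set
ThetaInv a = ∃[ c₁ ] ∃[ c₂ ] ((0ℚ < c₁) × (0ℚ < c₂) ×
  ∃[ s₀ ] (∀ s → s₀ ℕ.≤ s → LimBetween (a s) (c₁ * inv s) (c₂ * inv s)))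

rk : ℕ → ℚ
rk k = ratio 1 ((k ℕ.∸ 1) ℕ.^ (k ℕ.∸ 1))

{-# OPTIONS --safe #-}
module Submission where

-- Upper bound for f − g.  Merge the values of an extremal permutation into s intervals of nearly equal length:
-- only subwords containing two values of the same interval can become monotone, a fraction O(1/s).
--
-- Lower bound for f − g.  Mark the first h = ⌊n/2s⌋ occurrences of every letter of a word w as early and the others
-- as late, and break ties in two ways: early before late, and late before early (then by position).  Each monotone
-- subword of either permutation is monotone in w.  Conversely a monotone subword y x₁ … x_{k-1} of w in which y is
-- early, the xᵢ are late and y = x₁ is not monotone in one of them, and there are h of these for each monotone
-- (k-1)-subword of the late letters; by Ramsey's theorem and double counting that is Ω(n^k / s) in total.
--
-- g(k) ≤ (k-1)^{-(k-1)}.  Take k-1 decreasing blocks, each above the previous one.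
--
-- g(3) ≥ 1/4 and g(4) ≥ 1/27.  Flag algebras: for a positive semidefinite kernel κ_T on r-sets of points, depending
-- only on the order type of T ∪ U ∪ U′, the sum of κ_T(U, U′) over all T, U, U′ is nonnegative, and it is a sum over
-- (t+2r)-point patterns up to lower order terms.  For k = 4, kernels of types t = 2, 4 on 6 points and t = 5 on
-- 7 points suffice.  They were found by semidefinite programming, restricted to kernels annihilating the flag vectors
-- of the extremal permutations (including those with a few points near the corners of the blocks exchanged), and
-- rounded so that the inequality is an equality on all patterns of these permutations.

-- Neither tie-breaking is enough alone. On a subword y x₁ x₂ ... with y = x₁, y early and the rest
-- late, one order makes a descent from y to x₁ and the other an ascent, so nondecreasing subwords
-- are destroyed by one order and those that really decrease by the other; which kind abounds
-- depends on w. Comparing the sum over both permutations with twice the count in w avoids the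
-- choice.
--
-- The number h has to serve two purposes: at most n/2 letters may be early, so that the late ones
-- still contain a positive fraction of all subwords, and h must be of order n/s, since each
-- monotone late subword gains h extensions. All inequalities relate minimal counts at a fixed n
-- with denominators cleared; ratios appear only at the end.
--
-- The flag algebra inequalities reduce to evaluations on all patterns of six and of seven points.
-- Kernels are stored once for types related by a symmetry of the square, and the contribution of
-- the six-point kernels is tabulated, so that the seven-point check only looks it up.

open import Defs

-- Sums over sublists, double counting and binomial estimates.

module Counting where

  open import Data.Bool using (Bool; true; false)
  open import Data.Nat using (ℕ; zero; suc; z≤n; s≤s; _+_; _*_; _∸_; _^_; _≤_; _<_; _!; >-nonZero)
  import Data.Nat as ℕ
  open import Data.Nat.Properties
  import Data.Nat.Properties as ℕₚ
  open import Data.Nat.Combinatorics using (_C_; nCk+nC[k+1]≡[n+1]C[k+1]; k>n⇒nCk≡0; nCn≡1; nC1≡n)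
  open import Data.Nat.Tactic.RingSolver using (solve-∀)
  open import Data.List using (List; []; _∷_; [_]; map; _++_; length)
  import Data.List.Properties as Listₚ
  open import Data.List.Membership.Propositional using (_∈_)
  open import Data.List.Membership.Propositional.Properties using (∈-map⁺; ∈-map⁻; ∈-++⁺ˡ; ∈-++⁺ʳ; ∈-++⁻)
  open import Data.List.Relation.Unary.Any using (here; there)
  open import Data.List.Relation.Binary.Sublist.Propositional using (_⊆_; []; _∷_; _∷ʳ_; minimum)
  open import Data.Product using (_×_; _,_)
  open import Data.Sum using (inj₁; inj₂)
  open import Function using (_∘_)
  open import Algebra.Structures using (IsCommutativeMonoid)
  open import Relation.Nullary using (yes; no)
  open import Relation.Binary.PropositionalEquality using (_≡_; refl; sym; trans; cong; cong₂; subst; module ≡-Reasoning)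

  private variable
    A B : Set

  -- Splittings of a list into a sublist and its complement. Sums over disjoint pairs of sublists
  -- are written with it, so that double counting needs no notion of disjointness.
  sel : ℕ → List A → List (List A × List A)
  sel zero    xs       = [ [] , xs ]
  sel (suc k) []       = []
  sel (suc k) (x ∷ xs) = map (λ (t , r) → x ∷ t , r) (sel k xs) ++ map (λ (t , r) → t , x ∷ r) (sel (suc k) xs)

  sel-short : ∀ k (xs : List A) → length xs ℕ.< k → sel k xs ≡ []
  sel-short (suc k) [] _ = refl
  sel-short (suc k) (x ∷ xs) (s≤s p)
    rewrite sel-short k xs p | sel-short (suc k) xs (ℕₚ.m<n⇒m<1+n p) = refl

  subs-length : ∀ k (xs : List A) {u} → u ∈ subs k xs → length u ≡ k
  subs-length zero xs (here refl) = refl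
  subs-length (suc k) (x ∷ xs) u∈ with ∈-++⁻ (map (x ∷_) (subs k xs)) u∈
  ... | inj₂ u∈′ = subs-length (suc k) xs u∈′
  ... | inj₁ u∈′ with ∈-map⁻ (x ∷_) u∈′
  ...   | v , v∈ , refl = cong suc (subs-length k xs v∈)

  -- Generic in the monoid because the same double counting is applied to counts in ℕ and to signed
  -- kernels in ℤ.
  module Sums {M : Set} {_⊕_ : M → M → M} {𝟘 : M} (isCM : IsCommutativeMonoid _≡_ _⊕_ 𝟘) where
    open IsCommutativeMonoid isCM using (assoc; comm; identityˡ; identityʳ)

    Σ[_] : List A → (A → M) → M
    Σ[ [] ]     f = 𝟘
    Σ[ x ∷ xs ] f = f x ⊕ Σ[ xs ] f

    Σ-++ : ∀ (xs ys : List A) f → Σ[ xs ++ ys ] f ≡ Σ[ xs ] f ⊕ Σ[ ys ] f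
    Σ-++ [] ys f = sym (identityˡ _)
    Σ-++ (x ∷ xs) ys f = trans (cong (f x ⊕_) (Σ-++ xs ys f)) (sym (assoc _ _ _))

    Σ-map : ∀ (h : A → B) xs f → Σ[ map h xs ] f ≡ Σ[ xs ] (f ∘ h)
    Σ-map h [] f = refl
    Σ-map h (x ∷ xs) f = cong (f (h x) ⊕_) (Σ-map h xs f)

    Σ-cong∈ : ∀ (xs : List A) {f g} → (∀ x → x ∈ xs → f x ≡ g x) → Σ[ xs ] f ≡ Σ[ xs ] g
    Σ-cong∈ [] e = refl
    Σ-cong∈ (x ∷ xs) e = cong₂ _⊕_ (e x (here refl)) (Σ-cong∈ xs (λ y y∈ → e y (there y∈)))

    Σ-cong : ∀ (xs : List A) {f g} → (∀ x → f x ≡ g x) → Σ[ xs ] f ≡ Σ[ xs ] g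
    Σ-cong xs e = Σ-cong∈ xs (λ x _ → e x)

    interchange : ∀ a b c d → (a ⊕ b) ⊕ (c ⊕ d) ≡ (a ⊕ c) ⊕ (b ⊕ d)
    interchange a b c d = trans (assoc a b _) (trans (cong (a ⊕_) (trans (sym (assoc b c d)) (trans (cong (_⊕ d) (comm b c)) (assoc c b d)))) (sym (assoc a c _)))

    Σ-⊕ : ∀ (xs : List A) f g → Σ[ xs ] (λ x → f x ⊕ g x) ≡ Σ[ xs ] f ⊕ Σ[ xs ] g
    Σ-⊕ [] f g = sym (identityˡ _)
    Σ-⊕ (x ∷ xs) f g = trans (cong (_ ⊕_) (Σ-⊕ xs f g)) (interchange _ _ _ _)

    Σ-𝟘 : ∀ (xs : List A) → Σ[ xs ] (λ _ → 𝟘) ≡ 𝟘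
    Σ-𝟘 [] = refl
    Σ-𝟘 (x ∷ xs) = trans (identityˡ _) (Σ-𝟘 xs)

    Σ-swap : ∀ (xs : List A) (ys : List B) (f : A → B → M) →
             Σ[ xs ] (λ x → Σ[ ys ] (f x)) ≡ Σ[ ys ] (λ y → Σ[ xs ] (λ x → f x y))
    Σ-swap [] ys f = sym (Σ-𝟘 ys)
    Σ-swap (x ∷ xs) ys f = trans (cong (Σ[ ys ] (f x) ⊕_) (Σ-swap xs ys f)) (sym (Σ-⊕ ys (f x) _))

    Σ-subs-∷ : ∀ k (x : A) xs f → Σ[ subs (suc k) (x ∷ xs) ] f ≡ Σ[ subs k xs ] (λ u → f (x ∷ u)) ⊕ Σ[ subs (suc k) xs ] f
    Σ-subs-∷ k x xs f = trans (Σ-++ (map (x ∷_) (subs k xs)) _ f) (cong (_⊕ _) (Σ-map (x ∷_) (subs k xs) f))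

    Σ-sel-∷ : ∀ k (x : A) xs (f : List A × List A → M) → Σ[ sel (suc k) (x ∷ xs) ] f
            ≡ Σ[ sel k xs ] (λ (t , r) → f (x ∷ t , r)) ⊕ Σ[ sel (suc k) xs ] (λ (t , r) → f (t , x ∷ r))
    Σ-sel-∷ k x xs f = trans (Σ-++ (map _ (sel k xs)) _ f) (cong₂ _⊕_ (Σ-map _ (sel k xs) f) (Σ-map _ (sel (suc k) xs) f))

    -- Double counting of disjoint pairs (T, U): on the left T is chosen first and U inside its
    -- complement, on the right their union S first. Both sides obey the same recursion on the first
    -- element, which goes into T, into U or into neither.
    Σ-sel-subs : ∀ t b (P : List A) (F : List A → List A → M) →
      Σ[ sel t P ] (λ (T , R) → Σ[ subs b R ] (F T)) ≡ Σ[ subs (t ℕ.+ b) P ] (λ S → Σ[ sel t S ] (λ (T , U) → F T U))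
    Σ-sel-subs zero b P F = trans (identityʳ _) (Σ-cong (subs b P) (λ u → sym (identityʳ _)))
    Σ-sel-subs (suc t) b [] F = refl
    Σ-sel-subs (suc t) b (x ∷ P) F = begin
        Σ[ sel (suc t) (x ∷ P) ] (λ (T , R) → Σ[ subs b R ] (F T))
          ≡⟨ Σ-sel-∷ t x P _ ⟩
        Σ[ sel t P ] (λ (T , R) → Σ[ subs b R ] (F (x ∷ T))) ⊕ Σ[ sel (suc t) P ] (λ (T , R) → Σ[ subs b (x ∷ R) ] (F T))
          ≡⟨ cong₂ _⊕_ (Σ-sel-subs t b P (λ T → F (x ∷ T))) (second b) ⟩
        Σ[ subs (t ℕ.+ b) P ] (λ S → Σ[ sel t S ] (λ (T , U) → F (x ∷ T) U))
          ⊕ (Σ[ subs (t ℕ.+ b) P ] (λ S → Σ[ sel (suc t) S ] (λ (T , U) → F T (x ∷ U))) ⊕ rest)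
          ≡⟨ sym (assoc _ _ _) ⟩
        (Σ[ subs (t ℕ.+ b) P ] (λ S → Σ[ sel t S ] (λ (T , U) → F (x ∷ T) U))
          ⊕ Σ[ subs (t ℕ.+ b) P ] (λ S → Σ[ sel (suc t) S ] (λ (T , U) → F T (x ∷ U)))) ⊕ rest
          ≡⟨ cong (_⊕ rest) (sym (Σ-⊕ (subs (t ℕ.+ b) P) _ _)) ⟩
        Σ[ subs (t ℕ.+ b) P ] (λ S → Σ[ sel t S ] (λ (T , U) → F (x ∷ T) U) ⊕ Σ[ sel (suc t) S ] (λ (T , U) → F T (x ∷ U))) ⊕ rest
          ≡⟨ cong (_⊕ rest) (Σ-cong (subs (t ℕ.+ b) P) (λ S → sym (Σ-sel-∷ t x S (λ (T , U) → F T U)))) ⟩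
        Σ[ subs (t ℕ.+ b) P ] (λ S → Σ[ sel (suc t) (x ∷ S) ] (λ (T , U) → F T U)) ⊕ rest
          ≡⟨ sym (Σ-subs-∷ (t ℕ.+ b) x P _) ⟩
        Σ[ subs (suc t ℕ.+ b) (x ∷ P) ] (λ S → Σ[ sel (suc t) S ] (λ (T , U) → F T U)) ∎
      where
      open ≡-Reasoning
      rest = Σ[ subs (suc (t ℕ.+ b)) P ] (λ S → Σ[ sel (suc t) S ] (λ (T , U) → F T U))
      second : ∀ b → Σ[ sel (suc t) P ] (λ (T , R) → Σ[ subs b (x ∷ R) ] (F T))
             ≡ Σ[ subs (t ℕ.+ b) P ] (λ S → Σ[ sel (suc t) S ] (λ (T , U) → F T (x ∷ U)))
               ⊕ Σ[ subs (suc (t ℕ.+ b)) P ] (λ S → Σ[ sel (suc t) S ] (λ (T , U) → F T U))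
      -- With b = 0 the element x cannot lie in U: the corresponding sum on the right is empty,
      -- since S has only t elements and `suc t` of them cannot be split off.
      second zero = trans (Σ-sel-subs (suc t) 0 P F)
        (trans (sym (identityˡ _)) (cong (_⊕ _) (sym (trans (Σ-cong∈ (subs (t ℕ.+ 0) P) none) (Σ-𝟘 (subs (t ℕ.+ 0) P))))))
        where
        none : ∀ S → S ∈ subs (t ℕ.+ 0) P → Σ[ sel (suc t) S ] (λ (T , U) → F T (x ∷ U)) ≡ 𝟘
        none S S∈ rewrite sel-short (suc t) S (ℕₚ.≤-reflexive (cong suc (trans (subs-length _ P S∈) (ℕₚ.+-identityʳ t)))) = refl
      second (suc b) = trans (Σ-cong (sel (suc t) P) (λ (T , R) → Σ-subs-∷ b x R (F T)))
        (trans (Σ-⊕ (sel (suc t) P) _ _)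
          (cong₂ _⊕_
            (trans (Σ-sel-subs (suc t) b P (λ T U → F T (x ∷ U)))
              (cong (λ j → Σ[ subs j P ] (λ S → Σ[ sel (suc t) S ] (λ (T , U) → F T (x ∷ U)))) (sym (ℕₚ.+-suc t b))))
            (Σ-sel-subs (suc t) (suc b) P F)))

  open Sums +-0-isCommutativeMonoid public

  ind : Bool → ℕ
  ind true  = 1
  ind false = 0

  ind≤1 : ∀ b → ind b ≤ 1
  ind≤1 true  = ≤-refl
  ind≤1 false = z≤n

  countB-Σ : ∀ (p : A → Bool) xs → countB p xs ≡ Σ[ xs ] (ind ∘ p)
  countB-Σ p [] = refl
  countB-Σ p (x ∷ xs) with p x
  ... | true  = cong suc (countB-Σ p xs)
  ... | false = countB-Σ p xs

  m-Σ : ∀ k w → m k w ≡ Σ[ subs k w ] (ind ∘ monotone)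
  m-Σ k w = countB-Σ monotone (subs k w)

  Σ-mono∈ : ∀ (xs : List A) {f g : A → ℕ} → (∀ x → x ∈ xs → f x ≤ g x) → Σ[ xs ] f ≤ Σ[ xs ] g
  Σ-mono∈ [] e = z≤n
  Σ-mono∈ (x ∷ xs) e = +-mono-≤ (e x (here refl)) (Σ-mono∈ xs (λ y y∈ → e y (there y∈)))

  Σ-mono : ∀ (xs : List A) {f g : A → ℕ} → (∀ x → f x ≤ g x) → Σ[ xs ] f ≤ Σ[ xs ] g
  Σ-mono xs e = Σ-mono∈ xs (λ x _ → e x)

  Σ-*ˡ : ∀ c (xs : List A) f → Σ[ xs ] (λ x → c * f x) ≡ c * Σ[ xs ] f
  Σ-*ˡ c [] f = sym (*-zeroʳ c)
  Σ-*ˡ c (x ∷ xs) f = trans (cong (c * f x +_) (Σ-*ˡ c xs f)) (sym (*-distribˡ-+ c _ _))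

  Σ-const : ∀ (xs : List A) c → Σ[ xs ] (λ _ → c) ≡ length xs * c
  Σ-const [] c = refl
  Σ-const (x ∷ xs) c = cong (c +_) (Σ-const xs c)

  Σ-⊆ : ∀ {xs ys : List A} → xs ⊆ ys → ∀ f → Σ[ xs ] f ≤ Σ[ ys ] f
  Σ-⊆ [] f = z≤n
  Σ-⊆ (y ∷ʳ s) f = ≤-trans (Σ-⊆ s f) (m≤n+m _ _)
  Σ-⊆ (refl ∷ s) f = +-monoʳ-≤ _ (Σ-⊆ s f)

  subs-mono : ∀ k {xs ys : List A} → xs ⊆ ys → ∀ f → Σ[ subs k xs ] f ≤ Σ[ subs k ys ] f
  subs-mono zero s f = ≤-refl
  subs-mono (suc k) [] f = z≤n
  subs-mono (suc k) {xs} {_ ∷ ys} (y ∷ʳ s) f = ≤-trans (subs-mono (suc k) s f) (≤-trans (m≤n+m _ _) (≤-reflexive (sym (Σ-subs-∷ k y ys f))))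
  subs-mono (suc k) {x ∷ xs} {_ ∷ ys} (refl ∷ s) f = begin
    Σ[ subs (suc k) (x ∷ xs) ] f ≡⟨ Σ-subs-∷ k x xs f ⟩
    _ ≤⟨ +-mono-≤ (subs-mono k s _) (subs-mono (suc k) s f) ⟩
    _ ≡⟨ sym (Σ-subs-∷ k x ys f) ⟩
    Σ[ subs (suc k) (x ∷ ys) ] f ∎
    where open ≤-Reasoning

  subs-⊆ : ∀ k (xs : List A) {u} → u ∈ subs k xs → u ⊆ xs
  subs-⊆ zero xs (here refl) = minimum xs
  subs-⊆ (suc k) (x ∷ xs) u∈ with ∈-++⁻ (map (x ∷_) (subs k xs)) u∈
  ... | inj₂ u∈′ = x ∷ʳ subs-⊆ (suc k) xs u∈′
  ... | inj₁ u∈′ with ∈-map⁻ (x ∷_) u∈′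
  ...   | v , v∈ , refl = refl ∷ subs-⊆ k xs v∈

  ∈-subs : ∀ {xs u : List A} → u ⊆ xs → u ∈ subs (length u) xs
  ∈-subs [] = here refl
  ∈-subs {u = []} (y ∷ʳ s) = here refl
  ∈-subs {u = x ∷ u} (y ∷ʳ s) = ∈-++⁺ʳ _ (∈-subs s)
  ∈-subs {u = x ∷ u} (refl ∷ s) = ∈-++⁺ˡ (∈-map⁺ (x ∷_) (∈-subs s))

  subs-map : ∀ (h : A → B) k xs → subs k (map h xs) ≡ map (map h) (subs k xs)
  subs-map h zero xs = refl
  subs-map h (suc k) [] = refl
  subs-map h (suc k) (x ∷ xs) = begin
    map (h x ∷_) (subs k (map h xs)) ++ subs (suc k) (map h xs)
      ≡⟨ cong₂ _++_ (cong (map (h x ∷_)) (subs-map h k xs)) (subs-map h (suc k) xs) ⟩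
    map (h x ∷_) (map (map h) (subs k xs)) ++ map (map h) (subs (suc k) xs)
      ≡⟨ cong (_++ _) (trans (sym (Listₚ.map-∘ (subs k xs))) (Listₚ.map-∘ (subs k xs))) ⟩
    map (map h) (map (x ∷_) (subs k xs)) ++ map (map h) (subs (suc k) xs)
      ≡⟨ sym (Listₚ.map-++ (map h) (map (x ∷_) (subs k xs)) _) ⟩
    map (map h) (map (x ∷_) (subs k xs) ++ subs (suc k) xs) ∎
    where open ≡-Reasoning

  Σ-subs-map : ∀ (h : A → B) k xs f → Σ[ subs k (map h xs) ] f ≡ Σ[ subs k xs ] (f ∘ map h)
  Σ-subs-map h k xs f = trans (cong (λ l → Σ[ l ] f) (subs-map h k xs)) (Σ-map (map h) (subs k xs) f)

  length-subs : ∀ k (xs : List A) → length (subs k xs) ≡ length xs C k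
  length-subs zero xs = refl
  length-subs (suc k) [] = refl
  length-subs (suc k) (x ∷ xs) = begin
    length (map (x ∷_) (subs k xs) ++ subs (suc k) xs) ≡⟨ Listₚ.length-++ (map (x ∷_) (subs k xs)) ⟩
    length (map (x ∷_) (subs k xs)) + length (subs (suc k) xs)
      ≡⟨ cong₂ _+_ (trans (Listₚ.length-map (x ∷_) (subs k xs)) (length-subs k xs)) (length-subs (suc k) xs) ⟩
    length xs C k + length xs C suc k ≡⟨ nCk+nC[k+1]≡[n+1]C[k+1] (length xs) k ⟩
    suc (length xs) C suc k ∎
    where open ≡-Reasoning

  sel-length : ∀ k (xs : List A) {T R} → (T , R) ∈ sel k xs → length R ≡ length xs ∸ k
  sel-length zero xs (here refl) = refl
  sel-length (suc k) (x ∷ xs) p with ∈-++⁻ (map (λ (t , r) → x ∷ t , r) (sel k xs)) p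
  ... | inj₁ q with ∈-map⁻ _ q
  ...   | (T , R) , r , refl = sel-length k xs r
  sel-length (suc k) (x ∷ xs) p | inj₂ q with ∈-map⁻ _ q
  ...   | (T , R) , r , refl with suc k ≤? length xs
  ...     | yes le = trans (cong suc (sel-length (suc k) xs r)) (sym (+-∸-assoc 1 le))
  ...     | no  gt rewrite sel-short (suc k) xs (≰⇒> gt) with () ← r

  Σ-sel-fst : ∀ k (xs : List A) (F : List A → ℕ) → Σ[ sel k xs ] (λ (T , _) → F T) ≡ Σ[ subs k xs ] F
  Σ-sel-fst zero xs F = refl
  Σ-sel-fst (suc k) [] F = refl
  Σ-sel-fst (suc k) (x ∷ xs) F = trans (Σ-sel-∷ k x xs _)
    (trans (cong₂ _+_ (Σ-sel-fst k xs _) (Σ-sel-fst (suc k) xs F)) (sym (Σ-subs-∷ k x xs F)))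

  -- A j-sublist extends to a (j + b)-sublist by choosing b of the remaining elements. Every
  -- averaging argument below uses this identity or its version over ℤ.
  subs-of-subs : ∀ j b (P : List A) (F : List A → ℕ) →
    Σ[ subs (j + b) P ] (λ S → Σ[ subs j S ] F) ≡ ((length P ∸ j) C b) * Σ[ subs j P ] F
  subs-of-subs j b P F = begin
    Σ[ subs (j + b) P ] (λ S → Σ[ subs j S ] F)
      ≡⟨ Σ-cong (subs (j + b) P) (λ S → sym (Σ-sel-fst j S F)) ⟩
    Σ[ subs (j + b) P ] (λ S → Σ[ sel j S ] (λ (T , U) → F T))
      ≡⟨ sym (Σ-sel-subs j b P (λ T _ → F T)) ⟩
    Σ[ sel j P ] (λ (T , R) → Σ[ subs b R ] (λ _ → F T))
      ≡⟨ Σ-cong∈ (sel j P) (λ (T , R) p → trans (Σ-const (subs b R) (F T))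
           (cong (_* F T) (trans (length-subs b R) (cong (_C b) (sel-length j P p))))) ⟩
    Σ[ sel j P ] (λ (T , R) → ((length P ∸ j) C b) * F T) ≡⟨ Σ-*ˡ ((length P ∸ j) C b) (sel j P) (λ (T , _) → F T) ⟩
    ((length P ∸ j) C b) * Σ[ sel j P ] (λ (T , R) → F T) ≡⟨ cong (((length P ∸ j) C b) *_) (Σ-sel-fst j P F) ⟩
    ((length P ∸ j) C b) * Σ[ subs j P ] F ∎
    where open ≡-Reasoning

  -- Inequalities between binomial coefficients and powers.

  C-suc : ∀ n k → suc n C suc k ≡ n C k + n C suc k
  C-suc n k = sym (nCk+nC[k+1]≡[n+1]C[k+1] n k)

  C-mono : ∀ {m n} k → m ≤ n → m C k ≤ n C k
  C-mono zero m≤n = ≤-refl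
  C-mono {zero} (suc k) m≤n = z≤n
  C-mono {suc m} {suc n} (suc k) (s≤s m≤n) = begin
    suc m C suc k ≡⟨ C-suc m k ⟩
    m C k + m C suc k ≤⟨ +-mono-≤ (C-mono k m≤n) (C-mono (suc k) m≤n) ⟩
    n C k + n C suc k ≡⟨ sym (C-suc n k) ⟩
    suc n C suc k ∎
    where open ≤-Reasoning

  C-absorb : ∀ n k → suc k * (suc n C suc k) ≡ suc n * (n C k)
  C-absorb zero zero = refl
  C-absorb zero (suc k) = *-zeroʳ (suc (suc k))
  C-absorb (suc n) zero = trans (*-identityˡ (suc (suc n) C 1)) (trans (nC1≡n (suc (suc n))) (sym (*-identityʳ _)))
  C-absorb (suc n) (suc k) = begin
    suc (suc k) * (suc (suc n) C suc (suc k))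
      ≡⟨ cong (suc (suc k) *_) (C-suc (suc n) (suc k)) ⟩
    suc (suc k) * ((suc n C suc k) + (suc n C suc (suc k)))
      ≡⟨ *-distribˡ-+ (suc (suc k)) (suc n C suc k) _ ⟩
    (suc n C suc k + suc k * (suc n C suc k)) + suc (suc k) * (suc n C suc (suc k))
      ≡⟨ cong₂ (λ a b → (suc n C suc k + a) + b) (C-absorb n k) (C-absorb n (suc k)) ⟩
    (suc n C suc k + suc n * (n C k)) + suc n * (n C suc k)
      ≡⟨ +-assoc (suc n C suc k) _ _ ⟩
    suc n C suc k + (suc n * (n C k) + suc n * (n C suc k))
      ≡⟨ cong (suc n C suc k +_) (sym (*-distribˡ-+ (suc n) (n C k) _)) ⟩
    suc n C suc k + suc n * (n C k + n C suc k)
      ≡⟨ cong (λ z → suc n C suc k + suc n * z) (sym (C-suc n k)) ⟩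
    suc (suc n) * (suc n C suc k) ∎
    where open ≡-Reasoning

  C-step : ∀ n k → suc k * (n C suc k) ≡ (n ∸ k) * (n C k)
  C-step n k with k ≤? n
  ... | no k≰n = trans (trans (cong (suc k *_) (k>n⇒nCk≡0 (m<n⇒m<1+n (≰⇒> k≰n)))) (*-zeroʳ (suc k)))
                       (sym (cong (_* (n C k)) (m≤n⇒m∸n≡0 (≰⇒≥ k≰n))))
  ... | yes k≤n = +-cancelˡ-≡ (suc k * (n C k)) _ _ (begin
    suc k * (n C k) + suc k * (n C suc k) ≡⟨ sym (*-distribˡ-+ (suc k) (n C k) _) ⟩
    suc k * (n C k + n C suc k) ≡⟨ cong (suc k *_) (sym (C-suc n k)) ⟩
    suc k * (suc n C suc k) ≡⟨ C-absorb n k ⟩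
    suc n * (n C k) ≡⟨ cong (λ z → suc z * (n C k)) (sym (m+[n∸m]≡n k≤n)) ⟩
    (suc k + (n ∸ k)) * (n C k) ≡⟨ *-distribʳ-+ (n C k) (suc k) (n ∸ k) ⟩
    suc k * (n C k) + (n ∸ k) * (n C k) ∎)
    where open ≡-Reasoning

  C≤^ : ∀ n k → n C k ≤ n ^ k
  C≤^ n zero = ≤-refl
  C≤^ n (suc k) = begin
    n C suc k ≤⟨ m≤m+n _ _ ⟩
    suc k * (n C suc k) ≡⟨ C-step n k ⟩
    (n ∸ k) * (n C k) ≤⟨ *-mono-≤ (m∸n≤m n k) (C≤^ n k) ⟩
    n * n ^ k ∎
    where open ≤-Reasoning

  C>0 : ∀ {n k} → k ≤ n → 0 < n C k
  C>0 {n} {k} k≤n = ≤-trans (≤-reflexive (sym (nCn≡1 k))) (C-mono k k≤n)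

  ≤4* : ∀ {n r} J → n ≤ 2 * r → 2 * J ≤ r → n ≤ 4 * (r ∸ J)
  ≤4* {n} {r} J n≤ J≤ with m≤n⇒∃[o]m+o≡n J≤
  ... | d , refl = begin
    n ≤⟨ n≤ ⟩
    2 * (2 * J + d) ≤⟨ m≤m+n _ (2 * d) ⟩
    2 * (2 * J + d) + 2 * d ≡⟨ eq J d ⟩
    4 * (J + d) ≡⟨ cong (4 *_) (sym (trans (cong (_∸ J) (assoc J d)) (m+n∸m≡n J (J + d)))) ⟩
    4 * (2 * J + d ∸ J) ∎
    where
    open ≤-Reasoning
    assoc : ∀ J d → 2 * J + d ≡ J + (J + d)
    assoc = solve-∀
    eq : ∀ J d → 2 * (2 * J + d) + 2 * d ≡ 4 * (J + d)
    eq = solve-∀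

  -- Falling factorials are compared factor by factor: if i ≤ r/2 and r ≥ n/2, then n - i ≤ 4(r -
  -- i).
  C-halve : ∀ {n r} J → n ≤ 2 * r → 2 * J ≤ r → n C J ≤ 4 ^ J * (r C J)
  C-halve zero _ _ = ≤-refl
  C-halve {n} {r} (suc J) n≤ J≤ = *-cancelˡ-≤ (suc J) (begin
    suc J * (n C suc J) ≡⟨ C-step n J ⟩
    (n ∸ J) * (n C J) ≤⟨ *-mono-≤ (≤-trans (m∸n≤m n J) (≤4* J n≤ J≤′)) (C-halve J n≤ J≤′) ⟩
    4 * (r ∸ J) * (4 ^ J * (r C J)) ≡⟨ ring₁ 4 (r ∸ J) (4 ^ J) (r C J) ⟩
    4 * 4 ^ J * ((r ∸ J) * (r C J)) ≡⟨ cong (4 * 4 ^ J *_) (sym (C-step r J)) ⟩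
    4 * 4 ^ J * (suc J * (r C suc J)) ≡⟨ ring₂ (4 * 4 ^ J) (suc J) (r C suc J) ⟩
    suc J * (4 ^ suc J * (r C suc J)) ∎)
    where
    open ≤-Reasoning
    J≤′ : 2 * J ≤ r
    J≤′ = ≤-trans (*-monoʳ-≤ 2 (n≤1+n J)) J≤
    ring₁ : ∀ f d p c → f * d * (p * c) ≡ f * p * (d * c)
    ring₁ = solve-∀
    ring₂ : ∀ a b c → a * (b * c) ≡ b * (a * c)
    ring₂ = solve-∀

  ^≤C : ∀ {n r} J → n ≤ 2 * r → 2 * J ≤ r → n ^ J ≤ 4 ^ J * (J ! * (r C J))
  ^≤C zero _ _ = ≤-refl
  ^≤C {n} {r} (suc J) n≤ J≤ = begin
    n * n ^ J ≤⟨ *-mono-≤ (≤4* J n≤ J≤′) (^≤C J n≤ J≤′) ⟩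
    4 * (r ∸ J) * (4 ^ J * (J ! * (r C J))) ≡⟨ ring₁ (r ∸ J) (4 ^ J) (J !) (r C J) ⟩
    4 * 4 ^ J * (J ! * ((r ∸ J) * (r C J))) ≡⟨ cong (λ z → 4 * 4 ^ J * (J ! * z)) (sym (C-step r J)) ⟩
    4 * 4 ^ J * (J ! * (suc J * (r C suc J))) ≡⟨ ring₂ (4 * 4 ^ J) (J !) (suc J) (r C suc J) ⟩
    4 ^ suc J * ((suc J) ! * (r C suc J)) ∎
    where
    open ≤-Reasoning
    J≤′ : 2 * J ≤ r
    J≤′ = ≤-trans (*-monoʳ-≤ 2 (n≤1+n J)) J≤
    ring₁ : ∀ d p f c → 4 * d * (p * (f * c)) ≡ 4 * p * (f * (d * c))
    ring₁ = solve-∀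
    ring₂ : ∀ a f s c → a * (f * (s * c)) ≡ a * (s * f * c)
    ring₂ = solve-∀

  -- Factor by factor, J(q - i) ≤ Jq - i. It compares choices inside one of J blocks of size q with
  -- choices from all Jq points.
  C-scale : ∀ J q k → 1 ≤ J → J ^ k * (q C k) ≤ (J * q) C k
  C-scale J q zero _ = ≤-refl
  C-scale J q (suc k) J≥1 = *-cancelˡ-≤ (suc k) (begin
    suc k * (J ^ suc k * (q C suc k)) ≡⟨ ring₁ (suc k) J (J ^ k) (q C suc k) ⟩
    J * (J ^ k) * (suc k * (q C suc k)) ≡⟨ cong (J * J ^ k *_) (C-step q k) ⟩
    J * (J ^ k) * ((q ∸ k) * (q C k)) ≡⟨ ring₂ J (J ^ k) (q ∸ k) (q C k) ⟩
    J * (q ∸ k) * (J ^ k * (q C k)) ≤⟨ *-mono-≤ le (C-scale J q k J≥1) ⟩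
    (J * q ∸ k) * ((J * q) C k) ≡⟨ sym (C-step (J * q) k) ⟩
    suc k * ((J * q) C suc k) ∎)
    where
    open ≤-Reasoning
    ring₁ : ∀ s J p c → s * (J * p * c) ≡ J * p * (s * c)
    ring₁ = solve-∀
    ring₂ : ∀ J p d c → J * p * (d * c) ≡ J * d * (p * c)
    ring₂ = solve-∀
    le : J * (q ∸ k) ≤ J * q ∸ k
    le = ≤-trans (≤-reflexive (*-distribˡ-∸ J q k)) (∸-monoʳ-≤ (J * q) (m≤n*m k J {{>-nonZero J≥1}}))

  -- A sublist that is not inside the first n points contains one of the d others, and the rest of
  -- it can be chosen in at most C(n + d, k) ways.
  C-shift : ∀ n d k → (n + d) C suc k ≤ n C suc k + d * ((n + d) C k)
  C-shift n zero k = ≤-reflexive (trans (cong (_C suc k) (+-identityʳ n)) (sym (+-identityʳ _)))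
  C-shift n (suc d) k = begin
    (n + suc d) C suc k ≡⟨ cong (_C suc k) (+-suc n d) ⟩
    suc (n + d) C suc k ≡⟨ C-suc (n + d) k ⟩
    (n + d) C k + (n + d) C suc k ≤⟨ +-mono-≤ (C-mono k n+d≤) (≤-trans (C-shift n d k) (+-monoʳ-≤ (n C suc k) (*-monoʳ-≤ d (C-mono k n+d≤)))) ⟩
    (n + suc d) C k + (n C suc k + d * ((n + suc d) C k)) ≡⟨ ring ((n + suc d) C k) (n C suc k) d ⟩
    n C suc k + suc d * ((n + suc d) C k) ∎
    where
    open ≤-Reasoning
    n+d≤ : n + d ≤ n + suc d
    n+d≤ = +-monoʳ-≤ n (n≤1+n d)
    ring : ∀ a b d → a + (b + d * a) ≡ b + suc d * a
    ring = solve-∀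

  -- Absorbs the error terms: a count of J-sublists times n is at most a constant times the count of
  -- (J + 1)-sublists.
  n*C≤ : ∀ n J → 2 * J ≤ n → n * (n C J) ≤ 2 * suc J * (n C suc J)
  n*C≤ n J J≤n = begin
    n * (n C J) ≤⟨ *-monoˡ-≤ (n C J) n≤ ⟩
    2 * (n ∸ J) * (n C J) ≡⟨ *-assoc 2 (n ∸ J) (n C J) ⟩
    2 * ((n ∸ J) * (n C J)) ≡⟨ cong (2 *_) (sym (C-step n J)) ⟩
    2 * (suc J * (n C suc J)) ≡⟨ sym (*-assoc 2 (suc J) _) ⟩
    2 * suc J * (n C suc J) ∎
    where
    open ≤-Reasoning
    n≤ : n ≤ 2 * (n ∸ J)
    n≤ with m≤n⇒∃[o]m+o≡n J≤n
    ... | d , refl = subst (2 * J + d ≤_) (cong (2 *_) (sym (trans (cong (_∸ J) (eq J d)) (m+n∸m≡n J (J + d)))))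
      (≤-trans (+-monoʳ-≤ (2 * J) (m≤n*m d 2)) (≤-reflexive (sym (*-distribˡ-+ 2 J d))))
      where
      eq : ∀ J d → 2 * J + d ≡ J + (J + d)
      eq = solve-∀

-- Minimal counts over words and permutations; reduction of distinct keys to ranks.

module Minima where

  open Counting
  open import Data.Bool using (true; false; _∧_; _∨_; T)
  open import Data.Bool.Properties using (T-≡)
  open import Data.Nat using (ℕ; zero; suc; z≤n; s≤s; _≤_; _<_; _⊓_; _≤ᵇ_; _<ᵇ_; s≤s⁻¹)
  open import Data.Nat.Properties
  open import Data.List using (List; []; _∷_; map; _++_; length; foldr; upTo)
  import Data.List.Properties as Listₚ
  open import Data.List.Membership.Propositional using (_∈_; lose; find)
  open import Data.List.Membership.Propositional.Properties using (∈-map⁺; ∈-map⁻; ∈-++⁺ˡ; ∈-++⁺ʳ; ∈-++⁻; ∈-∃++; ∈-concatMap⁺; ∈-concatMap⁻; ∈-upTo⁺; ∈-upTo⁻)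
  open import Data.List.Relation.Unary.Any using (here; there)
  open import Data.List.Relation.Unary.All as All using (All; []; _∷_)
  open import Data.List.Relation.Unary.AllPairs using ([]; _∷_)
  open import Data.List.Relation.Unary.Unique.Propositional using (Unique)
  open import Data.List.Relation.Binary.Permutation.Propositional using (_↭_; ↭-refl; ↭-sym; ↭-trans; prep; swap; ↭⇒↭ₛ)
  open import Data.List.Relation.Binary.Permutation.Propositional.Properties using (↭-length; shift; drop-mid; ∈-resp-↭)
  import Data.List.Relation.Binary.Permutation.Setoid.Properties as Permₛ
  open import Data.List.Relation.Binary.Sublist.Propositional using (_⊆_; lookup)
  open import Data.Product using (_×_; _,_; ∃-syntax)
  open import Data.Sum using (inj₁; inj₂)
  open import Function using (_∘_; Equivalence)
  open import Relation.Nullary using (yes; no; contradiction)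
  open import Relation.Binary.Definitions using (tri<; tri≈; tri>)
  open import Relation.Binary.PropositionalEquality as ≡ using (_≡_; _≢_; refl; sym; cong; cong₂; subst; setoid; module ≡-Reasoning)

  private variable
    A B : Set

  foldr-⊓-≤ : ∀ x xs → foldr _⊓_ x xs ≤ x
  foldr-⊓-≤ x [] = ≤-refl
  foldr-⊓-≤ x (y ∷ ys) = ≤-trans (m⊓n≤n y _) (foldr-⊓-≤ x ys)

  foldr-⊓-≤∈ : ∀ x xs {y} → y ∈ xs → foldr _⊓_ x xs ≤ y
  foldr-⊓-≤∈ x (y ∷ ys) (here refl) = m⊓n≤m y _
  foldr-⊓-≤∈ x (y ∷ ys) (there p) = ≤-trans (m⊓n≤n y _) (foldr-⊓-≤∈ x ys p)

  minL-≤ : ∀ {xs y} → y ∈ xs → minL xs ≤ y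
  minL-≤ {x ∷ xs} (here refl) = foldr-⊓-≤ x xs
  minL-≤ {x ∷ xs} (there p) = foldr-⊓-≤∈ x xs p

  foldr-⊓-∈ : ∀ x xs → foldr _⊓_ x xs ∈ x ∷ xs
  foldr-⊓-∈ x [] = here refl
  foldr-⊓-∈ x (y ∷ ys) with ⊓-sel y (foldr _⊓_ x ys)
  ... | inj₁ e = there (here e)
  ... | inj₂ e with foldr-⊓-∈ x ys
  ...   | here p  = here (≡.trans e p)
  ...   | there p = there (there (subst (_∈ ys) (sym e) p))

  minL-∈ : ∀ {xs y} → y ∈ xs → minL xs ∈ xs
  minL-∈ {x ∷ xs} _ = foldr-⊓-∈ x xs

  ∈-words⁺ : ∀ s {w} → All (_< s) w → w ∈ words s (length w)
  ∈-words⁺ s [] = here refl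
  ∈-words⁺ s {a ∷ w} (p ∷ ps) = ∈-concatMap⁺ _ (lose (∈-upTo⁺ p) (∈-map⁺ (a ∷_) (∈-words⁺ s ps)))

  ∈-words⁻ : ∀ s n {w} → w ∈ words s n → All (_< s) w × length w ≡ n
  ∈-words⁻ s zero (here refl) = [] , refl
  ∈-words⁻ s (suc n) w∈ with find (∈-concatMap⁻ (λ a → map (a ∷_) (words s n)) {xs = upTo s} w∈)
  ... | a , a∈ , w∈′ with ∈-map⁻ (a ∷_) w∈′
  ...   | v , v∈ , refl with ∈-words⁻ s n v∈
  ...     | ps , e = ∈-upTo⁻ a∈ ∷ ps , cong suc e

  inserts-↭ : ∀ x ys {zs} → zs ∈ inserts x ys → zs ↭ x ∷ ys
  inserts-↭ x [] (here refl) = ↭-refl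
  inserts-↭ x (y ∷ ys) (here refl) = ↭-refl
  inserts-↭ x (y ∷ ys) (there p) with ∈-map⁻ (y ∷_) p
  ... | zs , q , refl = ↭-trans (prep y (inserts-↭ x ys q)) (swap y x ↭-refl)

  perms-↭ : ∀ xs {π} → π ∈ perms xs → π ↭ xs
  perms-↭ [] (here refl) = ↭-refl
  perms-↭ (x ∷ xs) p with find (∈-concatMap⁻ (inserts x) {xs = perms xs} p)
  ... | ρ , ρ∈ , q = ↭-trans (inserts-↭ x ρ q) (prep x (perms-↭ xs ρ∈))

  ∈-inserts : ∀ x as bs → as ++ x ∷ bs ∈ inserts x (as ++ bs)
  ∈-inserts x [] [] = here refl
  ∈-inserts x [] (b ∷ bs) = here refl
  ∈-inserts x (a ∷ as) bs = there (∈-map⁺ (a ∷_) (∈-inserts x as bs))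

  ↭-[] : {xs : List A} → xs ↭ [] → xs ≡ []
  ↭-[] {xs = []} p = refl
  ↭-[] {xs = x ∷ xs} p with () ← ↭-length p

  ↭-perms : ∀ xs {π} → π ↭ xs → π ∈ perms xs
  ↭-perms [] p rewrite ↭-[] p = here refl
  ↭-perms (x ∷ xs) {π} p with ∈-∃++ (∈-resp-↭ (↭-sym p) (here refl))
  ... | as , bs , refl = ∈-concatMap⁺ (inserts x) (lose (↭-perms xs (drop-mid as [] p)) (∈-inserts x as bs))

  Unique-↭ : {xs ys : List A} → xs ↭ ys → Unique xs → Unique ys
  Unique-↭ {A = A} p = Permₛ.Unique-resp-↭ (setoid A) (↭⇒↭ₛ p)

  -- Pigeonhole principle: the distinct elements of xs already occupy length xs places of ys, and
  -- the bound on the length of ys leaves no further place.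
  unique-↭ : ∀ {xs ys : List A} → Unique xs → (∀ {x} → x ∈ xs → x ∈ ys) → length ys ≤ length xs → xs ↭ ys
  unique-↭ {xs = []} {[]} _ _ _ = ↭-refl
  unique-↭ {xs = x ∷ xs} {ys} (x∉ ∷ u) sub le with ∈-∃++ (sub (here refl))
  ... | as , bs , refl = ↭-trans (prep x (unique-↭ u sub′ le′)) (↭-sym (shift x as bs))
    where
    sub′ : ∀ {z} → z ∈ xs → z ∈ as ++ bs
    sub′ z∈ with ∈-++⁻ as (sub (there z∈))
    ... | inj₁ p = ∈-++⁺ˡ p
    ... | inj₂ (here refl) = contradiction refl (All.lookup x∉ z∈)
    ... | inj₂ (there p) = ∈-++⁺ʳ as p
    le′ : length (as ++ bs) ≤ length xs
    le′ = s≤s⁻¹ (subst (_≤ suc (length xs)) (↭-length (shift x as bs)) le)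

  ≤ᵇ-mono : ∀ {a b} → a ≤ b → (a ≤ᵇ b) ≡ true
  ≤ᵇ-mono a≤b = Equivalence.to T-≡ (≤⇒≤ᵇ a≤b)

  ≤ᵇ-anti : ∀ {a b} → b < a → (a ≤ᵇ b) ≡ false
  ≤ᵇ-anti {a} {b} b<a with a ≤ᵇ b in e
  ... | false = refl
  ... | true  = contradiction (≤ᵇ⇒≤ a b (subst T (sym e) _)) (<⇒≱ b<a)

  ≤ᵇ-true : ∀ {a b} → (a ≤ᵇ b) ≡ true → a ≤ b
  ≤ᵇ-true {a} {b} e = ≤ᵇ⇒≤ a b (subst T (sym e) _)

  OrderIso : (ℕ → ℕ) → List ℕ → Set
  OrderIso f ks = ∀ {a b} → a ∈ ks → b ∈ ks → (f a ≤ᵇ f b) ≡ (a ≤ᵇ b)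

  nondec-iso : ∀ f u → OrderIso f u → nondec (map f u) ≡ nondec u
  nondec-iso f [] e = refl
  nondec-iso f (x ∷ []) e = refl
  nondec-iso f (x ∷ y ∷ r) e = cong₂ _∧_ (e (here refl) (there (here refl))) (nondec-iso f (y ∷ r) (λ p q → e (there p) (there q)))

  noninc-iso : ∀ f u → OrderIso f u → noninc (map f u) ≡ noninc u
  noninc-iso f [] e = refl
  noninc-iso f (x ∷ []) e = refl
  noninc-iso f (x ∷ y ∷ r) e = cong₂ _∧_ (e (there (here refl)) (here refl)) (noninc-iso f (y ∷ r) (λ p q → e (there p) (there q)))

  m-iso : ∀ f k ks → OrderIso f ks → m k (map f ks) ≡ m k ks
  m-iso f k ks e = begin
    m k (map f ks) ≡⟨ m-Σ k (map f ks) ⟩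
    Σ[ subs k (map f ks) ] (ind ∘ monotone) ≡⟨ Σ-subs-map f k ks _ ⟩
    Σ[ subs k ks ] (ind ∘ monotone ∘ map f) ≡⟨ Σ-cong∈ (subs k ks) (λ u u∈ → cong ind (iso u (subs-⊆ k ks u∈))) ⟩
    Σ[ subs k ks ] (ind ∘ monotone) ≡⟨ sym (m-Σ k ks) ⟩
    m k ks ∎
    where
    open ≡-Reasoning
    iso : ∀ u → u ⊆ ks → monotone (map f u) ≡ monotone u
    iso u s = cong₂ _∨_ (nondec-iso f u (λ p q → e (lookup s p) (lookup s q))) (noninc-iso f u (λ p q → e (lookup s p) (lookup s q)))

  rank : List ℕ → ℕ → ℕ
  rank ks v = Σ[ ks ] (λ u → ind (u <ᵇ v))

  ind-<ᵇ-mono : ∀ u {a b} → a ≤ b → ind (u <ᵇ a) ≤ ind (u <ᵇ b)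
  ind-<ᵇ-mono u {a} {b} a≤b with u <ᵇ a in e
  ... | false = z≤n
  ... | true rewrite Equivalence.to T-≡ (<⇒<ᵇ (<-≤-trans (<ᵇ⇒< u a (subst T (sym e) _)) a≤b)) = ≤-refl

  rank-mono : ∀ ks {a b} → a ≤ b → rank ks a ≤ rank ks b
  rank-mono ks a≤b = Σ-mono ks (λ u → ind-<ᵇ-mono u a≤b)

  <ᵇ-irrefl : ∀ a → (a <ᵇ a) ≡ false
  <ᵇ-irrefl zero = refl
  <ᵇ-irrefl (suc a) = <ᵇ-irrefl a

  <ᵇ-true : ∀ {a b} → a < b → (a <ᵇ b) ≡ true
  <ᵇ-true a<b = Equivalence.to T-≡ (<⇒<ᵇ a<b)

  Σ-strict : ∀ (xs : List A) {f g : A → ℕ} {z} → z ∈ xs → (∀ x → f x ≤ g x) → f z < g z → Σ[ xs ] f < Σ[ xs ] g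
  Σ-strict (x ∷ xs) (here refl) le lt = +-mono-<-≤ lt (Σ-mono xs le)
  Σ-strict (x ∷ xs) (there z∈) le lt = +-mono-≤-< (le x) (Σ-strict xs z∈ le lt)

  rank-strict : ∀ ks {a b} → a ∈ ks → a < b → rank ks a < rank ks b
  rank-strict ks {a} {b} a∈ a<b = Σ-strict ks a∈ (λ u → ind-<ᵇ-mono u (<⇒≤ a<b)) lem
    where
    lem : ind (a <ᵇ a) < ind (a <ᵇ b)
    lem rewrite <ᵇ-irrefl a | <ᵇ-true a<b = s≤s z≤n

  rank-iso : ∀ ks → OrderIso (rank ks) ks
  rank-iso ks {a} {b} a∈ b∈ with a ≤? b
  ... | yes a≤b = ≡.trans (≤ᵇ-mono (rank-mono ks a≤b)) (sym (≤ᵇ-mono a≤b))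
  ... | no  a≰b = ≡.trans (≤ᵇ-anti (rank-strict ks b∈ (≰⇒> a≰b))) (sym (≤ᵇ-anti (≰⇒> a≰b)))

  rank-< : ∀ ks {a} → a ∈ ks → rank ks a < length ks
  rank-< ks {a} a∈ = subst (rank ks a <_) (≡.trans (Σ-const ks 1) (*-identityʳ _))
    (Σ-strict ks a∈ (λ u → ind≤1 (u <ᵇ a)) lem)
    where
    lem : ind (a <ᵇ a) < 1
    lem rewrite <ᵇ-irrefl a = s≤s z≤n

  rank-injective : ∀ ks {a b} → a ∈ ks → b ∈ ks → rank ks a ≡ rank ks b → a ≡ b
  rank-injective ks {a} {b} a∈ b∈ e with <-cmp a b
  ... | tri< a<b _ _ = contradiction e (<⇒≢ (rank-strict ks a∈ a<b))
  ... | tri≈ _ a≡b _ = a≡b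
  ... | tri> _ _ b<a = contradiction (sym e) (<⇒≢ (rank-strict ks b∈ b<a))

  Unique-map∈ : ∀ (f : A → B) {xs} → (∀ {x y} → x ∈ xs → y ∈ xs → f x ≡ f y → x ≡ y) → Unique xs → Unique (map f xs)
  Unique-map∈ f {[]} inj [] = []
  Unique-map∈ f {x ∷ xs} inj (x∉ ∷ u) = All.tabulate fx∉ ∷ Unique-map∈ f (λ p q → inj (there p) (there q)) u
    where
    fx∉ : ∀ {z} → z ∈ map f xs → f x ≢ z
    fx∉ z∈ fx≡z with ∈-map⁻ f z∈
    ... | y , y∈ , refl = All.lookup x∉ y∈ (inj (here refl) (there y∈) fx≡z)

  ranks-↭ : ∀ ks → Unique ks → map (rank ks) ks ↭ upTo (length ks)
  ranks-↭ ks u = unique-↭ (Unique-map∈ (rank ks) (rank-injective ks) u) sub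
    (≤-reflexive (≡.trans (Listₚ.length-upTo _) (sym (Listₚ.length-map (rank ks) ks))))
    where
    sub : ∀ {x} → x ∈ map (rank ks) ks → x ∈ upTo (length ks)
    sub x∈ with ∈-map⁻ (rank ks) x∈
    ... | y , y∈ , refl = ∈-upTo⁺ (rank-< ks y∈)

  gmin : ℕ → ℕ → ℕ
  gmin k n = minL (map (m k) (perms (upTo n)))

  fmin : ℕ → ℕ → ℕ → ℕ
  fmin s k n = minL (map (m k) (words s n))

  -- Replacing each key by its rank gives a permutation of 0, ..., n - 1, and monotonicity depends
  -- only on the relative order. Constructions may therefore use any distinct numbers as values.
  gmin-≤ : ∀ k ks → Unique ks → gmin k (length ks) ≤ m k ks
  gmin-≤ k ks u = subst (gmin k (length ks) ≤_) (m-iso (rank ks) k ks (rank-iso ks))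
    (minL-≤ (∈-map⁺ (m k) (↭-perms _ (ranks-↭ ks u))))

  gmin-attained : ∀ k n → ∃[ π ] (π ↭ upTo n × gmin k n ≡ m k π)
  gmin-attained k n with ∈-map⁻ (m k) (minL-∈ (∈-map⁺ (m k) (↭-perms (upTo n) ↭-refl)))
  ... | π , π∈ , e = π , perms-↭ (upTo n) π∈ , e

  fmin-≤ : ∀ s k w → All (_< s) w → fmin s k (length w) ≤ m k w
  fmin-≤ s k w p = minL-≤ (∈-map⁺ (m k) (∈-words⁺ s p))


  words-inhabited : ∀ s n → ∃[ w ] w ∈ words (suc s) n
  words-inhabited s zero = [] , here refl
  words-inhabited s (suc n) with words-inhabited s n
  ... | w , w∈ = 0 ∷ w , ∈-concatMap⁺ (λ a → map (a ∷_) (words (suc s) n)) (lose (∈-upTo⁺ {suc s} (s≤s z≤n)) (∈-map⁺ (0 ∷_) w∈))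

  fmin-attained : ∀ s k n → ∃[ w ] (All (_< suc s) w × length w ≡ n × fmin (suc s) k n ≡ m k w)
  fmin-attained s k n with words-inhabited s n
  ... | w₀ , w₀∈ with ∈-map⁻ (m k) (minL-∈ (∈-map⁺ (m k) w₀∈))
  ...   | w , w∈ , e with ∈-words⁻ (suc s) n w∈
  ...     | p , l = w , p , l , e

-- Upper bound for f - g: merging values of a permutation.

module Coarsening where

  open Counting
  open Minima
  open import Data.Bool using (Bool; true; false; _∧_; _∨_; T)
  open import Data.Bool.Properties using (T-≡)
  open import Data.Nat using (ℕ; zero; suc; z≤n; s≤s; _+_; _*_; _∸_; _≤_; _<_; _⊓_; _≤ᵇ_; _≡ᵇ_; NonZero; _/_)
  open import Data.Nat.Properties
  open import Data.Nat.DivMod using (/-mono-≤; m<n*o⇒m/o<n; m/n*n≤m; m≡m%n+[m/n]*n; m%n<n)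
  open import Data.Nat.Combinatorics using (_C_)
  open import Data.Nat.Tactic.RingSolver using (solve-∀)
  open import Data.List using (List; []; _∷_; [_]; map; _++_; length; upTo)
  import Data.List.Properties as Listₚ
  open import Data.List.Membership.Propositional.Properties using (∈-upTo⁻)
  open import Data.List.Relation.Unary.All as All using (All)
  import Data.List.Relation.Unary.All.Properties as Allₚ
  open import Data.List.Relation.Binary.Permutation.Propositional using (_↭_; prep; refl; swap; trans)
  open import Data.List.Relation.Binary.Permutation.Propositional.Properties using (↭-length; ∈-resp-↭)
  open import Data.Product using (_×_; _,_)
  open import Data.Sum using (inj₁; inj₂; _⊎_)
  open import Function using (_∘_; Equivalence)
  open import Relation.Nullary using (yes; no)
  open import Relation.Binary.PropositionalEquality as ≡ using (_≡_; refl; sym; cong; cong₂; subst)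

  private variable
    A : Set

  Σ-↭ : ∀ {xs ys : List A} → xs ↭ ys → ∀ f → Σ[ xs ] f ≡ Σ[ ys ] f
  Σ-↭ refl f = refl
  Σ-↭ (prep x p) f = cong (f x +_) (Σ-↭ p f)
  Σ-↭ (swap x y p) f = ≡.trans (sym (+-assoc (f x) (f y) _)) (≡.trans (cong₂ _+_ (+-comm (f x) (f y)) (Σ-↭ p f)) (+-assoc (f y) (f x) _))
  Σ-↭ (trans p q) f = ≡.trans (Σ-↭ p f) (Σ-↭ q f)

  ≡ᵇ-true : ∀ {a b} → (a ≡ᵇ b) ≡ true → a ≡ b
  ≡ᵇ-true {a} {b} e = ≡ᵇ⇒≡ a b (subst T (sym e) _)

  ≡ᵇ-refl : ∀ a → (a ≡ᵇ a) ≡ true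
  ≡ᵇ-refl a = Equivalence.to T-≡ (≡⇒≡ᵇ a a refl)

  ∧-true : ∀ {a b} → a ∧ b ≡ true → a ≡ true × b ≡ true
  ∧-true {true} e = refl , e

  ∨-false : ∀ {a b} → a ∨ b ≡ false → a ≡ false × b ≡ false
  ∨-false {false} e = refl , e

  ∨-true : ∀ {a b} → a ∨ b ≡ true → a ≡ true ⊎ b ≡ true
  ∨-true {true} e = inj₁ refl
  ∨-true {false} e = inj₂ e

  ind-∨ : ∀ a b → ind (a ∨ b) ≤ ind a + ind b
  ind-∨ true  b = s≤s z≤n
  ind-∨ false b = ≤-refl

  ∨-trueʳ : ∀ a {b} → b ≡ true → a ∨ b ≡ true
  ∨-trueʳ true _ = refl
  ∨-trueʳ false e = e

  ∨-trueˡ : ∀ {a} b → a ≡ true → a ∨ b ≡ true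
  ∨-trueˡ b refl = refl

  ∧-intro : ∀ {a b} → a ≡ true → b ≡ true → a ∧ b ≡ true
  ∧-intro refl refl = refl

  module Merge (φ : ℕ → ℕ) (φ-mono : ∀ {a b} → a ≤ b → φ a ≤ φ b) where

    -- Looking at neighbours is enough: in a subword whose image under φ is monotone, equal images
    -- stand next to each other.
    adjTie : List ℕ → Bool
    adjTie [] = false
    adjTie (x ∷ []) = false
    adjTie (x ∷ y ∷ r) = (φ x ≡ᵇ φ y) ∨ adjTie (y ∷ r)

    φ-reflects : ∀ {a b} → (φ a ≡ᵇ φ b) ≡ false → φ a ≤ φ b → a ≤ b
    φ-reflects {a} {b} ne le with a ≤? b
    ... | yes p = p
    ... | no  q with () ← ≡.trans (sym ne) (subst (λ z → (φ a ≡ᵇ z) ≡ true) (≤-antisym le (φ-mono (<⇒≤ (≰⇒> q)))) (≡ᵇ-refl (φ a)))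

    ≡ᵇ-sym : ∀ a b → (a ≡ᵇ b) ≡ (b ≡ᵇ a)
    ≡ᵇ-sym zero zero = refl
    ≡ᵇ-sym zero (suc b) = refl
    ≡ᵇ-sym (suc a) zero = refl
    ≡ᵇ-sym (suc a) (suc b) = ≡ᵇ-sym a b

    nondec-φ : ∀ u → adjTie u ≡ false → nondec (map φ u) ≡ true → nondec u ≡ true
    nondec-φ [] _ _ = refl
    nondec-φ (x ∷ []) _ _ = refl
    nondec-φ (x ∷ y ∷ r) t e =
      let t₁ , t₂ = ∨-false {φ x ≡ᵇ φ y} t ; e₁ , e₂ = ∧-true {φ x ≤ᵇ φ y} e
      in ∧-intro (≤ᵇ-mono (φ-reflects t₁ (≤ᵇ-true e₁))) (nondec-φ (y ∷ r) t₂ e₂)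

    noninc-φ : ∀ u → adjTie u ≡ false → noninc (map φ u) ≡ true → noninc u ≡ true
    noninc-φ [] _ _ = refl
    noninc-φ (x ∷ []) _ _ = refl
    noninc-φ (x ∷ y ∷ r) t e =
      let t₁ , t₂ = ∨-false {φ x ≡ᵇ φ y} t ; e₁ , e₂ = ∧-true {φ y ≤ᵇ φ x} e
      in ∧-intro (≤ᵇ-mono (φ-reflects (≡.trans (≡ᵇ-sym (φ y) (φ x)) t₁) (≤ᵇ-true e₁))) (noninc-φ (y ∷ r) t₂ e₂)

    -- Without a tie between neighbours, every weak inequality between neighbouring images is
    -- strict, and a monotone φ reflects strict inequalities; so the subword was monotone before
    -- merging.
    monotone-φ : ∀ u → ind (monotone (map φ u)) ≤ ind (monotone u) + ind (adjTie u)
    monotone-φ u with adjTie u in t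
    ... | true = ≤-trans (ind≤1 _) (m≤n+m 1 _)
    ... | false with monotone (map φ u) in e
    ...   | false = z≤n
    ...   | true with ∨-true {nondec (map φ u)} e
    ...     | inj₁ e₁ rewrite nondec-φ u t e₁ = ≤-refl
    ...     | inj₂ e₂ rewrite ∨-trueʳ (nondec u) (noninc-φ u t e₂) = ≤-refl

    headIn : ℕ → List ℕ → Bool
    headIn c [] = false
    headIn c (y ∷ _) = c ≡ᵇ φ y

    cnt : ℕ → List ℕ → ℕ
    cnt c xs = Σ[ xs ] (λ y → ind (c ≡ᵇ φ y))

    headIn-count : ∀ c k xs → Σ[ subs (suc k) xs ] (ind ∘ headIn c) ≤ cnt c xs * (length xs C k)
    headIn-count c k [] = z≤n
    headIn-count c k (x ∷ xs) = begin
      Σ[ subs (suc k) (x ∷ xs) ] (ind ∘ headIn c) ≡⟨ Σ-subs-∷ k x xs _ ⟩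
      Σ[ subs k xs ] (λ _ → i) + Σ[ subs (suc k) xs ] (ind ∘ headIn c)
        ≡⟨ cong (_+ Σ[ subs (suc k) xs ] (ind ∘ headIn c)) (≡.trans (Σ-const (subs k xs) i) (≡.trans (*-comm _ i) (cong (i *_) (length-subs k xs)))) ⟩
      i * (length xs C k) + Σ[ subs (suc k) xs ] (ind ∘ headIn c) ≤⟨ +-monoʳ-≤ (i * (length xs C k)) (headIn-count c k xs) ⟩
      i * (length xs C k) + cnt c xs * (length xs C k) ≡⟨ sym (*-distribʳ-+ (length xs C k) i _) ⟩
      (i + cnt c xs) * (length xs C k) ≤⟨ *-monoʳ-≤ (i + cnt c xs) (C-mono k (n≤1+n (length xs))) ⟩
      (i + cnt c xs) * (suc (length xs) C k) ∎
      where
      open ≤-Reasoning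
      i = ind (c ≡ᵇ φ x)

    adjTie-∷ : ∀ x v → ind (adjTie (x ∷ v)) ≤ ind (headIn (φ x) v) + ind (adjTie v)
    adjTie-∷ x [] = z≤n
    adjTie-∷ x (y ∷ v) = ind-∨ (φ x ≡ᵇ φ y) (adjTie (y ∷ v))

    -- A tie has k possible places. Deleting its second element leaves a k-subword, and the deleted
    -- element is one of at most Q elements in the class of its predecessor.
    adjTie-count : ∀ Q k xs → (∀ c → cnt c xs ≤ Q) → Σ[ subs (suc k) xs ] (ind ∘ adjTie) ≤ Q * k * (length xs C k)
    adjTie-count Q k [] _ = z≤n
    adjTie-count Q zero (x ∷ xs) h = ≤-trans (adjTie-count Q zero xs (λ c → ≤-trans (m≤n+m _ _) (h c))) ≤-refl
    adjTie-count Q (suc k) (x ∷ xs) h = begin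
      Σ[ subs (suc (suc k)) (x ∷ xs) ] (ind ∘ adjTie) ≡⟨ Σ-subs-∷ (suc k) x xs _ ⟩
      Σ[ subs (suc k) xs ] (λ v → ind (adjTie (x ∷ v))) + Σ[ subs (suc (suc k)) xs ] (ind ∘ adjTie)
        ≤⟨ +-mono-≤ (Σ-mono (subs (suc k) xs) (adjTie-∷ x)) (adjTie-count Q (suc k) xs h′) ⟩
      Σ[ subs (suc k) xs ] (λ v → ind (headIn (φ x) v) + ind (adjTie v)) + Q * suc k * (n C suc k)
        ≡⟨ cong (_+ Q * suc k * (n C suc k)) (Σ-⊕ (subs (suc k) xs) _ _) ⟩
      (Σ[ subs (suc k) xs ] (ind ∘ headIn (φ x)) + Σ[ subs (suc k) xs ] (ind ∘ adjTie)) + Q * suc k * (n C suc k)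
        ≤⟨ +-monoˡ-≤ _ (+-mono-≤ (≤-trans (headIn-count (φ x) k xs) (*-monoˡ-≤ (n C k) (h′ (φ x)))) (adjTie-count Q k xs h′)) ⟩
      (Q * (n C k) + Q * k * (n C k)) + Q * suc k * (n C suc k) ≡⟨ ring Q k (n C k) (n C suc k) ⟩
      Q * suc k * (n C k + n C suc k) ≡⟨ cong (Q * suc k *_) (sym (C-suc n k)) ⟩
      Q * suc k * (suc n C suc k) ∎
      where
      open ≤-Reasoning
      n = length xs
      h′ : ∀ c → cnt c xs ≤ Q
      h′ c = ≤-trans (m≤n+m _ _) (h c)
      ring : ∀ q k a b → (q * a + q * k * a) + q * suc k * b ≡ q * suc k * (a + b)
      ring = solve-∀

    m-merge : ∀ Q k xs → (∀ c → cnt c xs ≤ Q) → m (suc k) (map φ xs) ≤ m (suc k) xs + Q * k * (length xs C k)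
    m-merge Q k xs h = begin
      m (suc k) (map φ xs) ≡⟨ m-Σ (suc k) (map φ xs) ⟩
      Σ[ subs (suc k) (map φ xs) ] (ind ∘ monotone) ≡⟨ Σ-subs-map φ (suc k) xs _ ⟩
      Σ[ subs (suc k) xs ] (ind ∘ monotone ∘ map φ) ≤⟨ Σ-mono (subs (suc k) xs) monotone-φ ⟩
      Σ[ subs (suc k) xs ] (λ u → ind (monotone u) + ind (adjTie u)) ≡⟨ Σ-⊕ (subs (suc k) xs) _ _ ⟩
      Σ[ subs (suc k) xs ] (ind ∘ monotone) + Σ[ subs (suc k) xs ] (ind ∘ adjTie)
        ≤⟨ +-mono-≤ (≤-reflexive (sym (m-Σ (suc k) xs))) (adjTie-count Q k xs h) ⟩
      m (suc k) xs + Q * k * (length xs C k) ∎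
      where open ≤-Reasoning

  m<[1+m/n]*n : ∀ m n .{{_ : NonZero n}} → m < suc (m / n) * n
  m<[1+m/n]*n m n = subst (_< suc (m / n) * n) (sym (m≡m%n+[m/n]*n m n)) (+-monoˡ-< (m / n * n) (m%n<n m n))

  -- The bound n ∸ c * q is there for the induction: when n itself falls into the class c, it is the
  -- smaller of the two bounds both before and after the step.
  quotient-fibre : ∀ q .{{_ : NonZero q}} c n → Σ[ upTo n ] (λ v → ind (c ≡ᵇ v / q)) ≤ (n ∸ c * q) ⊓ q
  quotient-fibre q c zero = z≤n
  quotient-fibre q c (suc n) = begin
    Σ[ upTo (suc n) ] h ≡⟨ cong (λ l → Σ[ l ] h) (sym (Listₚ.upTo-∷ʳ n)) ⟩
    Σ[ upTo n ++ [ n ] ] h ≡⟨ Σ-++ (upTo n) [ n ] h ⟩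
    Σ[ upTo n ] h + (h n + 0) ≤⟨ +-monoˡ-≤ (h n + 0) (quotient-fibre q c n) ⟩
    (n ∸ c * q) ⊓ q + (h n + 0) ≤⟨ step ⟩
    (suc n ∸ c * q) ⊓ q ∎
    where
    open ≤-Reasoning
    h : ℕ → ℕ
    h v = ind (c ≡ᵇ v / q)
    step : (n ∸ c * q) ⊓ q + (h n + 0) ≤ (suc n ∸ c * q) ⊓ q
    step with c ≡ᵇ n / q in e
    ... | false = ≤-trans (≤-reflexive (+-identityʳ _)) (⊓-monoˡ-≤ q (∸-monoˡ-≤ (c * q) (n≤1+n n)))
    ... | true with ≡ᵇ-true {c} e
    ...   | refl = begin
      (n ∸ c * q) ⊓ q + 1 ≤⟨ +-monoˡ-≤ 1 (m⊓n≤m (n ∸ c * q) q) ⟩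
      (n ∸ c * q) + 1 ≡⟨ +-comm _ 1 ⟩
      suc (n ∸ c * q) ≡⟨ sym (+-∸-assoc 1 (m/n*n≤m n q)) ⟩
      suc n ∸ c * q ≡⟨ sym (m≤n⇒m⊓n≡m le) ⟩
      (suc n ∸ c * q) ⊓ q ∎
      where
      le : suc n ∸ c * q ≤ q
      le = ≤-trans (∸-monoˡ-≤ (c * q) (m<[1+m/n]*n n q)) (≤-reflexive (m+n∸n≡m q (c * q)))

  fmin≤gmin : ∀ s k n → fmin (suc s) (suc k) n ≤ gmin (suc k) n + suc (n / suc s) * k * (n C k)
  fmin≤gmin s k n with gmin-attained (suc k) n
  ... | π , π↭ , e = begin
    fmin (suc s) (suc k) n ≡⟨ cong (fmin (suc s) (suc k)) (sym len) ⟩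
    fmin (suc s) (suc k) (length w) ≤⟨ fmin-≤ (suc s) (suc k) w w< ⟩
    m (suc k) w ≤⟨ m-merge q k π fibre ⟩
    m (suc k) π + q * k * (length π C k) ≡⟨ cong₂ (λ a b → a + q * k * (b C k)) (sym e) lenπ ⟩
    gmin (suc k) n + q * k * (n C k) ∎
    where
    open ≤-Reasoning
    -- One more than the quotient, so that (s + 1)q exceeds n and all letters v / q are below s + 1.
    q = suc (n / suc s)
    open Merge (_/ q) (λ a≤b → /-mono-≤ a≤b (≤-refl {q}))
    w = map (_/ q) π
    lenπ : length π ≡ n
    lenπ = ≡.trans (↭-length π↭) (Listₚ.length-upTo n)
    len : length w ≡ n
    len = ≡.trans (Listₚ.length-map (_/ q) π) lenπ
    w< : All (_< suc s) w
    w< = Allₚ.map⁺ (All.tabulate (λ {v} v∈ → m<n*o⇒m/o<n (<-≤-trans (<-trans (∈-upTo⁻ (∈-resp-↭ π↭ v∈)) (m<[1+m/n]*n n (suc s))) (≤-reflexive (*-comm q (suc s))))))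
    fibre : ∀ c → cnt c π ≤ q
    fibre c = ≤-trans (≤-reflexive (Σ-↭ π↭ _)) (≤-trans (quotient-fibre q c n) (m⊓n≤n _ q))

-- Lower bound for f - g: two ways of breaking ties.

module TieBreaking where

  open Counting
  open Minima
  open Coarsening
  open import Data.Bool using (Bool; true; false; T; if_then_else_)
  open import Data.Nat using (ℕ; zero; suc; z≤n; s≤s; _+_; _*_; _∸_; _^_; _≤_; _<_; _⊓_; _≤ᵇ_; _<ᵇ_; _≡ᵇ_; >-nonZero; _/_)
  open import Data.Nat.Properties
  open import Data.Nat.DivMod using (m/n*n≤m; m≥n⇒m/n>0)
  open import Data.Nat.Combinatorics using (_C_)
  open import Data.Nat.Tactic.RingSolver using (solve-∀)
  open import Data.List using (List; []; _∷_; map; length; upTo)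
  import Data.List.Properties as Listₚ
  open import Data.List.Membership.Propositional using (_∈_)
  open import Data.List.Membership.Propositional.Properties using (∈-upTo⁺)
  open import Data.List.Relation.Unary.Any using (here; there)
  open import Data.List.Relation.Unary.All as All using (All; []; _∷_)
  open import Data.List.Relation.Unary.AllPairs using (AllPairs; []; _∷_)
  import Data.List.Relation.Unary.AllPairs.Properties as AllPairsₚ
  open import Data.List.Relation.Unary.Unique.Propositional using (Unique)
  open import Data.List.Relation.Binary.Sublist.Propositional using (_⊆_; []; _∷_; _∷ʳ_; ⊆-trans; minimum)
  open import Data.List.Relation.Binary.Sublist.Propositional.Properties using (All-resp-⊆)
  open import Data.Product using (_×_; _,_; proj₁; proj₂; ∃-syntax)
  open import Data.Sum using (inj₁; inj₂; _⊎_)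
  open import Function using (_∘_)
  open import Relation.Nullary using (yes; no; contradiction)
  open import Relation.Binary.PropositionalEquality as ≡ using (_≡_; _≢_; refl; sym; cong; cong₂; subst)

  private variable
    A : Set

  AllPairs-resp-⊆ : ∀ {R : A → A → Set} {xs ys} → xs ⊆ ys → AllPairs R ys → AllPairs R xs
  AllPairs-resp-⊆ [] [] = []
  AllPairs-resp-⊆ (y ∷ʳ s) (_ ∷ ps) = AllPairs-resp-⊆ s ps
  AllPairs-resp-⊆ (refl ∷ s) (p ∷ ps) = All-resp-⊆ s p ∷ AllPairs-resp-⊆ s ps

  -- Ramsey's theorem for monotone subwords, and supersaturation.

  above : ℕ → List ℕ → List ℕ
  above x [] = []
  above x (y ∷ ys) = if x ≤ᵇ y then y ∷ above x ys else above x ys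

  below : ℕ → List ℕ → List ℕ
  below x [] = []
  below x (y ∷ ys) = if x ≤ᵇ y then below x ys else y ∷ below x ys

  above-⊆ : ∀ x ys → above x ys ⊆ ys
  above-⊆ x [] = []
  above-⊆ x (y ∷ ys) with x ≤ᵇ y
  ... | true  = refl ∷ above-⊆ x ys
  ... | false = y ∷ʳ above-⊆ x ys

  below-⊆ : ∀ x ys → below x ys ⊆ ys
  below-⊆ x [] = []
  below-⊆ x (y ∷ ys) with x ≤ᵇ y
  ... | true  = y ∷ʳ below-⊆ x ys
  ... | false = refl ∷ below-⊆ x ys

  above-All : ∀ x ys → All (x ≤_) (above x ys)
  above-All x [] = []
  above-All x (y ∷ ys) with x ≤ᵇ y in e
  ... | true  = ≤ᵇ-true e ∷ above-All x ys
  ... | false = above-All x ys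

  below-All : ∀ x ys → All (_≤ x) (below x ys)
  below-All x [] = []
  below-All x (y ∷ ys) with x ≤ᵇ y in e
  ... | true  = below-All x ys
  ... | false = <⇒≤ (≰⇒> (λ x≤y → contradiction (≡.trans (sym e) (≤ᵇ-mono x≤y)) λ ())) ∷ below-All x ys

  above+below : ∀ x ys → length (above x ys) + length (below x ys) ≡ length ys
  above+below x [] = refl
  above+below x (y ∷ ys) with x ≤ᵇ y
  ... | true  = cong suc (above+below x ys)
  ... | false = ≡.trans (+-suc _ _) (cong suc (above+below x ys))

  nondec-∷ : ∀ x u → All (x ≤_) u → nondec u ≡ true → nondec (x ∷ u) ≡ true
  nondec-∷ x [] _ _ = refl
  nondec-∷ x (y ∷ u) (p ∷ _) e = ∧-intro (≤ᵇ-mono p) e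

  noninc-∷ : ∀ x u → All (_≤ x) u → noninc u ≡ true → noninc (x ∷ u) ≡ true
  noninc-∷ x [] _ _ = refl
  noninc-∷ x (y ∷ u) (p ∷ _) e = ∧-intro (≤ᵇ-mono p) e

  -- The first letter x can be put in front of a nondecreasing subword of the later letters that are
  -- at least x, and in front of a nonincreasing subword of the others; one of these two lists has
  -- at least the length required for it. The exponential bound suffices, since only the existence
  -- of a constant depending on k matters.
  ramsey : ∀ a b xs → 2 ^ (a + b) ≤ length xs →
    (∃[ u ] (u ⊆ xs × length u ≡ a × nondec u ≡ true)) ⊎ (∃[ u ] (u ⊆ xs × length u ≡ b × noninc u ≡ true))
  ramsey zero b xs _ = inj₁ ([] , minimum xs , refl , refl)
  ramsey (suc a) zero xs _ = inj₂ ([] , minimum xs , refl , refl)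
  ramsey (suc a) (suc b) [] le = contradiction (m^n>0 2 (suc a + suc b)) (<⇒≱ (s≤s le))
  ramsey (suc a) (suc b) (x ∷ ys) le with 2 ^ (a + suc b) ≤? length (above x ys)
  ... | yes p with ramsey a (suc b) (above x ys) p
  ...   | inj₁ (u , s , l , e) = inj₁ (x ∷ u , refl ∷ ⊆-trans s (above-⊆ x ys) , cong suc l , nondec-∷ x u (All-resp-⊆ s (above-All x ys)) e)
  ...   | inj₂ (u , s , l , e) = inj₂ (u , x ∷ʳ ⊆-trans s (above-⊆ x ys) , l , e)
  ramsey (suc a) (suc b) (x ∷ ys) le | no p with ramsey (suc a) b (below x ys) enough
    where
    enough : 2 ^ (suc a + b) ≤ length (below x ys)
    enough = +-cancelˡ-≤ (2 ^ (a + suc b)) _ _ (begin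
      2 ^ (a + suc b) + 2 ^ (suc a + b) ≡⟨ cong (λ e → 2 ^ (a + suc b) + 2 ^ e) (sym (+-suc a b)) ⟩
      2 ^ (a + suc b) + 2 ^ (a + suc b) ≡⟨ cong (2 ^ (a + suc b) +_) (sym (+-identityʳ _)) ⟩
      2 ^ (suc a + suc b) ≤⟨ le ⟩
      suc (length ys) ≡⟨ cong suc (sym (above+below x ys)) ⟩
      suc (length (above x ys)) + length (below x ys) ≤⟨ +-monoˡ-≤ _ (≰⇒> p) ⟩
      2 ^ (a + suc b) + length (below x ys) ∎)
      where open ≤-Reasoning
  ...   | inj₁ (u , s , l , e) = inj₁ (u , x ∷ʳ ⊆-trans s (below-⊆ x ys) , l , e)
  ...   | inj₂ (u , s , l , e) = inj₂ (x ∷ u , refl ∷ ⊆-trans s (below-⊆ x ys) , cong suc l , noninc-∷ x u (All-resp-⊆ s (below-All x ys)) e)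

  Σ≥1 : ∀ {xs : List A} {z} (f : A → ℕ) → z ∈ xs → 1 ≤ f z → 1 ≤ Σ[ xs ] f
  Σ≥1 f (here refl) p = ≤-trans p (m≤m+n _ _)
  Σ≥1 f (there z∈) p = ≤-trans (Σ≥1 f z∈ p) (m≤n+m _ _)

  m≥1 : ∀ j xs → 2 ^ (j + j) ≤ length xs → 1 ≤ m j xs
  m≥1 j xs le = ≤-trans (go (ramsey j j xs le)) (≤-reflexive (sym (m-Σ j xs)))
    where
    go : _ → 1 ≤ Σ[ subs j xs ] (ind ∘ monotone)
    go (inj₁ (u , s , refl , e)) = Σ≥1 _ (∈-subs s) (≤-reflexive (cong ind (sym (∨-trueˡ (noninc u) e))))
    go (inj₂ (u , s , refl , e)) = Σ≥1 _ (∈-subs s) (≤-reflexive (cong ind (sym (∨-trueʳ (nondec u) e))))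

  -- Every sublist of length j + b with b = 2^(2j) contains a monotone j-subword, and each j-subword
  -- lies in the same number D of such sublists. The length is j + b rather than b so that
  -- `subs-of-subs j b` applies as it stands.
  supersaturation : ∀ j xs → j + 2 ^ (j + j) ≤ length xs → length xs C j ≤ ((j + 2 ^ (j + j)) C j) * m j xs
  supersaturation j xs le = *-cancelˡ-≤ D {{>-nonZero D>0}} (begin
    D * (r C j) ≡⟨ cong (D *_) (sym (≡.trans (Σ-const (subs j xs) 1) (≡.trans (*-identityʳ _) (length-subs j xs)))) ⟩
    D * Σ[ subs j xs ] (λ _ → 1) ≡⟨ sym (subs-of-subs j b xs (λ _ → 1)) ⟩
    Σ[ subs (j + b) xs ] (λ S → Σ[ subs j S ] (λ _ → 1))
      ≤⟨ Σ-mono∈ (subs (j + b) xs) pointwise ⟩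
    Σ[ subs (j + b) xs ] (λ S → ((j + b) C j) * Σ[ subs j S ] (ind ∘ monotone)) ≡⟨ Σ-*ˡ ((j + b) C j) (subs (j + b) xs) _ ⟩
    ((j + b) C j) * Σ[ subs (j + b) xs ] (λ S → Σ[ subs j S ] (ind ∘ monotone))
      ≡⟨ cong (((j + b) C j) *_) (≡.trans (subs-of-subs j b xs _) (cong (D *_) (sym (m-Σ j xs)))) ⟩
    ((j + b) C j) * (D * m j xs) ≡⟨ swap* ((j + b) C j) D (m j xs) ⟩
    D * (((j + b) C j) * m j xs) ∎)
    where
    open ≤-Reasoning
    b = 2 ^ (j + j)
    r = length xs
    D = (r ∸ j) C b
    D>0 : 0 < D
    D>0 = C>0 {r ∸ j} {b} (≤-trans (≤-reflexive (sym (m+n∸m≡n j b))) (∸-monoˡ-≤ j le))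
    swap* : ∀ a b c → a * (b * c) ≡ b * (a * c)
    swap* = solve-∀
    pointwise : ∀ S → S ∈ subs (j + b) xs → Σ[ subs j S ] (λ _ → 1) ≤ ((j + b) C j) * Σ[ subs j S ] (ind ∘ monotone)
    pointwise S S∈ = begin
      Σ[ subs j S ] (λ _ → 1) ≡⟨ ≡.trans (Σ-const (subs j S) 1) (≡.trans (*-identityʳ _) (≡.trans (length-subs j S) (cong (_C j) lS))) ⟩
      (j + b) C j ≡⟨ sym (*-identityʳ _) ⟩
      ((j + b) C j) * 1 ≤⟨ *-monoʳ-≤ ((j + b) C j) (≤-trans (m≥1 j S (≤-trans (m≤n+m b j) (≤-reflexive (sym lS)))) (≤-reflexive (m-Σ j S))) ⟩
      ((j + b) C j) * Σ[ subs j S ] (ind ∘ monotone) ∎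
      where
      lS : length S ≡ j + b
      lS = subs-length (j + b) xs S∈

  -- Early and late occurrences, and the subwords that gain from them.

  Tagged : Set
  Tagged = ℕ × Bool × ℕ

  letter : Tagged → ℕ
  letter (x , _ , _) = x

  early : Tagged → Bool
  early (_ , b , _) = b

  pos : Tagged → ℕ
  pos (_ , _ , i) = i

  bump : (ℕ → ℕ) → ℕ → ℕ → ℕ
  bump c x a = ind (x ≡ᵇ a) + c a

  -- The counter c records how often each letter has been read already, and i is the current
  -- position. Arbitrary initial values are allowed for the sake of induction; the word itself is
  -- tagged with both equal to 0.
  tag : ℕ → (ℕ → ℕ) → ℕ → List ℕ → List Tagged
  tag h c i [] = []
  tag h c i (x ∷ xs) = (x , (c x <ᵇ h) , i) ∷ tag h (bump c x) (suc i) xs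

  map-letter-tag : ∀ h c i xs → map letter (tag h c i xs) ≡ xs
  map-letter-tag h c i [] = refl
  map-letter-tag h c i (x ∷ xs) = cong (x ∷_) (map-letter-tag h (bump c x) (suc i) xs)

  length-tag : ∀ h c i xs → length (tag h c i xs) ≡ length xs
  length-tag h c i [] = refl
  length-tag h c i (x ∷ xs) = cong suc (length-tag h (bump c x) (suc i) xs)

  tag-pos≥ : ∀ h c i xs → All (λ p → i ≤ pos p) (tag h c i xs)
  tag-pos≥ h c i [] = []
  tag-pos≥ h c i (x ∷ xs) = ≤-refl ∷ All.map (≤-trans (n≤1+n i)) (tag-pos≥ h _ (suc i) xs)

  tag-pos< : ∀ h c i xs → All (λ p → pos p < i + length xs) (tag h c i xs)
  tag-pos< h c i [] = []
  tag-pos< h c i (x ∷ xs) = ≤-trans (s≤s (m≤m+n i (length xs))) (≤-reflexive (sym (+-suc i (length xs))))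
    ∷ All.map (λ p → ≤-trans p (≤-reflexive (sym (+-suc i (length xs))))) (tag-pos< h _ (suc i) xs)

  tag-increasing : ∀ h c i xs → AllPairs (λ p q → pos p < pos q) (tag h c i xs)
  tag-increasing h c i [] = []
  tag-increasing h c i (x ∷ xs) = tag-pos≥ h _ (suc i) xs ∷ tag-increasing h _ (suc i) xs

  late : List Tagged → List Tagged
  late [] = []
  late ((x , true  , i) ∷ ps) = late ps
  late ((x , false , i) ∷ ps) = (x , false , i) ∷ late ps

  late-⊆ : ∀ ps → late ps ⊆ ps
  late-⊆ [] = []
  late-⊆ ((x , true  , i) ∷ ps) = _ ∷ʳ late-⊆ ps
  late-⊆ ((x , false , i) ∷ ps) = refl ∷ late-⊆ ps

  late-All : ∀ ps → All (λ p → early p ≡ false) (late ps)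
  late-All [] = []
  late-All ((x , true  , i) ∷ ps) = late-All ps
  late-All ((x , false , i) ∷ ps) = refl ∷ late-All ps

  mono : List Tagged → ℕ
  mono v = ind (monotone (map letter v))

  headIs : ℕ → List Tagged → Bool
  headIs y [] = false
  headIs y (p ∷ _) = y ≡ᵇ letter p

  allLate : List Tagged → Bool
  allLate [] = true
  allLate ((_ , b , _) ∷ ps) = if b then false else allLate ps

  allLate-true : ∀ {ps} → All (λ p → early p ≡ false) ps → allLate ps ≡ true
  allLate-true [] = refl
  allLate-true (refl ∷ e) = allLate-true e

  good : List Tagged → ℕ
  good [] = 0
  good ((y , true  , _) ∷ v) = ind (headIs y v) * (ind (allLate v) * mono v)
  good ((y , false , _) ∷ v) = 0

  -- For a letter a, c a ⊓ h is the number of its early occurrences read before the current list.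
  -- These could precede v in the whole word, but are no longer visible in the list.
  capHead : ℕ → (ℕ → ℕ) → List Tagged → ℕ
  capHead h c [] = 0
  capHead h c (p ∷ _) = c (letter p) ⊓ h

  cap-bump-full : ∀ h c x → h ≤ c x → ∀ a → bump c x a ⊓ h ≡ c a ⊓ h
  cap-bump-full h c x h≤ a with x ≡ᵇ a in e
  ... | false = refl
  ... | true with ≡ᵇ-true {x} e
  ...   | refl = ≡.trans (m≥n⇒m⊓n≡n (m≤n⇒m≤1+n h≤)) (sym (m≥n⇒m⊓n≡n h≤))

  cap-bump : ∀ h c x → c x < h → ∀ a → bump c x a ⊓ h ≡ ind (x ≡ᵇ a) + c a ⊓ h
  cap-bump h c x lt a with x ≡ᵇ a in e
  ... | false = refl
  ... | true with ≡ᵇ-true {x} e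
  ...   | refl = ≡.trans (m≤n⇒m⊓n≡m lt) (cong suc (sym (m≤n⇒m⊓n≡m (<⇒≤ lt))))

  <ᵇ-false⇒≥ : ∀ {a b} → (a <ᵇ b) ≡ false → b ≤ a
  <ᵇ-false⇒≥ {a} {b} e = ≮⇒≥ (λ a<b → contradiction (≡.trans (sym e) (<ᵇ-true a<b)) λ ())

  -- Every late occurrence of a letter is preceded by exactly h early ones, so a monotone subword of
  -- late letters has h good extensions. Inside the induction, the extensions by early occurrences
  -- that were read before are counted by `capHead`, which vanishes when the counter starts at 0.
  good-count : ∀ h c i j xs → let P = tag h c i xs in
    h * Σ[ subs (suc j) (late P) ] mono
      ≤ Σ[ subs (suc (suc j)) P ] good + Σ[ subs (suc j) (late P) ] (λ v → mono v * capHead h c v)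
  good-count h c i j [] = ≤-reflexive (*-zeroʳ h)
  good-count h c i j (x ∷ xs) with c x <ᵇ h in e
  ... | false = begin
    h * Σ[ subs (suc j) (p ∷ late P) ] mono ≡⟨ cong (h *_) (Σ-subs-∷ j p (late P) mono) ⟩
    h * (Σ[ subs j (late P) ] (λ v → mono (p ∷ v)) + Σ[ subs (suc j) (late P) ] mono) ≡⟨ *-distribˡ-+ h _ _ ⟩
    h * Σ[ subs j (late P) ] (λ v → mono (p ∷ v)) + h * Σ[ subs (suc j) (late P) ] mono
      ≤⟨ +-monoʳ-≤ _ (good-count h (bump c x) (suc i) j xs) ⟩
    h * Σ[ subs j (late P) ] (λ v → mono (p ∷ v)) + (G + Σ[ subs (suc j) (late P) ] (λ v → mono v * capHead h (bump c x) v))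
      -- Here x is late, so h ≤ c x: the cap of a subword starting at p is exactly h, and raising
      -- the counter of x changes no cap.
      ≡⟨ cong₂ (λ a b → a + (G + b)) head≡ rest≡ ⟩
    a′ + (G + b′) ≡⟨ rearr a′ G b′ ⟩
    G + (a′ + b′) ≤⟨ +-mono-≤ (≤-trans (m≤n+m G _) (≤-reflexive (sym (Σ-subs-∷ (suc j) p P good)))) (≤-reflexive (sym (Σ-subs-∷ j p (late P) _))) ⟩
    Σ[ subs (suc (suc j)) (p ∷ P) ] good + Σ[ subs (suc j) (p ∷ late P) ] (λ v → mono v * capHead h c v) ∎
    where
    open ≤-Reasoning
    p = (x , false , i)
    P = tag h (bump c x) (suc i) xs
    G = Σ[ subs (suc (suc j)) P ] good
    a′ = Σ[ subs j (late P) ] (λ v → mono (p ∷ v) * (c x ⊓ h))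
    b′ = Σ[ subs (suc j) (late P) ] (λ v → mono v * capHead h c v)
    head≡ : h * Σ[ subs j (late P) ] (λ v → mono (p ∷ v)) ≡ a′
    head≡ = ≡.trans (sym (Σ-*ˡ h (subs j (late P)) _)) (Σ-cong (subs j (late P))
      (λ v → ≡.trans (*-comm h _) (cong (mono (p ∷ v) *_) (sym (m≥n⇒m⊓n≡n (<ᵇ-false⇒≥ {c x} e))))))
    rest≡ : Σ[ subs (suc j) (late P) ] (λ v → mono v * capHead h (bump c x) v) ≡ b′
    rest≡ = Σ-cong (subs (suc j) (late P)) λ where
      [] → refl
      v@(q ∷ _) → cong (mono v *_) (cap-bump-full h c x (<ᵇ-false⇒≥ {c x} e) (letter q))
    rearr : ∀ a b c → a + (b + c) ≡ b + (a + c)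
    rearr = solve-∀
  ... | true = begin
    h * Σ[ subs (suc j) (late P) ] mono ≤⟨ good-count h (bump c x) (suc i) j xs ⟩
    G + Σ[ subs (suc j) (late P) ] (λ v → mono v * capHead h (bump c x) v)
      -- Here x is early. Reading it raises the cap by one precisely for the subwords starting with
      -- the letter x, and this one is paid for by the good subword p ∷ v.
      ≡⟨ cong (G +_) (≡.trans (Σ-cong (subs (suc j) (late P)) split) (Σ-⊕ (subs (suc j) (late P)) _ _)) ⟩
    G + (Σ[ subs (suc j) (late P) ] (λ v → ind (headIs x v) * mono v) + b′) ≡⟨ rearr G _ b′ ⟩
    (Σ[ subs (suc j) (late P) ] (λ v → ind (headIs x v) * mono v) + G) + b′
      ≡⟨ cong (λ z → (z + G) + b′) (Σ-cong∈ (subs (suc j) (late P)) isGood) ⟩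
    (Σ[ subs (suc j) (late P) ] (λ v → good (p ∷ v)) + G) + b′
      ≤⟨ +-monoˡ-≤ b′ (+-monoˡ-≤ G (subs-mono (suc j) (late-⊆ P) (λ v → good (p ∷ v)))) ⟩
    (Σ[ subs (suc j) P ] (λ v → good (p ∷ v)) + G) + b′ ≡⟨ cong (_+ b′) (sym (Σ-subs-∷ (suc j) p P good)) ⟩
    Σ[ subs (suc (suc j)) (p ∷ P) ] good + b′ ∎
    where
    open ≤-Reasoning
    p = (x , true , i)
    P = tag h (bump c x) (suc i) xs
    G = Σ[ subs (suc (suc j)) P ] good
    b′ = Σ[ subs (suc j) (late P) ] (λ v → mono v * capHead h c v)
    split : ∀ v → mono v * capHead h (bump c x) v ≡ ind (headIs x v) * mono v + mono v * capHead h c v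
    split [] = refl
    split v@(q ∷ _) = ≡.trans (cong (mono v *_) (cap-bump h c x (<ᵇ⇒< (c x) h (subst T (sym e) _)) (letter q)))
      (≡.trans (*-distribˡ-+ (mono v) _ _) (cong (_+ mono v * (c (letter q) ⊓ h)) (*-comm (mono v) _)))
    isGood : ∀ v → v ∈ subs (suc j) (late P) → ind (headIs x v) * mono v ≡ good (p ∷ v)
    isGood v v∈ = cong (ind (headIs x v) *_) (sym (≡.trans (cong (λ b → ind b * mono v) (allLate-true (All-resp-⊆ (subs-⊆ (suc j) (late P) v∈) (late-All P)))) (+-identityʳ (mono v))))
    rearr : ∀ a b c → a + (b + c) ≡ (b + a) + c
    rearr = solve-∀

  -- A letter a still has at most h ∸ c a early occurrences to come. When an early letter x is read,
  -- the summand of x drops by one.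
  late-length : ∀ s h c i xs → All (_< s) xs → length xs ≤ length (late (tag h c i xs)) + Σ[ upTo s ] (λ a → h ∸ c a)
  late-length s h c i [] _ = z≤n
  late-length s h c i (x ∷ xs) (x<s ∷ xs<) with c x <ᵇ h in e
  ... | false = s≤s (≤-trans (late-length s h (bump c x) (suc i) xs xs<) (+-monoʳ-≤ _ (Σ-mono (upTo s) (λ a → ∸-monoʳ-≤ h (m≤n+m (c a) (ind (x ≡ᵇ a)))))))
  ... | true = begin
    suc (length xs) ≤⟨ s≤s (late-length s h (bump c x) (suc i) xs xs<) ⟩
    suc (l + Σ[ upTo s ] (λ a → h ∸ bump c x a)) ≡⟨ sym (+-suc l _) ⟩
    l + suc (Σ[ upTo s ] (λ a → h ∸ bump c x a))
      ≤⟨ +-monoʳ-≤ l (Σ-strict (upTo s) (∈-upTo⁺ x<s) (λ a → ∸-monoʳ-≤ h (m≤n+m (c a) (ind (x ≡ᵇ a)))) drop) ⟩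
    l + Σ[ upTo s ] (λ a → h ∸ c a) ∎
    where
    open ≤-Reasoning
    l = length (late (tag h (bump c x) (suc i) xs))
    drop : h ∸ bump c x x < h ∸ c x
    drop rewrite ≡ᵇ-refl x = ∸-monoʳ-< ≤-refl (<ᵇ⇒< (c x) h (subst T (sym e) _))

  -- The two tie-breakings as permutations given by integer keys.

  digit-≤ : ∀ N a a′ {r r′} → r′ < N → a * N + r ≤ a′ * N + r′ → a ≤ a′
  digit-≤ N a a′ {r} {r′} r′< le with a ≤? a′
  ... | yes p = p
  ... | no  q = contradiction le (<⇒≱ (begin-strict
    a′ * N + r′ <⟨ +-monoʳ-< (a′ * N) r′< ⟩
    a′ * N + N ≡⟨ +-comm (a′ * N) N ⟩
    suc a′ * N ≤⟨ *-monoˡ-≤ N (≰⇒> q) ⟩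
    a * N ≤⟨ m≤m+n (a * N) r ⟩
    a * N + r ∎))
    where open ≤-Reasoning

  nondec-head : ∀ x y r → nondec (x ∷ y ∷ r) ≡ true → x ≤ y
  nondec-head x y r e = ≤ᵇ-true (proj₁ (∧-true {x ≤ᵇ y} e))

  noninc-head : ∀ x y r → noninc (x ∷ y ∷ r) ≡ true → y ≤ x
  noninc-head x y r e = ≤ᵇ-true (proj₁ (∧-true {y ≤ᵇ x} e))

  module TieBreak (n : ℕ) where

    -- `offsetA` ranks the late occurrences of a letter below the early ones, `offsetB` the early
    -- below the late. An offset plus a position is below 2n, so a key is a two-digit number in base
    -- n + n whose high digit is the letter.
    offsetA offsetB : Bool → ℕ
    offsetA b = if b then n else 0
    offsetB b = if b then 0 else n

    key : (Bool → ℕ) → Tagged → ℕ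
    key o (x , b , i) = x * (n + n) + (o b + i)

    keyA keyB : Tagged → ℕ
    keyA = key offsetA
    keyB = key offsetB

    InRange : Tagged → Set
    InRange p = pos p < n

    low< : ∀ (o : Bool → ℕ) → (∀ b → o b ≤ n) → ∀ {p} → InRange p → o (early p) + pos p < n + n
    low< o o≤ {p} p< = +-mono-≤-< (o≤ (early p)) p<

    A≤ : ∀ b → offsetA b ≤ n
    A≤ true = ≤-refl
    A≤ false = z≤n

    B≤ : ∀ b → offsetB b ≤ n
    B≤ true = z≤n
    B≤ false = ≤-refl

    -- Refining a weak order can only destroy monotonicity: for either offset, a subword monotone by
    -- key is monotone by letter.
    module _ (o : Bool → ℕ) (o≤ : ∀ b → o b ≤ n) where

      letter-≤ : ∀ {p q} → InRange q → key o p ≤ key o q → letter p ≤ letter q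
      letter-≤ {p} {q} q< = digit-≤ (n + n) (letter p) (letter q) (low< o o≤ {q} q<)

      nondec-key : ∀ u → All InRange u → nondec (map (key o) u) ≡ true → nondec (map letter u) ≡ true
      nondec-key [] _ _ = refl
      nondec-key (p ∷ []) _ _ = refl
      nondec-key (p ∷ q ∷ u) (p< ∷ q< ∷ u<) e =
        let e₁ , e₂ = ∧-true {key o p ≤ᵇ key o q} e
        in ∧-intro (≤ᵇ-mono (letter-≤ {p} {q} q< (≤ᵇ-true e₁))) (nondec-key (q ∷ u) (q< ∷ u<) e₂)

      noninc-key : ∀ u → All InRange u → noninc (map (key o) u) ≡ true → noninc (map letter u) ≡ true
      noninc-key [] _ _ = refl
      noninc-key (p ∷ []) _ _ = refl
      noninc-key (p ∷ q ∷ u) (p< ∷ q< ∷ u<) e =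
        let e₁ , e₂ = ∧-true {key o q ≤ᵇ key o p} e
        in ∧-intro (≤ᵇ-mono (letter-≤ {q} {p} p< (≤ᵇ-true e₁))) (noninc-key (q ∷ u) (q< ∷ u<) e₂)

      monotone-key : ∀ u → All InRange u → monotone (map (key o) u) ≡ true → monotone (map letter u) ≡ true
      monotone-key u u< e with ∨-true {nondec (map (key o) u)} e
      ... | inj₁ e₁ = ∨-trueˡ _ (nondec-key u u< e₁)
      ... | inj₂ e₂ = ∨-trueʳ (nondec (map letter u)) (noninc-key u u< e₂)

      key-injective : (∀ {b b′ i i′} → i < n → i′ < n → o b + i ≡ o b′ + i′ → i ≡ i′) →
        ∀ {p q} → InRange p → InRange q → key o p ≡ key o q → pos p ≡ pos q
      key-injective dec {p} {q} p< q< e with ≤-antisym (letter-≤ {p} {q} q< (≤-reflexive e)) (letter-≤ {q} {p} p< (≤-reflexive (sym e)))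
      ... | refl = dec p< q< (+-cancelˡ-≡ (letter p * (n + n)) _ _ e)

      keys-unique : (∀ {b b′ i i′} → i < n → i′ < n → o b + i ≡ o b′ + i′ → i ≡ i′) →
        ∀ P → All InRange P → AllPairs (λ p q → pos p < pos q) P → Unique (map (key o) P)
      keys-unique dec P P< inc = AllPairsₚ.map⁺ (go P< inc)
        where
        go : ∀ {P} → All InRange P → AllPairs (λ p q → pos p < pos q) P → AllPairs (λ p q → key o p ≢ key o q) P
        go [] [] = []
        go {p ∷ P} (p< ∷ P<) (a ∷ as) = All.map (λ { {q} (q< , lt) e → <⇒≢ lt (key-injective dec {p} {q} p< q< e) }) (All.zip (P< , a)) ∷ go P< as

    shift≢ : ∀ {i i′} → i < n → n + i′ ≢ i
    shift≢ {i} {i′} i< e = <⇒≱ i< (≤-trans (m≤m+n n i′) (≤-reflexive e))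

    decA : ∀ {b b′ i i′} → i < n → i′ < n → offsetA b + i ≡ offsetA b′ + i′ → i ≡ i′
    decA {true} {true} _ _ e = +-cancelˡ-≡ n _ _ e
    decA {true} {false} _ i′< e = contradiction e (shift≢ i′<)
    decA {false} {true} i< _ e = contradiction (sym e) (shift≢ i<)
    decA {false} {false} _ _ e = e

    decB : ∀ {b b′ i i′} → i < n → i′ < n → offsetB b + i ≡ offsetB b′ + i′ → i ≡ i′
    decB {true} {true} _ _ e = e
    decB {true} {false} i< _ e = contradiction (sym e) (shift≢ i<)
    decB {false} {true} _ i′< e = contradiction e (shift≢ i′<)
    decB {false} {false} _ _ e = +-cancelˡ-≡ n _ _ e

    -- An early y followed by late x₁, x₂ with y, x₁ the same letter: key A goes down and key B goes up from y to x₁,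
    -- so if both words were monotone, x₁ and x₂ would be the same letter, but then key A goes up from x₁ to x₂.
    broken : ∀ y i x₁ i₁ x₂ i₂ u → let w = (y , true , i) ∷ (x₁ , false , i₁) ∷ (x₂ , false , i₂) ∷ u in
      y ≡ x₁ → i₁ < i₂ → All InRange w → monotone (map keyA w) ≡ true → monotone (map keyB w) ≡ true → 1 ≤ 0
    broken y i x₁ i₁ x₂ i₂ u refl i₁<i₂ w<@(p< ∷ p₁< ∷ p₂< ∷ _) eA eB
      with ∨-true {nondec (map keyA ((y , true , i) ∷ (y , false , i₁) ∷ (x₂ , false , i₂) ∷ u))} eA
         | ∨-true {nondec (map keyB ((y , true , i) ∷ (y , false , i₁) ∷ (x₂ , false , i₂) ∷ u))} eB
    ... | inj₁ a | _ = contradiction (+-cancelˡ-≤ (y * (n + n)) _ _ (nondec-head _ _ (map keyA ((x₂ , false , i₂) ∷ u)) a)) (<⇒≱ (<-≤-trans p₁< (m≤m+n n i)))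
    ... | _ | inj₂ b = contradiction (+-cancelˡ-≤ (y * (n + n)) _ _ (noninc-head _ _ (map keyB ((x₂ , false , i₂) ∷ u)) b)) (<⇒≱ (<-≤-trans p< (m≤m+n n i₁)))
    ... | inj₂ a | inj₁ b = contradiction descent (<⇒≱ ascent)
      where
      tailA : noninc (map keyA ((y , false , i₁) ∷ (x₂ , false , i₂) ∷ u)) ≡ true
      tailA = proj₂ (∧-true {keyA (y , false , i₁) ≤ᵇ keyA (y , true , i)} a)
      tailB : nondec (map keyB ((y , false , i₁) ∷ (x₂ , false , i₂) ∷ u)) ≡ true
      tailB = proj₂ (∧-true {keyB (y , true , i) ≤ᵇ keyB (y , false , i₁)} b)
      descent : keyA (x₂ , false , i₂) ≤ keyA (y , false , i₁)
      descent = noninc-head _ _ (map keyA u) tailA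
      ascent : keyA (y , false , i₁) < keyA (x₂ , false , i₂)
      ascent = +-mono-≤-< (*-monoˡ-≤ (n + n) (letter-≤ offsetB B≤ {y , false , i₁} {x₂ , false , i₂} p₂< (nondec-head _ _ (map keyB u) tailB))) i₁<i₂


    monoA monoB : List Tagged → ℕ
    monoA u = ind (monotone (map keyA u))
    monoB u = ind (monotone (map keyB u))

    ind-≤ : ∀ {a b} → (a ≡ true → b ≡ true) → ind a ≤ ind b
    ind-≤ {false} f = z≤n
    ind-≤ {true} f rewrite f refl = ≤-refl

    monotone-double : ∀ y u → monotone (y ∷ u) ≡ true → monotone (y ∷ y ∷ u) ≡ true
    monotone-double y u e with ∨-true {nondec (y ∷ u)} e
    ... | inj₁ a = ∨-trueˡ _ (∧-intro (≤ᵇ-mono {y} ≤-refl) a)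
    ... | inj₂ b = ∨-trueʳ (nondec (y ∷ y ∷ u)) (∧-intro (≤ᵇ-mono {y} ≤-refl) b)

    two-keys : ∀ u → All InRange u → monoA u + monoB u ≤ 2 * mono u
    two-keys u u< = +-mono-≤ (ind-≤ (monotone-key offsetA A≤ u u<)) (≤-trans (ind-≤ (monotone-key offsetB B≤ u u<)) (≤-reflexive (sym (+-identityʳ _))))

    good≤1 : ∀ b → ind b * 1 + 0 ≤ 1
    good≤1 true  = ≤-refl
    good≤1 false = z≤n

    -- If `good u` is 1, then u is monotone by `monotone-double`, and by `broken` one of the two
    -- orders loses it; in all other cases `two-keys` suffices. Two letters form a monotone subword
    -- in every order, so a third is indispensable: this is where k ≥ 3 enters.
    gain : ∀ u → 3 ≤ length u → All InRange u → AllPairs (λ p q → pos p < pos q) u → (monoA u + monoB u) + good u ≤ 2 * mono u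
    gain u@((y , false , i) ∷ v) _ u< _ = ≤-trans (≤-reflexive (+-identityʳ _)) (two-keys u u<)
    gain ((y , true , i) ∷ []) (s≤s ()) _ _
    gain ((y , true , i) ∷ p₁ ∷ []) (s≤s (s≤s ())) _ _
    gain u@((y , true , i) ∷ (x₁ , true , i₁) ∷ (x₂ , b₂ , i₂) ∷ v) _ u< _ =
      ≤-trans (≤-reflexive (≡.trans (cong (monoA u + monoB u +_) (*-zeroʳ (ind (y ≡ᵇ x₁)))) (+-identityʳ _))) (two-keys u u<)
    gain u@((y , true , i) ∷ (x₁ , false , i₁) ∷ (x₂ , true , i₂) ∷ v) _ u< _ =
      ≤-trans (≤-reflexive (≡.trans (cong (monoA u + monoB u +_) (*-zeroʳ (ind (y ≡ᵇ x₁)))) (+-identityʳ _))) (two-keys u u<)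
    gain u@((y , true , i) ∷ w@((x₁ , false , i₁) ∷ (x₂ , false , i₂) ∷ v)) _ u< (_ ∷ (i₁<i₂ ∷ _) ∷ _) with y ≡ᵇ x₁ in e
    ... | false = ≤-trans (≤-reflexive (+-identityʳ _)) (two-keys u u<)
    ... | true with ≡ᵇ-true {y} e
    ...   | refl with monotone (map letter w) in ew
    ...     | false = ≤-trans (≤-reflexive (≡.trans (cong (monoA u + monoB u +_) (≡.trans (+-identityʳ _) (*-zeroʳ (ind (allLate v))))) (+-identityʳ _))) (two-keys u u<)
    ...     | true rewrite monotone-double y (x₂ ∷ map letter v) ew with monotone (map keyA u) in eA | monotone (map keyB u) in eB
    -- Now 2 * mono u is 2 and `good u` is at most 1, so it is enough that one of the two orders
    -- fails.
    ...       | false | bB = ≤-trans (+-monoʳ-≤ (ind bB) (good≤1 (allLate v))) (+-monoˡ-≤ 1 (ind≤1 bB))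
    ...       | true | false = ≤-trans (+-monoʳ-≤ 1 (good≤1 (allLate v))) ≤-refl
    ...       | true | true with () ← broken y i y i₁ x₂ i₂ v refl i₁<i₂ u< eA eB

  -- Summing the gain over all subwords, with explicit constants.

  open TieBreak

  -- The sum of `gain` over all k-subwords: each of the two permutations has at least `gmin`
  -- monotone ones, and `good-count` with the counter at 0 bounds the number of good subwords from
  -- below.
  tieBreak-gain : ∀ s h j w → All (_< s) w → let k = suc (suc (suc j)) ; R = map letter (late (tag h (λ _ → 0) 0 w)) in
    2 * gmin k (length w) + h * m (suc (suc j)) R ≤ 2 * m k w
  tieBreak-gain s h j w w< = begin
    2 * gmin k n + h * m (suc (suc j)) R ≤⟨ +-mono-≤ twice (≤-trans (≤-reflexive (cong (h *_) mR)) (good-count h (λ _ → 0) 0 (suc j) w)) ⟩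
    (m k (map (keyA n) P) + m k (map (keyB n) P)) + (Σ[ subs k P ] good + Σ[ subs (suc (suc j)) (late P) ] (λ v → mono v * capHead h (λ _ → 0) v))
      ≡⟨ cong₂ (λ a b → a + (Σ[ subs k P ] good + b)) (cong₂ _+_ (mkey (keyA n)) (mkey (keyB n))) (≡.trans (Σ-cong (subs (suc (suc j)) (late P)) cap0) (Σ-𝟘 (subs (suc (suc j)) (late P)))) ⟩
    (Σ[ subs k P ] (monoA n) + Σ[ subs k P ] (monoB n)) + (Σ[ subs k P ] good + 0)
      ≡⟨ cong₂ _+_ (sym (Σ-⊕ (subs k P) (monoA n) (monoB n))) (+-identityʳ _) ⟩
    Σ[ subs k P ] (λ u → monoA n u + monoB n u) + Σ[ subs k P ] good ≡⟨ sym (Σ-⊕ (subs k P) _ good) ⟩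
    Σ[ subs k P ] (λ u → (monoA n u + monoB n u) + good u) ≤⟨ Σ-mono∈ (subs k P) pointwise ⟩
    Σ[ subs k P ] (λ u → 2 * mono u) ≡⟨ Σ-*ˡ 2 (subs k P) mono ⟩
    2 * Σ[ subs k P ] mono ≡⟨ cong (2 *_) (sym mW) ⟩
    2 * m k w ∎
    where
    open ≤-Reasoning
    k = suc (suc (suc j))
    n = length w
    P = tag h (λ _ → 0) 0 w
    R = map letter (late P)
    P< : All (InRange n) P
    P< = tag-pos< h (λ _ → 0) 0 w
    inc = tag-increasing h (λ _ → 0) 0 w
    mkey : ∀ (κ : Tagged → ℕ) → m k (map κ P) ≡ Σ[ subs k P ] (λ u → ind (monotone (map κ u)))
    mkey κ = ≡.trans (m-Σ k (map κ P)) (Σ-subs-map κ k P _)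
    mR : m (suc (suc j)) R ≡ Σ[ subs (suc (suc j)) (late P) ] mono
    mR = ≡.trans (m-Σ (suc (suc j)) R) (Σ-subs-map letter (suc (suc j)) (late P) _)
    mW : m k w ≡ Σ[ subs k P ] mono
    mW = ≡.trans (cong (m k) (sym (map-letter-tag h (λ _ → 0) 0 w))) (mkey letter)
    gmin-key : ∀ o → (∀ b → o b ≤ n) → (∀ {b b′ i i′} → i < n → i′ < n → o b + i ≡ o b′ + i′ → i ≡ i′) → gmin k n ≤ m k (map (key n o) P)
    gmin-key o o≤ dec = subst (λ l → gmin k l ≤ m k (map (key n o) P)) (≡.trans (Listₚ.length-map (key n o) P) (length-tag h (λ _ → 0) 0 w))
      (gmin-≤ k (map (key n o) P) (keys-unique n o o≤ dec P P< inc))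
    twice : 2 * gmin k n ≤ m k (map (keyA n) P) + m k (map (keyB n) P)
    twice = +-mono-≤ (gmin-key (offsetA n) (A≤ n) (decA n)) (≤-trans (≤-reflexive (+-identityʳ _)) (gmin-key (offsetB n) (B≤ n) (decB n)))
    cap0 : ∀ v → mono v * capHead h (λ _ → 0) v ≡ 0
    cap0 [] = *-zeroʳ (mono [])
    cap0 v@(_ ∷ _) = *-zeroʳ (mono v)
    pointwise : ∀ u → u ∈ subs k P → (monoA n u + monoB n u) + good u ≤ 2 * mono u
    pointwise u u∈ = gain n u (≤-trans (s≤s (s≤s (s≤s z≤n))) (≤-reflexive (sym (subs-length k P u∈))))
      (All-resp-⊆ (subs-⊆ k P u∈) P<) (AllPairs-resp-⊆ (subs-⊆ k P u∈) inc)

  -- The factor 4 comes from n ≤ 4(s + 1)h, the power 4^J from passing to the late letters, which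
  -- are at least n/2, and the binomial coefficient from `supersaturation`.
  lowerConst : ℕ → ℕ
  lowerConst J = 4 * 4 ^ J * ((J + 2 ^ (J + J)) C J)

  -- Twice a sufficient number of late letters: J + 2^(2J) of them for `supersaturation`, and at
  -- least 2J for `C-halve`.
  lowerStart : ℕ → ℕ
  lowerStart J = 2 * (J + 2 ^ (J + J) + 2 * J)

  fmin-lower : ∀ j s n → let J = suc (suc j) ; k = suc J in 2 * suc s ≤ n → lowerStart J ≤ n →
    lowerConst J * suc s * (2 * gmin k n) + n C k ≤ lowerConst J * suc s * (2 * fmin (suc s) k n)
  fmin-lower j s n s≤n st≤n with fmin-attained s (suc (suc (suc j))) n
  ... | w , w< , refl , e = begin
    Ks * (2 * gmin k n) + n C k ≤⟨ +-monoʳ-≤ (Ks * (2 * gmin k n)) main ⟩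
    Ks * (2 * gmin k n) + Ks * (h * m J R) ≡⟨ sym (*-distribˡ-+ Ks (2 * gmin k n) (h * m J R)) ⟩
    Ks * (2 * gmin k n + h * m J R) ≤⟨ *-monoʳ-≤ Ks (tieBreak-gain (suc s) h j w w<) ⟩
    Ks * (2 * m k w) ≡⟨ cong (λ z → Ks * (2 * z)) (sym e) ⟩
    Ks * (2 * fmin (suc s) k n) ∎
    where
    open ≤-Reasoning
    J = suc (suc j)
    k = suc J
    Ks = lowerConst J * suc s
    -- At most (s + 1)h ≤ n/2 letters are early, and 2(s + 1) ≤ n makes h positive, which is used to
    -- bound n by a multiple of (s + 1)h.
    h = n / (2 * suc s)
    P = tag h (λ _ → 0) 0 w
    R = map letter (late P)
    r = length R
    h*2s≤n : h * (2 * suc s) ≤ n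
    h*2s≤n = m/n*n≤m n (2 * suc s)
    n≤r+sh : n ≤ r + suc s * h
    n≤r+sh = ≤-trans (late-length (suc s) h (λ _ → 0) 0 w w<) (≤-reflexive (cong₂ _+_ (sym (Listₚ.length-map letter (late P)))
      (≡.trans (Σ-const (upTo (suc s)) h) (cong (_* h) (Listₚ.length-upTo (suc s))))))
    ring₀ : ∀ h s → h * (2 * s) ≡ s * h + s * h
    ring₀ = solve-∀
    n≤2r : n ≤ 2 * r
    n≤2r = +-cancelʳ-≤ n n (2 * r) (begin
      n + n ≤⟨ +-mono-≤ n≤r+sh n≤r+sh ⟩
      (r + suc s * h) + (r + suc s * h) ≡⟨ dbl r (suc s * h) ⟩
      2 * r + (suc s * h + suc s * h) ≡⟨ cong (2 * r +_) (sym (ring₀ h (suc s))) ⟩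
      2 * r + h * (2 * suc s) ≤⟨ +-monoʳ-≤ (2 * r) h*2s≤n ⟩
      2 * r + n ∎)
      where
      dbl : ∀ a b → (a + b) + (a + b) ≡ 2 * a + (b + b)
      dbl = solve-∀
    start≤r : J + 2 ^ (J + J) + 2 * J ≤ r
    start≤r = *-cancelˡ-≤ 2 (≤-trans st≤n n≤2r)
    h≥1 : 1 ≤ h
    h≥1 = m≥n⇒m/n>0 s≤n
    n≤4sh : n ≤ 4 * suc s * h
    n≤4sh = begin
      n ≤⟨ <⇒≤ (m<[1+m/n]*n n (2 * suc s)) ⟩
      suc h * (2 * suc s) ≤⟨ *-monoˡ-≤ (2 * suc s) (+-monoˡ-≤ h h≥1) ⟩
      (h + h) * (2 * suc s) ≡⟨ ring h (suc s) ⟩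
      4 * suc s * h ∎
      where
      ring : ∀ h s → (h + h) * (2 * s) ≡ 4 * s * h
      ring = solve-∀
    main : n C k ≤ Ks * (h * m J R)
    main = begin
      n C k ≤⟨ m≤m+n (n C k) _ ⟩
      k * (n C k) ≡⟨ C-step n J ⟩
      (n ∸ J) * (n C J) ≤⟨ *-mono-≤ (≤-trans (m∸n≤m n J) n≤4sh) (C-halve J n≤2r (≤-trans (m≤n+m (2 * J) (J + 2 ^ (J + J))) start≤r)) ⟩
      4 * suc s * h * (4 ^ J * (r C J)) ≤⟨ *-monoʳ-≤ (4 * suc s * h) (*-monoʳ-≤ (4 ^ J) (supersaturation J R (≤-trans (m≤m+n _ (2 * J)) start≤r))) ⟩
      4 * suc s * h * (4 ^ J * (((J + 2 ^ (J + J)) C J) * m J R)) ≡⟨ ring (suc s) h (4 ^ J) ((J + 2 ^ (J + J)) C J) (m J R) ⟩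
      Ks * (h * m J R) ∎
      where
      ring : ∀ s h p c m → 4 * s * h * (p * (c * m)) ≡ 4 * p * c * s * (h * m)
      ring = solve-∀

-- Upper bound for g(k): increasing sequence of decreasing blocks.

module DecreasingBlocks where

  open Counting
  open Minima
  open Coarsening
  open TieBreaking
  open import Data.Bool using (Bool; true; false; _∧_)
  open import Data.Nat using (ℕ; zero; suc; z≤n; s≤s; _+_; _*_; _∸_; _^_; _≤_; _<_; _≤ᵇ_; _≡ᵇ_; NonZero; _/_)
  open import Data.Nat.Properties
  open import Data.Nat.DivMod using (m/n*n≤m; /-mono-≤; m<n*o⇒m/o<n)
  open import Data.Nat.Combinatorics using (_C_)
  open import Data.Nat.Tactic.RingSolver using (solve-∀)
  open import Data.List using (List; []; _∷_; map; length; upTo)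
  import Data.List.Properties as Listₚ
  open import Data.List.Membership.Propositional using (_∈_)
  open import Data.List.Membership.Propositional.Properties using (∈-upTo⁻; ∈-upTo⁺)
  open import Data.List.Relation.Unary.All as All using (All; []; _∷_)
  open import Data.List.Relation.Unary.AllPairs using (AllPairs; []; _∷_)
  import Data.List.Relation.Unary.AllPairs.Properties as AllPairsₚ
  open import Data.List.Relation.Unary.Unique.Propositional.Properties using (upTo⁺)
  open import Data.List.Relation.Binary.Sublist.Propositional.Properties using (All-resp-⊆)
  open import Data.Product using (_,_)
  open import Data.Sum using (inj₁; inj₂)
  open import Function using (_∘_)
  open import Relation.Nullary using (contradiction)
  open import Relation.Binary.PropositionalEquality as ≡ using (_≡_; refl; sym; cong; cong₂; subst)

  module Blocks (J n : ℕ) .{{J≢0 : NonZero J}} where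

    q : ℕ
    q = suc (n / J)

    block : ℕ → ℕ
    block i = i / q

    open Merge block (λ a≤b → /-mono-≤ a≤b (≤-refl {q})) using (cnt)

    -- Again a two-digit number: the block in the high digit and the reversed position in the low
    -- one. The base is n + 1 because n ∸ i equals n for i = 0.
    key : ℕ → ℕ
    key i = block i * suc n + (n ∸ i)

    block-< : ∀ {i} → i < n → block i < J
    block-< {i} i<n = m<n*o⇒m/o<n (<-≤-trans (<-trans i<n (m<[1+m/n]*n n J)) (≤-reflexive (*-comm q J)))

    low< : ∀ i → n ∸ i < suc n
    low< i = s≤s (m∸n≤m n i)

    key-≤ : ∀ {i i′} → key i ≤ key i′ → block i ≤ block i′
    key-≤ {i} {i′} = digit-≤ (suc n) (block i) (block i′) (low< i′)

    key-injective : ∀ {i i′} → i ∈ upTo n → i′ ∈ upTo n → key i ≡ key i′ → i ≡ i′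
    key-injective {i} {i′} i∈ i′∈ e = ∸-cancelˡ-≡ (<⇒≤ (∈-upTo⁻ i∈)) (<⇒≤ (∈-upTo⁻ i′∈))
      (+-cancelˡ-≡ (block i * suc n) _ _ (≡.trans e (cong (λ b → b * suc n + (n ∸ i′)) (sym b≡))))
      where
      b≡ : block i ≡ block i′
      b≡ = ≤-antisym (key-≤ {i} {i′} (≤-reflexive e)) (key-≤ {i′} {i} (≤-reflexive (sym e)))

    ascent : ∀ {i i′} → i < i′ → i′ < n → key i ≤ key i′ → block i < block i′
    ascent {i} {i′} i<i′ i′<n le with m≤n⇒m<n∨m≡n (key-≤ {i} {i′} le)
    ... | inj₁ lt = lt
    ... | inj₂ e = contradiction (+-cancelˡ-≤ (block i * suc n) _ _ (subst (λ b → key i ≤ b * suc n + (n ∸ i′)) (sym e) le))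
                     (<⇒≱ (∸-monoʳ-< i<i′ (<⇒≤ i′<n)))

    allIs : ℕ → List ℕ → Bool
    allIs c [] = true
    allIs c (x ∷ xs) = (c ≡ᵇ block x) ∧ allIs c xs

    -- Keys strictly decrease inside a block, so each step of a nondecreasing subword enters a
    -- higher block, and the blocks are numbered below J.
    nondec-short : ∀ i u → AllPairs _<_ (i ∷ u) → All (_< n) (i ∷ u) → nondec (map key (i ∷ u)) ≡ true → block i + length u < J
    nondec-short i [] _ (i< ∷ _) _ = ≤-trans (s≤s (≤-reflexive (+-identityʳ _))) (block-< i<)
    nondec-short i (i′ ∷ u) ((i<i′ ∷ _) ∷ inc) (i< ∷ i′< ∷ u<) e =
      let e₁ , e₂ = ∧-true {key i ≤ᵇ key i′} e
      in ≤-trans (s≤s (≤-trans (≤-reflexive (+-suc (block i) (length u))) (+-monoˡ-≤ (length u) (ascent i<i′ i′< (≤ᵇ-true e₁)))))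
           (nondec-short i′ u inc (i′< ∷ u<) e₂)

    -- From left to right the block number cannot go down, and along nonincreasing keys it cannot go
    -- up.
    noninc-same : ∀ i u → AllPairs _<_ (i ∷ u) → noninc (map key (i ∷ u)) ≡ true → allIs (block i) (i ∷ u) ≡ true
    noninc-same i [] _ _ = ∧-intro (≡ᵇ-refl (block i)) refl
    noninc-same i (i′ ∷ u) ((i<i′ ∷ _) ∷ inc) e =
      let e₁ , e₂ = ∧-true {key i′ ≤ᵇ key i} e
          b≡ = ≤-antisym (/-mono-≤ {o = q} {p = q} (<⇒≤ i<i′) ≤-refl) (key-≤ {i′} {i} (≤ᵇ-true e₁))
      in ∧-intro (≡ᵇ-refl (block i)) (subst (λ b → allIs b (i′ ∷ u) ≡ true) (sym b≡) (noninc-same i′ u inc e₂))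

    count-allIs : ∀ c k xs → Σ[ subs k xs ] (ind ∘ allIs c) ≡ cnt c xs C k
    count-allIs c zero xs = refl
    count-allIs c (suc k) [] = refl
    count-allIs c (suc k) (x ∷ xs) = ≡.trans (Σ-subs-∷ k x xs _) step
      where
      step : Σ[ subs k xs ] (λ u → ind ((c ≡ᵇ block x) ∧ allIs c u)) + Σ[ subs (suc k) xs ] (ind ∘ allIs c) ≡ (ind (c ≡ᵇ block x) + cnt c xs) C suc k
      step with c ≡ᵇ block x
      ... | true  = ≡.trans (cong₂ _+_ (count-allIs c k xs) (count-allIs c (suc k) xs)) (sym (C-suc (cnt c xs) k))
      ... | false = cong₂ _+_ (Σ-𝟘 (subs k xs)) (count-allIs c (suc k) xs)

    pointwise : ∀ u → length u ≡ suc J → AllPairs _<_ u → All (_< n) u → ind (monotone (map key u)) ≤ Σ[ upTo J ] (λ c → ind (allIs c u))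
    pointwise u@(i ∷ v) l inc u<@(i< ∷ _) with monotone (map key u) in e
    ... | false = z≤n
    ... | true with ∨-true {nondec (map key u)} e
    ...   | inj₁ a = contradiction (nondec-short i v inc u< a) (≤⇒≯ (≤-trans (≤-reflexive (sym (suc-injective l))) (m≤n+m (length v) (block i))))
    ...   | inj₂ b = Σ≥1 (λ c → ind (allIs c u)) (∈-upTo⁺ (block-< i<)) (≤-reflexive (cong ind (sym (noninc-same i v inc b))))

    upTo-increasing : AllPairs _<_ (upTo n)
    upTo-increasing = AllPairsₚ.applyUpTo⁺₁ (λ x → x) n (λ i<j _ → i<j)

    gmin-blocks : gmin (suc J) n ≤ J * (q C suc J)
    gmin-blocks = begin
      gmin k n ≡⟨ cong (gmin k) (sym (≡.trans (Listₚ.length-map key (upTo n)) (Listₚ.length-upTo n))) ⟩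
      gmin k (length (map key (upTo n))) ≤⟨ gmin-≤ k (map key (upTo n)) (Unique-map∈ key key-injective (upTo⁺ n)) ⟩
      m k (map key (upTo n)) ≡⟨ ≡.trans (m-Σ k (map key (upTo n))) (Σ-subs-map key k (upTo n) _) ⟩
      Σ[ subs k (upTo n) ] (λ u → ind (monotone (map key u)))
        ≤⟨ Σ-mono∈ (subs k (upTo n)) (λ u u∈ → pointwise u (subs-length k (upTo n) u∈)
             (AllPairs-resp-⊆ (subs-⊆ k (upTo n) u∈) upTo-increasing)
             (All-resp-⊆ (subs-⊆ k (upTo n) u∈) (All.tabulate ∈-upTo⁻))) ⟩
      Σ[ subs k (upTo n) ] (λ u → Σ[ upTo J ] (λ c → ind (allIs c u))) ≡⟨ Σ-swap (subs k (upTo n)) (upTo J) _ ⟩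
      Σ[ upTo J ] (λ c → Σ[ subs k (upTo n) ] (ind ∘ allIs c)) ≡⟨ Σ-cong (upTo J) (λ c → count-allIs c k (upTo n)) ⟩
      Σ[ upTo J ] (λ c → cnt c (upTo n) C k) ≤⟨ Σ-mono (upTo J) (λ c → C-mono k (≤-trans (quotient-fibre q c n) (m⊓n≤n _ q))) ⟩
      Σ[ upTo J ] (λ c → q C k) ≡⟨ ≡.trans (Σ-const (upTo J) (q C k)) (cong (_* (q C k)) (Listₚ.length-upTo J)) ⟩
      J * (q C k) ∎
      where
      open ≤-Reasoning
      k = suc J

  -- It says J^J · gmin ≤ (1 + O(1/n)) C(n, J + 1), multiplied by n to remain in ℕ. The J blocks
  -- have size at most q and Jq ≤ n + J; by `C-shift` the J surplus points only cost a lower order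
  -- term.
  gmin-upper : ∀ j n → let J = suc j in 2 * J ≤ n →
    n * (J ^ J * gmin (suc J) n) ≤ n * (n C suc J) + J * 4 ^ J * (2 * suc J) * (n C suc J)
  gmin-upper j n J≤n = begin
    n * (J ^ J * gmin k n) ≤⟨ *-monoʳ-≤ n (*-monoʳ-≤ (J ^ J) (gmin-blocks)) ⟩
    n * (J ^ J * (J * (q C k))) ≡⟨ cong (n *_) (ring₁ (J ^ J) J (q C k)) ⟩
    n * (J ^ k * (q C k)) ≤⟨ *-monoʳ-≤ n (≤-trans (C-scale J q k (s≤s z≤n)) (C-mono k Jq≤)) ⟩
    n * ((n + J) C k) ≤⟨ *-monoʳ-≤ n (C-shift n J J) ⟩
    n * (n C k + J * ((n + J) C J)) ≤⟨ *-monoʳ-≤ n (+-monoʳ-≤ (n C k) (*-monoʳ-≤ J (C-halve J n+J≤ J≤n))) ⟩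
    n * (n C k + J * (4 ^ J * (n C J))) ≡⟨ ring₂ n (n C k) J (4 ^ J) (n C J) ⟩
    n * (n C k) + J * 4 ^ J * (n * (n C J)) ≤⟨ +-monoʳ-≤ (n * (n C k)) (*-monoʳ-≤ (J * 4 ^ J) (n*C≤ n J J≤n)) ⟩
    n * (n C k) + J * 4 ^ J * (2 * suc J * (n C k)) ≡⟨ cong (n * (n C k) +_) (sym (*-assoc (J * 4 ^ J) (2 * suc J) (n C k))) ⟩
    n * (n C k) + J * 4 ^ J * (2 * suc J) * (n C k) ∎
    where
    open ≤-Reasoning
    J = suc j
    k = suc J
    open Blocks J n using (q; gmin-blocks)
    ring₁ : ∀ p J c → p * (J * c) ≡ J * p * c
    ring₁ = solve-∀
    ring₂ : ∀ n b J p c → n * (b + J * (p * c)) ≡ n * b + J * p * (n * c)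
    ring₂ = solve-∀
    Jq≤ : J * q ≤ n + J
    Jq≤ = ≤-trans (≤-reflexive (≡.trans (*-suc J (n / J)) (+-comm J _))) (+-monoˡ-≤ J (≤-trans (≤-reflexive (*-comm J (n / J))) (m/n*n≤m n J)))
    n+J≤ : n + J ≤ 2 * n
    n+J≤ = ≤-trans (+-monoʳ-≤ n (≤-trans (m≤n*m J 2) J≤n)) (≤-reflexive (cong (n +_) (sym (+-identityʳ n))))

-- From counts to ratios and limits.

module Densities where

  open Counting
  open Minima
  open Coarsening
  open TieBreaking
  open import Data.Nat using (ℕ; suc; z≤n; s≤s; _⊔_; >-nonZero; _/_)
  import Data.Nat as ℕ
  import Data.Nat.Properties as ℕₚ
  open import Data.Nat.DivMod using (m/n*n≤m)
  open import Data.Nat.Combinatorics using (_C_)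
  import Data.Nat.Tactic.RingSolver as ℕ-Ring
  open import Data.Integer as ℤ using (+_; +≤+; -[1+_])
  import Data.Integer.Properties as ℤₚ
  open import Data.Rational as ℚ using (ℚ; 0ℚ; mkℚ; _+_; _-_; _*_; -_; _≤_; _<_; ∣_∣; *<*; toℚᵘ)
  open import Data.Rational.Properties
  open import Data.Rational.Unnormalised as ℚᵘ using (mkℚᵘ; *≤*; *<*; _≃_)
  import Data.Rational.Unnormalised.Properties as ℚᵘₚ
  open import Algebra.Properties.Group +-0-group using () renaming (⁻¹-involutive to neg-involutive)
  open import Data.Product using (_×_; _,_; ∃-syntax)
  open import Data.Sum using (inj₁; inj₂)
  open import Relation.Binary.PropositionalEquality using (_≡_; refl; sym; trans; cong; cong₂; subst; subst₂)

  toℚᵘ-ratio : ∀ a b → toℚᵘ (ratio a (suc b)) ≃ mkℚᵘ (+ a) b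
  toℚᵘ-ratio a b = toℚᵘ-fromℚᵘ (mkℚᵘ (+ a) b)

  ratio-≤ : ∀ a c {N M} → 0 ℕ.< N → 0 ℕ.< M → a ℕ.* M ℕ.≤ c ℕ.* N → ratio a N ≤ ratio c M
  ratio-≤ a c {suc b} {suc d} _ _ le = toℚᵘ-cancel-≤ (begin
    toℚᵘ (ratio a (suc b)) ≃⟨ toℚᵘ-ratio a b ⟩
    mkℚᵘ (+ a) b ≤⟨ *≤* (subst₂ ℤ._≤_ (ℤₚ.pos-* a (suc d)) (ℤₚ.pos-* c (suc b)) (+≤+ le)) ⟩
    mkℚᵘ (+ c) d ≃⟨ toℚᵘ-ratio c d ⟨
    toℚᵘ (ratio c (suc d)) ∎)
    where open ℚᵘₚ.≤-Reasoning

  ratio-+ : ∀ a c {N M} → 0 ℕ.< N → 0 ℕ.< M → ratio a N + ratio c M ≡ ratio (a ℕ.* M ℕ.+ c ℕ.* N) (N ℕ.* M)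
  ratio-+ a c {suc b} {suc d} _ _ = toℚᵘ-injective (begin-equality
    toℚᵘ (ratio a (suc b) + ratio c (suc d)) ≃⟨ toℚᵘ-homo-+ (ratio a (suc b)) (ratio c (suc d)) ⟩
    toℚᵘ (ratio a (suc b)) ℚᵘ.+ toℚᵘ (ratio c (suc d)) ≃⟨ ℚᵘₚ.+-cong (toℚᵘ-ratio a b) (toℚᵘ-ratio c d) ⟩
    mkℚᵘ (+ a) b ℚᵘ.+ mkℚᵘ (+ c) d ≡⟨ cong (λ z → mkℚᵘ z (d ℕ.+ b ℕ.* suc d)) (cong₂ ℤ._+_ (sym (ℤₚ.pos-* a (suc d))) (sym (ℤₚ.pos-* c (suc b)))) ⟩
    mkℚᵘ (+ (a ℕ.* suc d ℕ.+ c ℕ.* suc b)) (d ℕ.+ b ℕ.* suc d) ≃⟨ toℚᵘ-ratio _ _ ⟨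
    toℚᵘ (ratio (a ℕ.* suc d ℕ.+ c ℕ.* suc b) (suc b ℕ.* suc d)) ∎)
    where open ℚᵘₚ.≤-Reasoning

  ratio-* : ∀ a c {N M} → 0 ℕ.< N → 0 ℕ.< M → ratio a N * ratio c M ≡ ratio (a ℕ.* c) (N ℕ.* M)
  ratio-* a c {suc b} {suc d} _ _ = toℚᵘ-injective (begin-equality
    toℚᵘ (ratio a (suc b) * ratio c (suc d)) ≃⟨ toℚᵘ-homo-* (ratio a (suc b)) (ratio c (suc d)) ⟩
    toℚᵘ (ratio a (suc b)) ℚᵘ.* toℚᵘ (ratio c (suc d)) ≃⟨ ℚᵘₚ.*-cong (toℚᵘ-ratio a b) (toℚᵘ-ratio c d) ⟩
    mkℚᵘ (+ a) b ℚᵘ.* mkℚᵘ (+ c) d ≡⟨ cong (λ z → mkℚᵘ z (d ℕ.+ b ℕ.* suc d)) (sym (ℤₚ.pos-* a c)) ⟩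
    mkℚᵘ (+ (a ℕ.* c)) (d ℕ.+ b ℕ.* suc d) ≃⟨ toℚᵘ-ratio _ _ ⟨
    toℚᵘ (ratio (a ℕ.* c) (suc b ℕ.* suc d)) ∎)
    where open ℚᵘₚ.≤-Reasoning

  ratio>0 : ∀ a {N} → 0 ℕ.< a → 0 ℕ.< N → 0ℚ < ratio a N
  ratio>0 (suc a) {suc b} _ _ = toℚᵘ-cancel-< (ℚᵘₚ.<-respʳ-≃ (ℚᵘₚ.≃-sym (toℚᵘ-ratio (suc a) b)) (*<* (ℤ.+<+ (s≤s z≤n))))

  +-≤⇒≤-- : ∀ p q r → p + q ≤ r → p ≤ r - q
  +-≤⇒≤-- p q r le = begin
    p ≡⟨ sym (+-identityʳ p) ⟩
    p + 0ℚ ≡⟨ cong (_+_ p) (sym (+-inverseʳ q)) ⟩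
    p + (q - q) ≡⟨ sym (+-assoc p q (- q)) ⟩
    p + q - q ≤⟨ +-monoˡ-≤ (- q) le ⟩
    r - q ∎
    where open ≤-Reasoning

  ≤-+⇒--≤ : ∀ p q r → p ≤ r + q → p - q ≤ r
  ≤-+⇒--≤ p q r le = begin
    p - q ≤⟨ +-monoˡ-≤ (- q) le ⟩
    r + q - q ≡⟨ +-assoc r q (- q) ⟩
    r + (q - q) ≡⟨ cong (_+_ r) (+-inverseʳ q) ⟩
    r + 0ℚ ≡⟨ +-identityʳ r ⟩
    r ∎
    where open ≤-Reasoning

  ratio-gap-≥ : ∀ f g c {N M K} → 0 ℕ.< N → 0 ℕ.< M → 0 ℕ.< K →
    (c ℕ.* M ℕ.+ g ℕ.* K) ℕ.* N ℕ.≤ f ℕ.* (K ℕ.* M) → ratio c K ≤ ratio f N - ratio g M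
  ratio-gap-≥ f g c {N} {M} {K} N>0 M>0 K>0 le = +-≤⇒≤-- _ _ _ (subst (_≤ ratio f N) (sym (ratio-+ c g K>0 M>0))
    (ratio-≤ (c ℕ.* M ℕ.+ g ℕ.* K) f (ℕₚ.*-mono-≤ K>0 M>0) N>0 le))

  ratio-gap-≤ : ∀ f g c {N M K} → 0 ℕ.< N → 0 ℕ.< M → 0 ℕ.< K →
    f ℕ.* (K ℕ.* M) ℕ.≤ (c ℕ.* M ℕ.+ g ℕ.* K) ℕ.* N → ratio f N - ratio g M ≤ ratio c K
  ratio-gap-≤ f g c {N} {M} {K} N>0 M>0 K>0 le = ≤-+⇒--≤ _ _ _ (subst (ratio f N ≤_) (sym (ratio-+ c g K>0 M>0))
    (ratio-≤ f (c ℕ.* M ℕ.+ g ℕ.* K) N>0 (ℕₚ.*-mono-≤ K>0 M>0) le))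

  -- A product of three factors: 2 since (s + 1)(⌊n/(s + 1)⌋ + 1) ≤ 2n, J for the places of a tie,
  -- and 2(J + 1) from `n*C≤`.
  upperConst : ℕ → ℕ
  upperConst J = 4 ℕ.* J ℕ.* suc J

  fmin-upper : ∀ J s n → suc s ℕ.≤ n → 2 ℕ.* J ℕ.≤ n →
    suc s ℕ.* fmin (suc s) (suc J) n ℕ.≤ suc s ℕ.* gmin (suc J) n ℕ.+ upperConst J ℕ.* (n C suc J)
  fmin-upper J s n s≤n J≤n = begin
    suc s ℕ.* fmin (suc s) (suc J) n ≤⟨ ℕₚ.*-monoʳ-≤ (suc s) (fmin≤gmin s J n) ⟩
    suc s ℕ.* (gm ℕ.+ suc q ℕ.* J ℕ.* (n C J)) ≡⟨ ring₁ (suc s) gm q J (n C J) ⟩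
    suc s ℕ.* gm ℕ.+ (suc s ℕ.+ q ℕ.* suc s) ℕ.* (J ℕ.* (n C J)) ≤⟨ ℕₚ.+-monoʳ-≤ (suc s ℕ.* gm) (ℕₚ.*-monoˡ-≤ (J ℕ.* (n C J)) (ℕₚ.+-mono-≤ s≤n (m/n*n≤m n (suc s)))) ⟩
    suc s ℕ.* gm ℕ.+ (n ℕ.+ n) ℕ.* (J ℕ.* (n C J)) ≤⟨ ℕₚ.+-monoʳ-≤ (suc s ℕ.* gm) bound ⟩
    suc s ℕ.* gm ℕ.+ upperConst J ℕ.* (n C suc J) ∎
    where
    open ℕₚ.≤-Reasoning
    gm = gmin (suc J) n
    q = n / suc s
    ring₁ : ∀ s g q J c → s ℕ.* (g ℕ.+ suc q ℕ.* J ℕ.* c) ≡ s ℕ.* g ℕ.+ (s ℕ.+ q ℕ.* s) ℕ.* (J ℕ.* c)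
    ring₁ = ℕ-Ring.solve-∀
    ring₂ : ∀ n J c → (n ℕ.+ n) ℕ.* (J ℕ.* c) ≡ 2 ℕ.* J ℕ.* (n ℕ.* c)
    ring₂ = ℕ-Ring.solve-∀
    ring₃ : ∀ J c → 2 ℕ.* J ℕ.* (2 ℕ.* suc J ℕ.* c) ≡ 4 ℕ.* J ℕ.* suc J ℕ.* c
    ring₃ = ℕ-Ring.solve-∀
    bound : (n ℕ.+ n) ℕ.* (J ℕ.* (n C J)) ℕ.≤ upperConst J ℕ.* (n C suc J)
    bound = begin
      (n ℕ.+ n) ℕ.* (J ℕ.* (n C J)) ≡⟨ ring₂ n J (n C J) ⟩
      2 ℕ.* J ℕ.* (n ℕ.* (n C J)) ≤⟨ ℕₚ.*-monoʳ-≤ (2 ℕ.* J) (n*C≤ n J J≤n) ⟩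
      2 ℕ.* J ℕ.* (2 ℕ.* suc J ℕ.* (n C suc J)) ≡⟨ ring₃ J (n C suc J) ⟩
      upperConst J ℕ.* (n C suc J) ∎

  lowerConst>0 : ∀ J → 0 ℕ.< lowerConst J
  lowerConst>0 J = ℕₚ.*-mono-≤ {1} {4 ℕ.* 4 ℕ.^ J} (ℕₚ.*-mono-≤ {1} {4} (s≤s z≤n) (ℕₚ.m^n>0 4 J)) (C>0 {J ℕ.+ 2 ℕ.^ (J ℕ.+ J)} {J} (ℕₚ.m≤m+n J _))

  -- The 2 in `c₁` accounts for the two permutations summed in `fmin-lower`.
  c₁ c₂ : ℕ → ℚ
  c₁ J = ratio 1 (2 ℕ.* lowerConst J)
  c₂ J = ratio (upperConst J) 1

  -- The threshold for n depends on s, since h ≥ 1 requires n ≥ 2(s + 1); the constants `c₁` and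
  -- `c₂` do not, and this is what Θ(1/s) demands.
  f-g-bounds : ∀ j s → let J = suc (suc j) in ∃[ N ] (∀ n → N ℕ.≤ n →
    (c₁ J * inv (suc s) ≤ f (suc s) (suc J) n - g (suc J) n) × (f (suc s) (suc J) n - g (suc J) n ≤ c₂ J * inv (suc s)))
  f-g-bounds j s = N₀ , λ n N≤n → lower n N≤n , upper n N≤n
    where
    J = suc (suc j)
    N₀ = 2 ℕ.* suc s ⊔ lowerStart J
    module _ (n : ℕ) (N≤n : N₀ ℕ.≤ n) where
      s≤n : 2 ℕ.* suc s ℕ.≤ n
      s≤n = ℕₚ.≤-trans (ℕₚ.m≤m⊔n _ (lowerStart J)) N≤n
      st≤n : lowerStart J ℕ.≤ n
      st≤n = ℕₚ.≤-trans (ℕₚ.m≤n⊔m (2 ℕ.* suc s) _) N≤n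
      4J≤n : 2 ℕ.* (2 ℕ.* J) ℕ.≤ n
      4J≤n = ℕₚ.≤-trans (ℕₚ.*-monoʳ-≤ 2 (ℕₚ.m≤n+m (2 ℕ.* J) (J ℕ.+ 2 ℕ.^ (J ℕ.+ J)))) st≤n
      2J≤n : 2 ℕ.* J ℕ.≤ n
      2J≤n = ℕₚ.≤-trans (ℕₚ.m≤n*m (2 ℕ.* J) 2) 4J≤n
      k≤n : suc J ℕ.≤ n
      k≤n = ℕₚ.≤-trans (ℕₚ.≤-trans (ℕₚ.+-monoˡ-≤ J {1} {J} (s≤s z≤n)) (ℕₚ.≤-reflexive (cong (J ℕ.+_) (sym (ℕₚ.+-identityʳ J))))) 2J≤n
      C≡>0 : 0 ℕ.< n C suc J
      C≡>0 = C>0 {n} {suc J} k≤n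
      F = fmin (suc s) (suc J) n
      G = gmin (suc J) n
      K = lowerConst J
      B = n C suc J
      lower : c₁ J * inv (suc s) ≤ f (suc s) (suc J) n - g (suc J) n
      lower = subst (_≤ ratio F B - ratio G B) (sym (ratio-* 1 1 {2 ℕ.* K} {suc s} (ℕₚ.*-mono-≤ {1} {2} (s≤s z≤n) (lowerConst>0 J)) (s≤s z≤n)))
        (ratio-gap-≥ F G 1 C≡>0 C≡>0 (ℕₚ.*-mono-≤ {1} {2 ℕ.* K} {1} {suc s} (ℕₚ.*-mono-≤ {1} {2} (s≤s z≤n) (lowerConst>0 J)) (s≤s z≤n)) le)
        where
        open ℕₚ.≤-Reasoning
        ring₁ : ∀ b g k s → (1 ℕ.* b ℕ.+ g ℕ.* (2 ℕ.* k ℕ.* s)) ≡ k ℕ.* s ℕ.* (2 ℕ.* g) ℕ.+ b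
        ring₁ = ℕ-Ring.solve-∀
        ring₂ : ∀ b f k s → k ℕ.* s ℕ.* (2 ℕ.* f) ℕ.* b ≡ f ℕ.* (2 ℕ.* k ℕ.* s ℕ.* b)
        ring₂ = ℕ-Ring.solve-∀
        le : (1 ℕ.* B ℕ.+ G ℕ.* (2 ℕ.* K ℕ.* suc s)) ℕ.* B ℕ.≤ F ℕ.* (2 ℕ.* K ℕ.* suc s ℕ.* B)
        le = begin
          (1 ℕ.* B ℕ.+ G ℕ.* (2 ℕ.* K ℕ.* suc s)) ℕ.* B ≡⟨ cong (ℕ._* B) (ring₁ B G K (suc s)) ⟩
          (K ℕ.* suc s ℕ.* (2 ℕ.* G) ℕ.+ B) ℕ.* B ≤⟨ ℕₚ.*-monoˡ-≤ B (fmin-lower j s n s≤n st≤n) ⟩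
          K ℕ.* suc s ℕ.* (2 ℕ.* F) ℕ.* B ≡⟨ ring₂ B F K (suc s) ⟩
          F ℕ.* (2 ℕ.* K ℕ.* suc s ℕ.* B) ∎
      upper : f (suc s) (suc J) n - g (suc J) n ≤ c₂ J * inv (suc s)
      upper = subst (ratio F B - ratio G B ≤_) (sym (trans (ratio-* (upperConst J) 1 {1} {suc s} (s≤s z≤n) (s≤s z≤n)) scale))
        (ratio-gap-≤ F G (upperConst J) {B} {B} {suc s} C≡>0 C≡>0 (s≤s z≤n) le)
        where
        open ℕₚ.≤-Reasoning
        U = upperConst J
        scale : ratio (U ℕ.* 1) (1 ℕ.* suc s) ≡ ratio U (suc s)
        scale = cong₂ ratio (ℕₚ.*-identityʳ U) (ℕₚ.*-identityˡ (suc s))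
        ring₁ : ∀ b f s → f ℕ.* (s ℕ.* b) ≡ s ℕ.* f ℕ.* b
        ring₁ = ℕ-Ring.solve-∀
        ring₂ : ∀ b g s u → s ℕ.* g ℕ.+ u ℕ.* b ≡ u ℕ.* b ℕ.+ g ℕ.* s
        ring₂ = ℕ-Ring.solve-∀
        le : F ℕ.* (suc s ℕ.* B) ℕ.≤ (U ℕ.* B ℕ.+ G ℕ.* suc s) ℕ.* B
        le = begin
          F ℕ.* (suc s ℕ.* B) ≡⟨ ring₁ B F (suc s) ⟩
          suc s ℕ.* F ℕ.* B ≤⟨ ℕₚ.*-monoˡ-≤ B (fmin-upper J s n (ℕₚ.≤-trans (ℕₚ.m≤n*m (suc s) 2) s≤n) 2J≤n) ⟩
          (suc s ℕ.* G ℕ.+ U ℕ.* B) ℕ.* B ≡⟨ cong (ℕ._* B) (ring₂ B G (suc s) U) ⟩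
          (U ℕ.* B ℕ.+ G ℕ.* suc s) ℕ.* B ∎

  c₁>0 : ∀ J → 0ℚ < c₁ J
  c₁>0 J = ratio>0 1 (s≤s z≤n) (ℕₚ.*-mono-≤ {1} {2} (s≤s z≤n) (lowerConst>0 J))

  c₂>0 : ∀ j → 0ℚ < c₂ (suc (suc j))
  c₂>0 j = ratio>0 (upperConst (suc (suc j))) {1} (s≤s z≤n) (s≤s z≤n)

  ≤-slack⁺ : ∀ p ε → 0ℚ < ε → p ≤ p + ε
  ≤-slack⁺ p ε ε>0 = subst (_≤ p + ε) (+-identityʳ p) (+-monoʳ-≤ p (<⇒≤ ε>0))

  ≤-slack⁻ : ∀ p ε → 0ℚ < ε → p - ε ≤ p
  ≤-slack⁻ p ε ε>0 = ≤-+⇒--≤ p ε p (≤-slack⁺ p ε ε>0)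

  theta-g : ∀ k → 3 ℕ.≤ k → ThetaInv (λ s n → f s k n - g k n)
  theta-g (suc (suc (suc j))) (s≤s (s≤s (s≤s z≤n))) = c₁ J , c₂ J , c₁>0 J , c₂>0 j , 1 , λ { (suc s) _ ε ε>0 →
    let N , b = f-g-bounds j s in N , λ n N≤n → let lo , hi = b n N≤n in
      ≤-trans (≤-slack⁻ _ ε ε>0) lo , ≤-trans hi (≤-slack⁺ _ ε ε>0) }
    where J = suc (suc j)

  p≤∣p∣ : ∀ p → p ≤ ∣ p ∣
  p≤∣p∣ p with ≤-total 0ℚ p
  ... | inj₁ 0≤p = ≤-reflexive (sym (0≤p⇒∣p∣≡p 0≤p))
  ... | inj₂ p≤0 = ≤-trans p≤0 (0≤∣p∣ p)

  split-diff : ∀ p q r → (p - q) + (q - r) ≡ p - r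
  split-diff p q r = trans (+-assoc p (- q) (q - r)) (cong (_+_ p) (trans (sym (+-assoc (- q) q (- r))) (trans (cong (_+ - r) (+-inverseˡ q)) (+-identityˡ (- r)))))

  neg-diff : ∀ p q → - (p - q) ≡ q - p
  neg-diff p q = trans (neg-distrib-+ p (- q)) (trans (+-comm (- p) (- - q)) (cong (_- p) (neg-involutive q)))

  -- The difference f - L is (f - g) + (g - L). The first summand satisfies its bounds exactly for
  -- large n, so the whole ε is available for the second.
  theta-limit : ∀ k L → 3 ℕ.≤ k → Converges (g k) L → ThetaInv (λ s n → f s k n - L)
  theta-limit (suc (suc (suc j))) L (s≤s (s≤s (s≤s z≤n))) conv = c₁ J , c₂ J , c₁>0 J , c₂>0 j , 1 , λ { (suc s) _ ε ε>0 →
    let N , b = f-g-bounds j s ; M , c = conv ε ε>0 in N ⊔ M , λ n le →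
      let lo , hi = b n (ℕₚ.≤-trans (ℕₚ.m≤m⊔n N M) le)
          d = c n (ℕₚ.≤-trans (ℕₚ.m≤n⊔m N M) le)
          F = f (suc s) k n ; G = g k n
          hi′ = ≤-trans (p≤∣p∣ (G - L)) d
          lo′ = subst (- ε ≤_) (trans (cong -_ (sym (neg-diff G L))) (neg-involutive (G - L)))
                  (neg-antimono-≤ (≤-trans (≤-trans (p≤∣p∣ (L - G)) (≤-reflexive (trans (cong ∣_∣ (sym (neg-diff G L))) (∣-p∣≡∣p∣ (G - L))))) d))
      in subst (c₁ J * inv (suc s) - ε ≤_) (split-diff F G L) (+-mono-≤ lo lo′)
       , subst (_≤ c₂ J * inv (suc s) + ε) (split-diff F G L) (+-mono-≤ hi hi′) }
    where
    J = suc (suc j)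
    k = suc J

  small : ∀ ε → 0ℚ < ε → ∃[ D ] (0 ℕ.< D × ratio 1 D ≤ ε)
  small (mkℚ (+ suc a) d co) _ = suc d , s≤s z≤n , toℚᵘ-cancel-≤ (begin
    toℚᵘ (ratio 1 (suc d)) ≃⟨ toℚᵘ-ratio 1 d ⟩
    mkℚᵘ (+ 1) d ≤⟨ *≤* (ℤₚ.*-monoʳ-≤-nonNeg (+ suc d) {+ 1} {+ suc a} (+≤+ (s≤s z≤n))) ⟩
    mkℚᵘ (+ suc a) d ≡⟨ refl ⟩
    toℚᵘ (mkℚ (+ suc a) d co) ∎)
    where open ℚᵘₚ.≤-Reasoning
  small (mkℚ (+ 0) d co) (*<* (ℤ.+<+ ()))
  small (mkℚ -[1+ a ] d co) (*<* ())

  ∣-∣-≤ : ∀ p {q} → p ≤ q → - p ≤ q → ∣ p ∣ ≤ q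
  ∣-∣-≤ p {q} a b with ∣p∣≡p∨∣p∣≡-p p
  ... | inj₁ e = subst (_≤ q) (sym e) a
  ... | inj₂ e = subst (_≤ q) (sym e) b

  -- The two inequalities say that R · gmin / C(n, k) differs from 1 by at most c/n; dividing by R ≥
  -- 1 does not enlarge the error.
  converges : ∀ k R c N₀ → 0 ℕ.< R → (∀ n → N₀ ℕ.≤ n → k ℕ.≤ n
      × n ℕ.* (R ℕ.* gmin k n) ℕ.≤ n ℕ.* (n C k) ℕ.+ c ℕ.* (n C k)
      × n ℕ.* (n C k) ℕ.≤ n ℕ.* (R ℕ.* gmin k n) ℕ.+ c ℕ.* (n C k)) → Converges (g k) (ratio 1 R)
  -- From n > c · D follows c/n ≤ 1/D ≤ ε.
  converges k R c N₀ R>0 H ε ε>0 = let D , D>0 , D≤ = small ε ε>0 in N₀ ⊔ suc (c ℕ.* D) , λ n le →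
    let k≤n , up , lo = H n (ℕₚ.≤-trans (ℕₚ.m≤m⊔n N₀ _) le)
        n≥ = ℕₚ.≤-trans (ℕₚ.m≤n⊔m N₀ _) le
    in ≤-trans (bound n k≤n (ℕₚ.≤-trans (s≤s z≤n) n≥) up lo) (≤-trans (ratio-≤ c 1 (ℕₚ.≤-trans (s≤s z≤n) n≥) D>0 (ℕₚ.≤-trans (ℕₚ.≤-trans (ℕₚ.n≤1+n _) n≥) (ℕₚ.≤-reflexive (sym (ℕₚ.*-identityˡ n))))) D≤)
    where
    bound : ∀ n → k ℕ.≤ n → 0 ℕ.< n → n ℕ.* (R ℕ.* gmin k n) ℕ.≤ n ℕ.* (n C k) ℕ.+ c ℕ.* (n C k)
      → n ℕ.* (n C k) ℕ.≤ n ℕ.* (R ℕ.* gmin k n) ℕ.+ c ℕ.* (n C k) → ∣ g k n - ratio 1 R ∣ ≤ ratio c n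
    bound n k≤n n>0 up lo = ∣-∣-≤ (g k n - ratio 1 R) (ratio-gap-≤ G 1 c B>0 R>0 n>0 upper)
        (subst (_≤ ratio c n) (sym (neg-diff (g k n) (ratio 1 R))) (ratio-gap-≤ 1 G c R>0 B>0 n>0 lower))
      where
      open ℕₚ.≤-Reasoning
      G = gmin k n
      B = n C k
      B>0 : 0 ℕ.< B
      B>0 = C>0 {n} {k} k≤n
      r₁ : ∀ g n R → g ℕ.* (n ℕ.* R) ≡ n ℕ.* (R ℕ.* g)
      r₁ = ℕ-Ring.solve-∀
      r₂ : ∀ c n b → n ℕ.* b ℕ.+ c ℕ.* b ≡ (c ℕ.+ n) ℕ.* b
      r₂ = ℕ-Ring.solve-∀
      r₃ : ∀ c n R g b → n ℕ.* (R ℕ.* g) ℕ.+ c ℕ.* b ≡ c ℕ.* b ℕ.+ g ℕ.* n ℕ.* R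
      r₃ = ℕ-Ring.solve-∀
      upper : G ℕ.* (n ℕ.* R) ℕ.≤ (c ℕ.* R ℕ.+ 1 ℕ.* n) ℕ.* B
      upper = begin
        G ℕ.* (n ℕ.* R) ≡⟨ r₁ G n R ⟩
        n ℕ.* (R ℕ.* G) ≤⟨ up ⟩
        n ℕ.* B ℕ.+ c ℕ.* B ≡⟨ r₂ c n B ⟩
        (c ℕ.+ n) ℕ.* B ≤⟨ ℕₚ.*-monoˡ-≤ B (ℕₚ.+-mono-≤ (ℕₚ.m≤m*n c R {{>-nonZero R>0}}) (ℕₚ.≤-reflexive (sym (ℕₚ.*-identityˡ n)))) ⟩
        (c ℕ.* R ℕ.+ 1 ℕ.* n) ℕ.* B ∎
      lower : 1 ℕ.* (n ℕ.* B) ℕ.≤ (c ℕ.* B ℕ.+ G ℕ.* n) ℕ.* R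
      lower = begin
        1 ℕ.* (n ℕ.* B) ≡⟨ ℕₚ.*-identityˡ _ ⟩
        n ℕ.* B ≤⟨ lo ⟩
        n ℕ.* (R ℕ.* G) ℕ.+ c ℕ.* B ≡⟨ r₃ c n R G B ⟩
        c ℕ.* B ℕ.+ G ℕ.* n ℕ.* R ≤⟨ ℕₚ.+-monoˡ-≤ (G ℕ.* n ℕ.* R) (ℕₚ.m≤m*n (c ℕ.* B) R {{>-nonZero R>0}}) ⟩
        c ℕ.* B ℕ.* R ℕ.+ G ℕ.* n ℕ.* R ≡⟨ sym (ℕₚ.*-distribʳ-+ R (c ℕ.* B) (G ℕ.* n)) ⟩
        (c ℕ.* B ℕ.+ G ℕ.* n) ℕ.* R ∎

-- Flag algebra method: nonnegative sums of positive semidefinite kernels.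

module Flags where

  open Counting
  open Minima
  open Coarsening using (∧-true)
  open TieBreaking using (AllPairs-resp-⊆)
  open import Data.Bool using (Bool; true; false; T; _∧_; if_then_else_)
  open import Data.Nat as ℕ using (ℕ; zero; suc; z≤n; _≤ᵇ_; _<ᵇ_; _/_; _%_; _!; >-nonZero)
  import Data.Nat.Properties as ℕₚ
  open import Data.Nat.DivMod using (m%n<n)
  import Data.Nat.Tactic.RingSolver as ℕ-Ring
  open import Data.Nat.Combinatorics using (_C_; k>n⇒nCk≡0)
  open import Data.Integer as ℤ using (ℤ; +_; 0ℤ; _+_; _*_; _-_; -_; _⊖_; ∣_∣; _≤_; +≤+)
  open import Data.Integer.Properties
  open import Data.List using (List; []; _∷_; map; _++_; length; upTo)
  import Data.List.Properties as Listₚ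
  open import Data.List.Membership.Propositional using (_∈_)
  open import Data.List.Membership.Propositional.Properties using (∈-map⁺; ∈-map⁻; ∈-++⁻)
  open import Data.List.Relation.Unary.Any using (here; there)
  open import Data.List.Relation.Unary.All as All using (All; []; _∷_)
  open import Data.List.Relation.Unary.AllPairs using (AllPairs; []; _∷_)
  import Data.List.Relation.Unary.AllPairs.Properties as AllPairsₚ
  open import Data.List.Relation.Unary.Unique.Propositional using (Unique)
  open import Data.List.Relation.Unary.Unique.Propositional.Properties using (upTo⁺)
  open import Data.List.Relation.Binary.Permutation.Propositional using (↭-sym)
  open import Data.List.Relation.Binary.Permutation.Propositional.Properties using (↭-length)
  open import Data.List.Relation.Binary.Sublist.Propositional using (_⊆_; []; _∷_; _∷ʳ_; ⊆-refl; ⊆-trans; lookup; minimum)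
  open import Data.Product using (_×_; _,_; proj₁; proj₂; ∃-syntax)
  open import Data.Sum using (inj₁; inj₂)
  open import Function using (_∘_)
  open import Relation.Nullary using (yes; no; contradiction)
  open import Relation.Binary.PropositionalEquality using (_≡_; refl; sym; trans; cong; cong₂; subst; subst₂; module ≡-Reasoning)

  private variable
    A B X : Set

  open Sums +-0-isCommutativeMonoid public using () renaming
    ( Σ[_] to ∑[_]; Σ-++ to ∑-++; Σ-map to ∑-map; Σ-cong∈ to ∑-cong∈; Σ-cong to ∑-cong; Σ-⊕ to ∑-+; Σ-𝟘 to ∑-0
    ; Σ-swap to ∑-swap; Σ-subs-∷ to ∑-subs-∷; Σ-sel-∷ to ∑-sel-∷; Σ-sel-subs to ∑-sel-subs)

  ∑-mono∈ : ∀ (xs : List A) {f g : A → ℤ} → (∀ x → x ∈ xs → f x ≤ g x) → ∑[ xs ] f ≤ ∑[ xs ] g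
  ∑-mono∈ [] e = ≤-refl
  ∑-mono∈ (x ∷ xs) e = +-mono-≤ (e x (here refl)) (∑-mono∈ xs (λ y y∈ → e y (there y∈)))

  ∑-*ˡ : ∀ c (xs : List A) f → ∑[ xs ] (λ x → c * f x) ≡ c * ∑[ xs ] f
  ∑-*ˡ c [] f = sym (*-zeroʳ c)
  ∑-*ˡ c (x ∷ xs) f = trans (cong (_+_ (c * f x)) (∑-*ˡ c xs f)) (sym (*-distribˡ-+ c _ _))

  ∑-*ʳ : ∀ c (xs : List A) f → ∑[ xs ] (λ x → f x * c) ≡ ∑[ xs ] f * c
  ∑-*ʳ c xs f = trans (∑-cong xs (λ x → *-comm (f x) c)) (trans (∑-*ˡ c xs f) (*-comm c _))

  ∑-pos : ∀ (xs : List A) (f : A → ℕ) → ∑[ xs ] (λ x → + f x) ≡ + Σ[ xs ] f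
  ∑-pos [] f = refl
  ∑-pos (x ∷ xs) f = cong (_+_ (+ f x)) (∑-pos xs f)

  ∑-const : ∀ (xs : List A) c → ∑[ xs ] (λ _ → + c) ≡ + (length xs ℕ.* c)
  ∑-const xs c = trans (∑-pos xs (λ _ → c)) (cong +_ (Σ-const xs c))

  ∑-sel-fst : ∀ k (xs : List A) (F : List A → ℤ) → ∑[ sel k xs ] (λ (T , _) → F T) ≡ ∑[ subs k xs ] F
  ∑-sel-fst zero xs F = refl
  ∑-sel-fst (suc k) [] F = refl
  ∑-sel-fst (suc k) (x ∷ xs) F = trans (∑-sel-∷ k x xs _)
    (trans (cong₂ _+_ (∑-sel-fst k xs _) (∑-sel-fst (suc k) xs F)) (sym (∑-subs-∷ k x xs F)))

  length-sel : ∀ k (xs : List A) → length (sel k xs) ≡ length xs C k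
  length-sel k xs = +-injective (begin
    + length (sel k xs) ≡⟨ cong +_ (sym (ℕₚ.*-identityʳ _)) ⟩
    + (length (sel k xs) ℕ.* 1) ≡⟨ sym (∑-const (sel k xs) 1) ⟩
    ∑[ sel k xs ] (λ _ → + 1) ≡⟨ ∑-sel-fst k xs (λ _ → + 1) ⟩
    ∑[ subs k xs ] (λ _ → + 1) ≡⟨ ∑-const (subs k xs) 1 ⟩
    + (length (subs k xs) ℕ.* 1) ≡⟨ cong +_ (trans (ℕₚ.*-identityʳ _) (length-subs k xs)) ⟩
    + (length xs C k) ∎)
    where open ≡-Reasoning

  sel-⊆ : ∀ k (xs : List A) {T R} → (T , R) ∈ sel k xs → (T ⊆ xs) × (R ⊆ xs)
  sel-⊆ zero xs (here refl) = minimum xs , ⊆-refl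
  sel-⊆ (suc k) (x ∷ xs) p with ∈-++⁻ (map (λ (t , r) → x ∷ t , r) (sel k xs)) p
  ... | inj₁ q with ∈-map⁻ _ q
  ...   | (T , R) , r , refl = let a , b = sel-⊆ k xs r in refl ∷ a , x ∷ʳ b
  sel-⊆ (suc k) (x ∷ xs) p | inj₂ q with ∈-map⁻ _ q
  ...   | (T , R) , r , refl = let a , b = sel-⊆ (suc k) xs r in x ∷ʳ a , refl ∷ b

  -- Positive semidefiniteness tested on vectors of multiplicities: below, the list is that of all
  -- sublists of a given size, and the double sum is the quadratic form at the vector counting them.
  PSD : (X → X → ℤ) → Set
  PSD κ = ∀ xs → 0ℤ ≤ ∑[ xs ] (λ x → ∑[ xs ] (κ x))

  ∣∑∣≤ : ∀ (xs : List A) (f : A → ℤ) M → (∀ x → ∣ f x ∣ ℕ.≤ M) → ∣ ∑[ xs ] f ∣ ℕ.≤ M ℕ.* length xs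
  ∣∑∣≤ [] f M h = z≤n
  ∣∑∣≤ (x ∷ xs) f M h = ℕₚ.≤-trans (∣i+j∣≤∣i∣+∣j∣ (f x) _) (ℕₚ.≤-trans (ℕₚ.+-mono-≤ (h x) (∣∑∣≤ xs f M h)) (ℕₚ.≤-reflexive (sym (ℕₚ.*-suc M (length xs)))))

  length-subs-∷ : ∀ r (y : A) R → length (subs (suc r) (y ∷ R)) ≡ length (subs r R) ℕ.+ length (subs (suc r) R)
  length-subs-∷ r y R = trans (length-subs (suc r) (y ∷ R)) (trans (C-suc (length R) r) (sym (cong₂ ℕ._+_ (length-subs r R) (length-subs (suc r) R))))

  -- The difference of the sums is at most M times the number of sublists of R not coming from R′.
  -- The subtraction is moved to the other side so that the two recursive bounds add up.
  subs-diff : ∀ r {R R′ : List A} → R′ ⊆ R → ∀ (f : List A → ℤ) M → (∀ U → ∣ f U ∣ ℕ.≤ M) →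
    ∣ ∑[ subs r R ] f - ∑[ subs r R′ ] f ∣ ℕ.+ M ℕ.* length (subs r R′) ℕ.≤ M ℕ.* length (subs r R)
  subs-diff zero s f M h rewrite +-inverseʳ (f [] + 0ℤ) = ℕₚ.≤-refl
  subs-diff (suc r) [] f M h = ℕₚ.≤-refl
  subs-diff (suc r) {_ ∷ R} {R′} (y ∷ʳ s) f M h = begin
    ∣ ∑[ subs (suc r) (y ∷ R) ] f - b ∣ ℕ.+ M ℕ.* length (subs (suc r) R′)
      ≡⟨ cong (λ z → ∣ z ∣ ℕ.+ M ℕ.* length (subs (suc r) R′)) (trans (cong (_- b) (∑-subs-∷ r y R f)) (+-assoc a _ (- b))) ⟩
    ∣ a + (c - b) ∣ ℕ.+ M ℕ.* length (subs (suc r) R′) ≤⟨ ℕₚ.+-monoˡ-≤ _ (∣i+j∣≤∣i∣+∣j∣ a (c - b)) ⟩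
    (∣ a ∣ ℕ.+ ∣ c - b ∣) ℕ.+ M ℕ.* length (subs (suc r) R′) ≡⟨ ℕₚ.+-assoc ∣ a ∣ _ _ ⟩
    ∣ a ∣ ℕ.+ (∣ c - b ∣ ℕ.+ M ℕ.* length (subs (suc r) R′)) ≤⟨ ℕₚ.+-mono-≤ (∣∑∣≤ (subs r R) (f ∘ (y ∷_)) M (λ U → h (y ∷ U))) (subs-diff (suc r) s f M h) ⟩
    M ℕ.* length (subs r R) ℕ.+ M ℕ.* length (subs (suc r) R) ≡⟨ sym (ℕₚ.*-distribˡ-+ M _ _) ⟩
    M ℕ.* (length (subs r R) ℕ.+ length (subs (suc r) R)) ≡⟨ cong (M ℕ.*_) (sym (length-subs-∷ r y R)) ⟩
    M ℕ.* length (subs (suc r) (y ∷ R)) ∎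
    where
    open ℕₚ.≤-Reasoning
    a = ∑[ subs r R ] (f ∘ (y ∷_))
    b = ∑[ subs (suc r) R′ ] f
    c = ∑[ subs (suc r) R ] f
  subs-diff (suc r) {x ∷ R} {_ ∷ R′} (refl ∷ s) f M h = begin
    ∣ ∑[ subs (suc r) (x ∷ R) ] f - ∑[ subs (suc r) (x ∷ R′) ] f ∣ ℕ.+ M ℕ.* length (subs (suc r) (x ∷ R′))
      ≡⟨ cong₂ (λ z l → ∣ z ∣ ℕ.+ M ℕ.* l) (trans (cong₂ _-_ (∑-subs-∷ r x R f) (∑-subs-∷ r x R′ f)) (regroup a c a′ c′)) (length-subs-∷ r x R′) ⟩
    ∣ (a - a′) + (c - c′) ∣ ℕ.+ M ℕ.* (l₁ ℕ.+ l₂) ≤⟨ ℕₚ.+-mono-≤ (∣i+j∣≤∣i∣+∣j∣ (a - a′) (c - c′)) (ℕₚ.≤-reflexive (ℕₚ.*-distribˡ-+ M l₁ l₂)) ⟩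
    (∣ a - a′ ∣ ℕ.+ ∣ c - c′ ∣) ℕ.+ (M ℕ.* l₁ ℕ.+ M ℕ.* l₂) ≡⟨ interchangeℕ ∣ a - a′ ∣ ∣ c - c′ ∣ (M ℕ.* l₁) (M ℕ.* l₂) ⟩
    (∣ a - a′ ∣ ℕ.+ M ℕ.* l₁) ℕ.+ (∣ c - c′ ∣ ℕ.+ M ℕ.* l₂)
      ≤⟨ ℕₚ.+-mono-≤ (subs-diff r s (f ∘ (x ∷_)) M (λ U → h (x ∷ U))) (subs-diff (suc r) s f M h) ⟩
    M ℕ.* length (subs r R) ℕ.+ M ℕ.* length (subs (suc r) R) ≡⟨ sym (ℕₚ.*-distribˡ-+ M _ _) ⟩
    M ℕ.* (length (subs r R) ℕ.+ length (subs (suc r) R)) ≡⟨ cong (M ℕ.*_) (sym (length-subs-∷ r x R)) ⟩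
    M ℕ.* length (subs (suc r) (x ∷ R)) ∎
    where
    open ℕₚ.≤-Reasoning
    a = ∑[ subs r R ] (f ∘ (x ∷_))
    a′ = ∑[ subs r R′ ] (f ∘ (x ∷_))
    c = ∑[ subs (suc r) R ] f
    c′ = ∑[ subs (suc r) R′ ] f
    l₁ = length (subs r R′)
    l₂ = length (subs (suc r) R′)
    regroup : ∀ a c a′ c′ → (a + c) - (a′ + c′) ≡ (a - a′) + (c - c′)
    regroup a c a′ c′ = trans (cong (_+_ (a + c)) (neg-distrib-+ a′ c′)) (Sums.interchange +-0-isCommutativeMonoid a c (- a′) (- c′))
    interchangeℕ : ∀ a b c d → (a ℕ.+ b) ℕ.+ (c ℕ.+ d) ≡ (a ℕ.+ c) ℕ.+ (b ℕ.+ d)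
    interchangeℕ = ℕ-Ring.solve-∀

  -- The left side counts the sublists of size r + 1 that meet a fixed set of r + 1 points: there
  -- are r + 1 choices for a common point and at most C(n, r) for the rest.
  C-loss : ∀ n r → n C suc r ℕ.∸ (n ℕ.∸ suc r) C suc r ℕ.≤ suc r ℕ.* (n C r)
  C-loss n r with suc r ℕₚ.≤? n
  ... | no gt rewrite k>n⇒nCk≡0 (ℕₚ.≰⇒> gt) | ℕₚ.0∸n≡0 ((n ℕ.∸ suc r) C suc r) = z≤n
  ... | yes le = ℕₚ.m≤n+o⇒m∸n≤o (n C suc r) ((n ℕ.∸ suc r) C suc r) (subst (λ z → z C suc r ℕ.≤ (n ℕ.∸ suc r) C suc r ℕ.+ suc r ℕ.* (z C r)) (ℕₚ.m∸n+n≡m le) (C-shift (n ℕ.∸ suc r) (suc r) r))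

  pairSum : ℕ → (List A → List A → ℤ) → List A → ℤ
  pairSum r κ V = ∑[ sel r V ] (λ (U , U′) → κ U U′)

  i≤+∣i∣ : ∀ i → i ≤ + ∣ i ∣
  i≤+∣i∣ (+ n) = ≤-refl
  i≤+∣i∣ ℤ.-[1+ n ] = ℤ.-≤+

  -- Pairs of overlapping sublists are a lower order term in Σ_{U,U′} κ U U′ ≥ 0.
  pairSum-bound : ∀ r (κ : List A → List A → ℤ) M → PSD κ → (∀ U U′ → ∣ κ U U′ ∣ ℕ.≤ M) → ∀ R → let n = length R in
    0ℤ ≤ ∑[ subs (suc r ℕ.+ suc r) R ] (pairSum (suc r) κ) + + (n ℕ.^ suc r ℕ.* (M ℕ.* (suc r ℕ.* n ℕ.^ r)))
  pairSum-bound r κ M psd h R = begin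
    0ℤ ≤⟨ psd (subs (suc r) R) ⟩
    ∑[ subs (suc r) R ] (λ U → ∑[ subs (suc r) R ] (κ U)) ≡⟨ sym (∑-sel-fst (suc r) R _) ⟩
    ∑[ sel (suc r) R ] (λ (U , _) → ∑[ subs (suc r) R ] (κ U)) ≤⟨ ∑-mono∈ (sel (suc r) R) termwise ⟩
    ∑[ sel (suc r) R ] (λ (U , R′) → ∑[ subs (suc r) R′ ] (κ U) + + (M ℕ.* D)) ≡⟨ ∑-+ (sel (suc r) R) _ _ ⟩
    ∑[ sel (suc r) R ] (λ (U , R′) → ∑[ subs (suc r) R′ ] (κ U)) + ∑[ sel (suc r) R ] (λ _ → + (M ℕ.* D))
      ≡⟨ cong₂ _+_ (∑-sel-subs (suc r) (suc r) R κ) (trans (∑-const (sel (suc r) R) (M ℕ.* D)) (cong (λ l → + (l ℕ.* (M ℕ.* D))) (length-sel (suc r) R))) ⟩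
    ∑[ subs (suc r ℕ.+ suc r) R ] (pairSum (suc r) κ) + + ((n C suc r) ℕ.* (M ℕ.* D))
      ≤⟨ +-monoʳ-≤ (∑[ subs (suc r ℕ.+ suc r) R ] (pairSum (suc r) κ)) (+≤+ (ℕₚ.*-mono-≤ (C≤^ n (suc r)) (ℕₚ.*-monoʳ-≤ M (ℕₚ.≤-trans (C-loss n r) (ℕₚ.*-monoʳ-≤ (suc r) (C≤^ n r)))))) ⟩
    ∑[ subs (suc r ℕ.+ suc r) R ] (pairSum (suc r) κ) + + (n ℕ.^ suc r ℕ.* (M ℕ.* (suc r ℕ.* n ℕ.^ r))) ∎
    where
    open ≤-Reasoning
    n = length R
    D = (n C suc r) ℕ.∸ ((n ℕ.∸ suc r) C suc r)
    termwise : ∀ p → p ∈ sel (suc r) R → ∑[ subs (suc r) R ] (κ (proj₁ p)) ≤ ∑[ subs (suc r) (proj₂ p) ] (κ (proj₁ p)) + + (M ℕ.* D)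
    termwise (U , R′) p∈ = begin
      a ≡⟨ sym (trans (+-comm b (a - b)) (trans (+-assoc a (- b) b) (trans (cong (_+_ a) (+-inverseˡ b)) (+-identityʳ a)))) ⟩
      b + (a - b) ≤⟨ +-monoʳ-≤ b (≤-trans (i≤+∣i∣ (a - b)) (+≤+ diff)) ⟩
      b + + (M ℕ.* D) ∎
      where
      a = ∑[ subs (suc r) R ] (κ U)
      b = ∑[ subs (suc r) R′ ] (κ U)
      diff : ∣ a - b ∣ ℕ.≤ M ℕ.* D
      diff = ℕₚ.≤-trans (ℕₚ.m+n≤o⇒m≤o∸n _ (subs-diff (suc r) (proj₂ (sel-⊆ (suc r) R p∈)) (κ U) M (h U)))
        (ℕₚ.≤-reflexive (trans (cong₂ (λ x y → M ℕ.* x ℕ.∸ M ℕ.* y) (length-subs (suc r) R) (trans (length-subs (suc r) R′) (cong (_C suc r) (sel-length (suc r) R p∈))))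
          (sym (ℕₚ.*-distribˡ-∸ M (n C suc r) _))))

  flagSum : ℕ → ℕ → (List A → List A → List A → ℤ) → List A → ℤ
  flagSum t r κ S = ∑[ sel t S ] (λ (T , V) → pairSum r (κ T) V)

  -- `pairSum-bound` is applied in the complement of each T, and `∑-sel-subs` collects the result
  -- into a sum over unions. The exponents of n in the error add up to one less than the number of
  -- points of a pattern.
  flagSum-bound : ∀ t r (κ : List A → List A → List A → ℤ) M → (∀ T → PSD (κ T)) → (∀ T U U′ → ∣ κ T U U′ ∣ ℕ.≤ M) → ∀ P → let n = length P in
    0ℤ ≤ ∑[ subs (t ℕ.+ (suc r ℕ.+ suc r)) P ] (flagSum t (suc r) κ) + + (n ℕ.^ t ℕ.* (n ℕ.^ suc r ℕ.* (M ℕ.* (suc r ℕ.* n ℕ.^ r))))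
  flagSum-bound t r κ M psd h P = begin
    0ℤ ≡⟨ sym (∑-0 (sel t P)) ⟩
    ∑[ sel t P ] (λ _ → 0ℤ) ≤⟨ ∑-mono∈ (sel t P) bound ⟩
    ∑[ sel t P ] (λ (T , R) → ∑[ subs (suc r ℕ.+ suc r) R ] (pairSum (suc r) (κ T)) + + E) ≡⟨ ∑-+ (sel t P) _ _ ⟩
    ∑[ sel t P ] (λ (T , R) → ∑[ subs (suc r ℕ.+ suc r) R ] (pairSum (suc r) (κ T))) + ∑[ sel t P ] (λ _ → + E)
      ≡⟨ cong₂ _+_ (∑-sel-subs t (suc r ℕ.+ suc r) P (λ T → pairSum (suc r) (κ T))) (trans (∑-const (sel t P) E) (cong (λ l → + (l ℕ.* E)) (length-sel t P))) ⟩
    ∑[ subs (t ℕ.+ (suc r ℕ.+ suc r)) P ] (flagSum t (suc r) κ) + + ((n C t) ℕ.* E)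
      ≤⟨ +-monoʳ-≤ (∑[ subs (t ℕ.+ (suc r ℕ.+ suc r)) P ] (flagSum t (suc r) κ)) (+≤+ (ℕₚ.*-monoˡ-≤ E (C≤^ n t))) ⟩
    ∑[ subs (t ℕ.+ (suc r ℕ.+ suc r)) P ] (flagSum t (suc r) κ) + + (n ℕ.^ t ℕ.* E) ∎
    where
    open ≤-Reasoning
    n = length P
    E = n ℕ.^ suc r ℕ.* (M ℕ.* (suc r ℕ.* n ℕ.^ r))
    bound : ∀ p → p ∈ sel t P → 0ℤ ≤ ∑[ subs (suc r ℕ.+ suc r) (proj₂ p) ] (pairSum (suc r) (κ (proj₁ p))) + + E
    bound (T , R) p∈ = ≤-trans (pairSum-bound r (κ T) M (psd T) (h T) R)
      (+-monoʳ-≤ (∑[ subs (suc r ℕ.+ suc r) R ] (pairSum (suc r) (κ T))) (+≤+ (ℕₚ.*-mono-≤ (ℕₚ.^-monoˡ-≤ (suc r) l≤) (ℕₚ.*-monoʳ-≤ M (ℕₚ.*-monoʳ-≤ (suc r) (ℕₚ.^-monoˡ-≤ r l≤))))))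
      where
      l≤ : length R ℕ.≤ n
      l≤ = ℕₚ.≤-trans (ℕₚ.≤-reflexive (sel-length t P p∈)) (ℕₚ.m∸n≤m n t)

  -- Point sets and their order types.

  Point : Set
  Point = ℕ × ℕ

  abscissa ordinate : Point → ℕ
  abscissa = proj₁
  ordinate = proj₂

  points : ℕ → List ℕ → List Point
  points i [] = []
  points i (v ∷ vs) = (i , v) ∷ points (suc i) vs

  map-ordinate-points : ∀ i vs → map ordinate (points i vs) ≡ vs
  map-ordinate-points i [] = refl
  map-ordinate-points i (v ∷ vs) = cong (v ∷_) (map-ordinate-points (suc i) vs)

  length-points : ∀ i vs → length (points i vs) ≡ length vs
  length-points i vs = trans (sym (Listₚ.length-map ordinate (points i vs))) (cong length (map-ordinate-points i vs))

  _left-of_ : Point → Point → Set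
  p left-of q = abscissa p ℕ.< abscissa q

  points-≥ : ∀ i vs → All (λ p → i ℕ.≤ abscissa p) (points i vs)
  points-≥ i [] = []
  points-≥ i (v ∷ vs) = ℕₚ.≤-refl ∷ All.map (ℕₚ.≤-trans (ℕₚ.n≤1+n i)) (points-≥ (suc i) vs)

  points-sorted : ∀ i vs → AllPairs _left-of_ (points i vs)
  points-sorted i [] = []
  points-sorted i (v ∷ vs) = points-≥ (suc i) vs ∷ points-sorted (suc i) vs

  record SameOrder (φ : Point → Point) (S : List Point) : Set where
    field
      same-x : ∀ {p q} → p ∈ S → q ∈ S → (abscissa (φ p) ≤ᵇ abscissa (φ q)) ≡ (abscissa p ≤ᵇ abscissa q)
      same-y : ∀ {p q} → p ∈ S → q ∈ S → (ordinate (φ p) ≤ᵇ ordinate (φ q)) ≡ (ordinate p ≤ᵇ ordinate q)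
  open SameOrder public

  SameOrder-⊆ : ∀ {φ S S′} → S′ ⊆ S → SameOrder φ S → SameOrder φ S′
  SameOrder-⊆ s o = record { same-x = λ p q → same-x o (lookup s p) (lookup s q) ; same-y = λ p q → same-y o (lookup s p) (lookup s q) }

  ≥⇒<ᵇ-false : ∀ {a b} → b ℕ.≤ a → (a <ᵇ b) ≡ false
  ≥⇒<ᵇ-false {a} {b} b≤a with a <ᵇ b in e
  ... | false = refl
  ... | true = contradiction (ℕₚ.<ᵇ⇒< a b (subst T (sym e) _)) (ℕₚ.≤⇒≯ b≤a)

  -- The recursion drops points from the left. Abscissa ranks are recomputed for what remains,
  -- shifted by i; the map ψ is kept fixed, because the ordinate ranks refer to the whole set.
  standardise-x : ∀ i S (ψ : ℕ → ℕ) → AllPairs _left-of_ S →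
    map (λ p → i ℕ.+ rank (map abscissa S) (abscissa p) , ψ (ordinate p)) S ≡ points i (map ψ (map ordinate S))
  standardise-x i [] ψ _ = refl
  standardise-x i (p ∷ S) ψ (p< ∷ inc) = cong₂ _∷_ (cong (_, ψ (ordinate p)) (trans (cong (i ℕ.+_) rank-head) (ℕₚ.+-identityʳ i)))
    (trans (Listₚ.map-cong-local (All.map (λ {q} lt → cong (_, ψ (ordinate q)) (rank-tail q lt)) p<)) (standardise-x (suc i) S ψ inc))
    where
    rank-head : rank (abscissa p ∷ map abscissa S) (abscissa p) ≡ 0
    rank-head = cong₂ ℕ._+_ (cong ind (<ᵇ-irrefl (abscissa p))) (trans (Σ-map abscissa S _) (trans (Σ-cong∈ S (λ q q∈ → cong ind (≥⇒<ᵇ-false {abscissa q} {abscissa p} (ℕₚ.<⇒≤ (All.lookup p< q∈))))) (Σ-𝟘 S)))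
    rank-tail : ∀ q → p left-of q → i ℕ.+ rank (abscissa p ∷ map abscissa S) (abscissa q) ≡ suc i ℕ.+ rank (map abscissa S) (abscissa q)
    rank-tail q lt = trans (cong (λ b → i ℕ.+ (ind b ℕ.+ rank (map abscissa S) (abscissa q))) (<ᵇ-true lt)) (ℕₚ.+-suc i _)

  pattern-of : List Point → List ℕ
  pattern-of S = map (rank (map ordinate S)) (map ordinate S)

  standardise : ∀ S → AllPairs _left-of_ S → ∃[ φ ] (SameOrder φ S × map φ S ≡ points 0 (pattern-of S))
  standardise S inc = φ , record { same-x = λ p q → rank-iso (map abscissa S) (∈-map⁺ abscissa p) (∈-map⁺ abscissa q)
                                 ; same-y = λ p q → rank-iso (map ordinate S) (∈-map⁺ ordinate p) (∈-map⁺ ordinate q) }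
    , standardise-x 0 S (rank (map ordinate S)) inc
    where
    φ : Point → Point
    φ p = rank (map abscissa S) (abscissa p) , rank (map ordinate S) (ordinate p)

  Natural : (List Point → A) → Set
  Natural F = ∀ φ S → SameOrder φ S → F (map φ S) ≡ F S

  -- Reduces an assertion about all sets of N points to the finitely many permutations of N
  -- elements.
  natural-pattern : ∀ (F : List Point → A) → Natural F → ∀ S → AllPairs _left-of_ S → F S ≡ F (points 0 (pattern-of S))
  natural-pattern F nat S inc = let φ , o , e = standardise S inc in trans (sym (nat φ S o)) (cong F e)

  pattern-∈ : ∀ S {N} → length S ≡ N → Unique (map ordinate S) → pattern-of S ∈ perms (upTo N)
  pattern-∈ S refl u = subst (λ l → pattern-of S ∈ perms (upTo l)) (Listₚ.length-map ordinate S) (↭-perms _ (ranks-↭ (map ordinate S) u))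

  m-pattern : ∀ k S → m k (pattern-of S) ≡ m k (map ordinate S)
  m-pattern k S = m-iso (rank (map ordinate S)) k (map ordinate S) (rank-iso (map ordinate S))

  Unique-sub : ∀ i π {S} → Unique π → S ⊆ points i π → Unique (map ordinate S)
  Unique-sub i π u s = AllPairsₚ.map⁺ (AllPairs-resp-⊆ s (AllPairsₚ.map⁻ (subst Unique (sym (map-ordinate-points i π)) u)))

  sel-map : ∀ (φ : A → B) k xs → sel k (map φ xs) ≡ map (λ (T , R) → map φ T , map φ R) (sel k xs)
  sel-map φ zero xs = refl
  sel-map φ (suc k) [] = refl
  sel-map φ (suc k) (x ∷ xs) = trans (cong₂ _++_ left right) (sym (Listₚ.map-++ _ (map (λ (t , r) → x ∷ t , r) (sel k xs)) _))
    where
    left : map (λ (t , r) → φ x ∷ t , r) (sel k (map φ xs)) ≡ map (λ (T , R) → map φ T , map φ R) (map (λ (t , r) → x ∷ t , r) (sel k xs))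
    left = trans (cong (map _) (sel-map φ k xs)) (trans (sym (Listₚ.map-∘ (sel k xs))) (Listₚ.map-∘ (sel k xs)))
    right : map (λ (t , r) → t , φ x ∷ r) (sel (suc k) (map φ xs)) ≡ map (λ (T , R) → map φ T , map φ R) (map (λ (t , r) → t , x ∷ r) (sel (suc k) xs))
    right = trans (cong (map _) (sel-map φ (suc k) xs)) (trans (sym (Listₚ.map-∘ (sel (suc k) xs))) (Listₚ.map-∘ (sel (suc k) xs)))

  Kernel : Set
  Kernel = List Point → List Point → List Point → ℤ

  NaturalKernel : Kernel → Set
  NaturalKernel κ = ∀ φ S → SameOrder φ S → ∀ {T U U′} → T ⊆ S → U ⊆ S → U′ ⊆ S → κ (map φ T) (map φ U) (map φ U′) ≡ κ T U U′

  flagSum-natural : ∀ t r κ → NaturalKernel κ → Natural (flagSum t r κ)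
  flagSum-natural t r κ nat φ S o = begin
    ∑[ sel t (map φ S) ] (λ (T , V) → pairSum r (κ T) V) ≡⟨ cong (λ l → ∑[ l ] (λ (T , V) → pairSum r (κ T) V)) (sel-map φ t S) ⟩
    ∑[ map (λ (T , R) → map φ T , map φ R) (sel t S) ] (λ (T , V) → pairSum r (κ T) V) ≡⟨ ∑-map _ (sel t S) _ ⟩
    ∑[ sel t S ] (λ (T , V) → pairSum r (κ (map φ T)) (map φ V)) ≡⟨ ∑-cong∈ (sel t S) inner ⟩
    ∑[ sel t S ] (λ (T , V) → pairSum r (κ T) V) ∎
    where
    open ≡-Reasoning
    inner : ∀ p → p ∈ sel t S → pairSum r (κ (map φ (proj₁ p))) (map φ (proj₂ p)) ≡ pairSum r (κ (proj₁ p)) (proj₂ p)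
    inner (T , V) p∈ = let T⊆ , V⊆ = sel-⊆ t S p∈ in
      trans (cong (λ l → ∑[ l ] (λ (U , U′) → κ (map φ T) U U′)) (sel-map φ r V))
        (trans (∑-map _ (sel r V) _) (∑-cong∈ (sel r V) (λ (U , U′) q∈ → let U⊆ , U′⊆ = sel-⊆ r V q∈ in nat φ S o T⊆ (⊆-trans U⊆ V⊆) (⊆-trans U′⊆ V⊆))))

  -- Averaging a local inequality over all sublists.

  ∑-subs-of-subs : ∀ j b (P : List A) (F : List A → ℤ) →
    ∑[ subs (j ℕ.+ b) P ] (λ S → ∑[ subs j S ] F) ≡ + ((length P ℕ.∸ j) C b) * ∑[ subs j P ] F
  ∑-subs-of-subs j b P F = begin
    ∑[ subs (j ℕ.+ b) P ] (λ S → ∑[ subs j S ] F) ≡⟨ ∑-cong (subs (j ℕ.+ b) P) (λ S → sym (∑-sel-fst j S F)) ⟩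
    ∑[ subs (j ℕ.+ b) P ] (λ S → ∑[ sel j S ] (λ (T , U) → F T)) ≡⟨ sym (∑-sel-subs j b P (λ T _ → F T)) ⟩
    ∑[ sel j P ] (λ (T , R) → ∑[ subs b R ] (λ _ → F T)) ≡⟨ ∑-cong∈ (sel j P) const ⟩
    ∑[ sel j P ] (λ (T , R) → + ((length P ℕ.∸ j) C b) * F T) ≡⟨ ∑-*ˡ (+ ((length P ℕ.∸ j) C b)) (sel j P) (λ (T , _) → F T) ⟩
    + ((length P ℕ.∸ j) C b) * ∑[ sel j P ] (λ (T , R) → F T) ≡⟨ cong (+ ((length P ℕ.∸ j) C b) *_) (∑-sel-fst j P F) ⟩
    + ((length P ℕ.∸ j) C b) * ∑[ subs j P ] F ∎
    where
    open ≡-Reasoning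
    const : ∀ p → p ∈ sel j P → ∑[ subs b (proj₂ p) ] (λ _ → F (proj₁ p)) ≡ + ((length P ℕ.∸ j) C b) * F (proj₁ p)
    const (T , R) p∈ = begin
      ∑[ subs b R ] (λ _ → F T) ≡⟨ ∑-cong (subs b R) (λ _ → sym (*-identityˡ (F T))) ⟩
      ∑[ subs b R ] (λ _ → + 1 * F T) ≡⟨ ∑-*ʳ (F T) (subs b R) (λ _ → + 1) ⟩
      ∑[ subs b R ] (λ _ → + 1) * F T ≡⟨ cong (_* F T) (trans (∑-const (subs b R) 1) (cong +_ (trans (ℕₚ.*-identityʳ _) (trans (length-subs b R) (cong (_C b) (sel-length j P p∈)))))) ⟩
      + ((length P ℕ.∸ j) C b) * F T ∎

  -- The local inequality is summed over all (k + b)-sublists. Each k-subword lies in c of them,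
  -- which turns the binomial and the monotone counts into c times those of π, while the sum of F is
  -- at least -E.
  certificate : ∀ k b R D (F : List Point → ℤ) (E : ℕ → ℕ) →
    (∀ P → 0ℤ ≤ ∑[ subs (k ℕ.+ b) P ] F + + E (length P)) →
    (∀ S → length S ≡ k ℕ.+ b → AllPairs _left-of_ S → Unique (map ordinate S) →
       F S + + (D ℕ.* ((k ℕ.+ b) C k)) ≤ + (D ℕ.* (R ℕ.* m k (map ordinate S)))) →
    ∀ π → Unique π → let n = length π ; c = (n ℕ.∸ k) C b in
    c ℕ.* (D ℕ.* (n C k)) ℕ.≤ c ℕ.* (D ℕ.* (R ℕ.* m k π)) ℕ.+ E n
  certificate k b R D F E bound local π u = drop‿+≤+ (begin
    + (c ℕ.* (D ℕ.* (n C k))) ≡⟨ cong +_ (trans (swap* c D (n C k)) (cong (D ℕ.*_) (trans (cong₂ ℕ._*_ (sym c≡) (sym Σ1)) (sym (subs-of-subs k b P (λ _ → 1)))))) ⟩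
    + (D ℕ.* Σ[ subs N P ] (λ S → Σ[ subs k S ] (λ _ → 1))) ≡⟨ cong +_ (trans (sym (Σ-*ˡ D (subs N P) _)) (Σ-cong∈ (subs N P) inner)) ⟩
    + Σ[ subs N P ] (λ S → D ℕ.* (N C k)) ≡⟨ sym (∑-pos (subs N P) _) ⟩
    base ≤⟨ i≤i+0≤ base _ (bound P) ⟩
    base + (∑[ subs N P ] F + + E (length P)) ≡⟨ trans (sym (+-assoc base (∑[ subs N P ] F) (+ E (length P)))) (cong₂ _+_ (trans (+-comm base (∑[ subs N P ] F)) (sym (∑-+ (subs N P) F _))) (cong (+_ ∘ E) (length-points 0 π))) ⟩
    ∑[ subs N P ] (λ S → F S + + (D ℕ.* (N C k))) + + E n ≤⟨ +-monoˡ-≤ (+ E n) (∑-mono∈ (subs N P) pointwise) ⟩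
    ∑[ subs N P ] (λ S → + (D ℕ.* (R ℕ.* m k (map ordinate S)))) + + E n ≡⟨ cong (_+ + E n) (trans (∑-pos (subs N P) _) (cong +_ total)) ⟩
    + (c ℕ.* (D ℕ.* (R ℕ.* m k π)) ℕ.+ E n) ∎)
    where
    open ≤-Reasoning
    n = length π
    c = (n ℕ.∸ k) C b
    N = k ℕ.+ b
    P = points 0 π
    base = ∑[ subs N P ] (λ S → + (D ℕ.* (N C k)))
    swap* : ∀ a b c → a ℕ.* (b ℕ.* c) ≡ b ℕ.* (a ℕ.* c)
    swap* = ℕ-Ring.solve-∀
    i≤i+0≤ : ∀ i j → 0ℤ ≤ j → i ≤ i + j
    i≤i+0≤ i j h = subst (_≤ i + j) (+-identityʳ i) (+-monoʳ-≤ i h)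
    c≡ : (length P ℕ.∸ k) C b ≡ c
    c≡ = cong (λ l → (l ℕ.∸ k) C b) (length-points 0 π)
    Σ1 : Σ[ subs k P ] (λ _ → 1) ≡ n C k
    Σ1 = trans (Σ-const (subs k P) 1) (trans (ℕₚ.*-identityʳ _) (trans (length-subs k P) (cong (_C k) (length-points 0 π))))
    inner : ∀ S → S ∈ subs N P → D ℕ.* Σ[ subs k S ] (λ _ → 1) ≡ D ℕ.* (N C k)
    inner S S∈ = cong (D ℕ.*_) (trans (Σ-const (subs k S) 1) (trans (ℕₚ.*-identityʳ _) (trans (length-subs k S) (cong (_C k) (subs-length N P S∈)))))
    pointwise : ∀ S → S ∈ subs N P → F S + + (D ℕ.* (N C k)) ≤ + (D ℕ.* (R ℕ.* m k (map ordinate S)))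
    pointwise S S∈ = local S (subs-length N P S∈) (AllPairs-resp-⊆ (subs-⊆ N P S∈) (points-sorted 0 π)) (Unique-sub 0 π u (subs-⊆ N P S∈))
    total : Σ[ subs N P ] (λ S → D ℕ.* (R ℕ.* m k (map ordinate S))) ≡ c ℕ.* (D ℕ.* (R ℕ.* m k π))
    total = beginℕ
      where
      mono# : List Point → ℕ
      mono# U = ind (monotone (map ordinate U))
      m≡ : ∀ S → m k (map ordinate S) ≡ Σ[ subs k S ] mono#
      m≡ S = trans (m-Σ k (map ordinate S)) (Σ-subs-map ordinate k S _)
      ring : ∀ D R c x → D ℕ.* (R ℕ.* (c ℕ.* x)) ≡ c ℕ.* (D ℕ.* (R ℕ.* x))
      ring = ℕ-Ring.solve-∀
      beginℕ : Σ[ subs N P ] (λ S → D ℕ.* (R ℕ.* m k (map ordinate S))) ≡ c ℕ.* (D ℕ.* (R ℕ.* m k π))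
      beginℕ = trans (Σ-*ˡ D (subs N P) _) (trans (cong (D ℕ.*_) (trans (Σ-*ˡ R (subs N P) _) (cong (R ℕ.*_)
        (trans (Σ-cong (subs N P) m≡) (trans (subs-of-subs k b P mono#) (cong₂ ℕ._*_ c≡ (trans (sym (m≡ P)) (cong (m k) (map-ordinate-points 0 π)))))))))
        (ring D R c (m k π)))

  -- Weighted sums of squares as kernels.

  dot : List ℕ → List ℤ → List ℤ → ℤ
  dot []       _        _        = 0ℤ
  dot (w ∷ ws) []       _        = 0ℤ
  dot (w ∷ ws) (x ∷ xs) []       = 0ℤ
  dot (w ∷ ws) (x ∷ xs) (y ∷ ys) = + w * (x * y) + dot ws xs ys

  head₀ : List ℤ → ℤ
  head₀ []      = 0ℤ
  head₀ (x ∷ _) = x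

  tail₀ : List ℤ → List ℤ
  tail₀ []       = []
  tail₀ (_ ∷ xs) = xs

  dot-[]ˡ : ∀ ws ys → dot ws [] ys ≡ 0ℤ
  dot-[]ˡ [] ys = refl
  dot-[]ˡ (w ∷ ws) ys = refl

  dot-[]ʳ : ∀ ws xs → dot ws xs [] ≡ 0ℤ
  dot-[]ʳ [] xs = refl
  dot-[]ʳ (w ∷ ws) [] = refl
  dot-[]ʳ (w ∷ ws) (x ∷ xs) = refl

  dot-∷ : ∀ w ws xs ys → dot (w ∷ ws) xs ys ≡ + w * (head₀ xs * head₀ ys) + dot ws (tail₀ xs) (tail₀ ys)
  dot-∷ w ws [] ys = sym (cong₂ _+_ (*-zeroʳ (+ w)) (dot-[]ˡ ws (tail₀ ys)))
  dot-∷ w ws (x ∷ xs) [] = sym (cong₂ _+_ (trans (cong (+ w *_) (*-zeroʳ x)) (*-zeroʳ (+ w))) (dot-[]ʳ ws xs))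
  dot-∷ w ws (x ∷ xs) (y ∷ ys) = refl

  square≥0 : ∀ i → 0ℤ ≤ i * i
  square≥0 (+ n) = subst (0ℤ ≤_) (pos-* n n) (+≤+ z≤n)
  square≥0 ℤ.-[1+ n ] = +≤+ z≤n

  -- Each weight contributes w s², where s is the sum of one coordinate over the list. Through
  -- `head₀` and `tail₀` missing coordinates count as 0, so the vectors may have any lengths.
  dot-PSD : ∀ ws (f : X → List ℤ) → PSD (λ x y → dot ws (f x) (f y))
  dot-PSD [] f xs = ≤-reflexive (sym (trans (∑-cong xs (λ _ → ∑-0 xs)) (∑-0 xs)))
  dot-PSD (w ∷ ws) f xs = subst (0ℤ ≤_) (sym expand) (+-mono-≤ first (dot-PSD ws (tail₀ ∘ f) xs))
    where
    h = head₀ ∘ f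
    s = ∑[ xs ] h
    first : 0ℤ ≤ + w * (s * s)
    first = subst (_≤ + w * (s * s)) (*-zeroʳ (+ w)) (*-monoˡ-≤-nonNeg (+ w) (square≥0 s))
    expand : ∑[ xs ] (λ x → ∑[ xs ] (λ y → dot (w ∷ ws) (f x) (f y))) ≡ + w * (s * s) + ∑[ xs ] (λ x → ∑[ xs ] (λ y → dot ws (tail₀ (f x)) (tail₀ (f y))))
    expand = begin
      ∑[ xs ] (λ x → ∑[ xs ] (λ y → dot (w ∷ ws) (f x) (f y)))
        ≡⟨ ∑-cong xs (λ x → trans (∑-cong xs (λ y → dot-∷ w ws (f x) (f y))) (∑-+ xs _ _)) ⟩
      ∑[ xs ] (λ x → ∑[ xs ] (λ y → + w * (h x * h y)) + ∑[ xs ] (λ y → dot ws (tail₀ (f x)) (tail₀ (f y)))) ≡⟨ ∑-+ xs _ _ ⟩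
      ∑[ xs ] (λ x → ∑[ xs ] (λ y → + w * (h x * h y))) + rest ≡⟨ cong (_+ rest) (∑-cong xs (λ x → trans (∑-*ˡ (+ w) xs _) (cong (+ w *_) (∑-*ˡ (h x) xs h)))) ⟩
      ∑[ xs ] (λ x → + w * (h x * s)) + rest ≡⟨ cong (_+ rest) (trans (∑-*ˡ (+ w) xs _) (cong (+ w *_) (∑-*ʳ s xs h))) ⟩
      + w * (s * s) + rest ∎
      where
      open ≡-Reasoning
      rest = ∑[ xs ] (λ x → ∑[ xs ] (λ y → dot ws (tail₀ (f x)) (tail₀ (f y))))

  ∥_∥ : List ℤ → ℕ
  ∥ xs ∥ = Σ[ xs ] ∣_∣

  ∣dot∣≤ : ∀ ws xs ys → ∣ dot ws xs ys ∣ ℕ.≤ Σ[ ws ] (λ w → w) ℕ.* (∥ xs ∥ ℕ.* ∥ ys ∥)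
  ∣dot∣≤ [] xs ys = z≤n
  ∣dot∣≤ (w ∷ ws) [] ys = z≤n
  ∣dot∣≤ (w ∷ ws) (x ∷ xs) [] = z≤n
  ∣dot∣≤ (w ∷ ws) (x ∷ xs) (y ∷ ys) = begin
    ∣ + w * (x * y) + dot ws xs ys ∣ ≤⟨ ∣i+j∣≤∣i∣+∣j∣ (+ w * (x * y)) _ ⟩
    ∣ + w * (x * y) ∣ ℕ.+ ∣ dot ws xs ys ∣ ≡⟨ cong (ℕ._+ ∣ dot ws xs ys ∣) (trans (abs-* (+ w) (x * y)) (cong (w ℕ.*_) (abs-* x y))) ⟩
    w ℕ.* (∣ x ∣ ℕ.* ∣ y ∣) ℕ.+ ∣ dot ws xs ys ∣ ≤⟨ ℕₚ.+-mono-≤ (ℕₚ.*-monoʳ-≤ w le) (ℕₚ.≤-trans (∣dot∣≤ ws xs ys) (ℕₚ.*-monoʳ-≤ (Σ[ ws ] (λ w → w)) (ℕₚ.*-mono-≤ (ℕₚ.m≤n+m ∥ xs ∥ ∣ x ∣) (ℕₚ.m≤n+m ∥ ys ∥ ∣ y ∣)))) ⟩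
    w ℕ.* b ℕ.+ Σ[ ws ] (λ w → w) ℕ.* b ≡⟨ sym (ℕₚ.*-distribʳ-+ b w _) ⟩
    (w ℕ.+ Σ[ ws ] (λ w → w)) ℕ.* b ∎
    where
    open ℕₚ.≤-Reasoning
    b = (∣ x ∣ ℕ.+ ∥ xs ∥) ℕ.* (∣ y ∣ ℕ.+ ∥ ys ∥)
    le : ∣ x ∣ ℕ.* ∣ y ∣ ℕ.≤ b
    le = ℕₚ.*-mono-≤ (ℕₚ.m≤m+n ∣ x ∣ ∥ xs ∥) (ℕₚ.m≤m+n ∣ y ∣ ∥ ys ∥)

  at : A → List A → ℕ → A
  at d []       _       = d
  at d (x ∷ xs) zero    = x
  at d (x ∷ xs) (suc i) = at d xs i

  at-bound : ∀ (f : A → ℕ) d xs i → f (at d xs i) ℕ.≤ f d ℕ.+ Σ[ xs ] f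
  at-bound f d [] i = ℕₚ.m≤m+n (f d) 0
  at-bound f d (x ∷ xs) zero = ℕₚ.≤-trans (ℕₚ.m≤m+n (f x) _) (ℕₚ.m≤n+m _ (f d))
  at-bound f d (x ∷ xs) (suc i) = ℕₚ.≤-trans (at-bound f d xs i) (ℕₚ.+-monoʳ-≤ (f d) (ℕₚ.m≤n+m _ (f x)))

  -- Encoding kernels and flags by natural numbers.

  signed : ℕ → ℕ → ℤ
  signed B d = if d ℕ.+ d <ᵇ B then + d else d ⊖ B

  digits : (B : ℕ) .{{_ : ℕ.NonZero B}} → ℕ → ℕ → List ℤ
  digits B zero    x = []
  digits B (suc l) x = signed B (x % B) ∷ digits B l (x / B)

  ∣signed∣≤ : ∀ B d → d ℕ.≤ B → ∣ signed B d ∣ ℕ.≤ B ℕ.+ B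
  ∣signed∣≤ B d d≤B with d ℕ.+ d <ᵇ B
  ... | true  = ℕₚ.≤-trans d≤B (ℕₚ.m≤m+n B B)
  ... | false = ℕₚ.≤-trans (∣m⊝n∣≤m⊔n d B) (ℕₚ.≤-trans (ℕₚ.m⊔n≤m+n d B) (ℕₚ.+-monoˡ-≤ B d≤B))

  digits-bound : ∀ B .{{_ : ℕ.NonZero B}} l x → ∥ digits B l x ∥ ℕ.≤ l ℕ.* (B ℕ.+ B)
  digits-bound B zero x = z≤n
  digits-bound B (suc l) x = ℕₚ.+-mono-≤ (∣signed∣≤ B (x % B) (ℕₚ.<⇒≤ (m%n<n x B))) (digits-bound B l (x / B))

  -- Vectors of integers between -50000 and 49999 are written as one natural number in base 100000, least significant
  -- digit first, a negative entry -d being the digit 100000 - d.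
  unpack : ℕ → ℕ → List ℤ
  unpack = digits 100000

  unpack-bound : ∃[ c ] (∀ l x → ∥ unpack l x ∥ ℕ.≤ l ℕ.* c)
  unpack-bound = _ , digits-bound 100000

  -- A number in [0, |T|!) determined by the order type of T.
  typeCode : List Point → ℕ
  typeCode []      = 0
  typeCode (p ∷ T) = Σ[ T ] (λ q → ind (ordinate q ≤ᵇ ordinate p)) ℕ.+ suc (length T) ℕ.* typeCode T

  -- The coordinates of the cell containing y in the grid cut out by the vertical and horizontal
  -- lines through the points of T.
  column row : List Point → Point → ℕ
  column T y = Σ[ T ] (λ q → ind (abscissa q ≤ᵇ abscissa y))
  row    T y = Σ[ T ] (λ q → ind (ordinate q ≤ᵇ ordinate y))

  typeCode-natural : Natural typeCode
  typeCode-natural φ [] o = refl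
  typeCode-natural φ (p ∷ S) o = cong₂ ℕ._+_
    (trans (Σ-map φ S _) (Σ-cong∈ S (λ q q∈ → cong ind (same-y o (there q∈) (here refl)))))
    (cong₂ ℕ._*_ (cong suc (Listₚ.length-map φ S)) (typeCode-natural φ S (record { same-x = λ a b → same-x o (there a) (there b) ; same-y = λ a b → same-y o (there a) (there b) })))

  column-natural : ∀ φ S → SameOrder φ S → ∀ {T y} → T ⊆ S → y ∈ S → column (map φ T) (φ y) ≡ column T y
  column-natural φ S o {T} T⊆ y∈ = trans (Σ-map φ T _) (Σ-cong∈ T (λ q q∈ → cong ind (same-x o (lookup T⊆ q∈) y∈)))

  row-natural : ∀ φ S → SameOrder φ S → ∀ {T y} → T ⊆ S → y ∈ S → row (map φ T) (φ y) ≡ row T y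
  row-natural φ S o {T} T⊆ y∈ = trans (Σ-map φ T _) (Σ-cong∈ T (λ q q∈ → cong ind (same-y o (lookup T⊆ q∈) y∈)))

  -- A form is a list of weights together with the packed coordinate vectors of the flags.
  Form : Set
  Form = List ℕ × List ℕ

  emptyForm : Form
  emptyForm = [] , []

  -- The code of U relative to T is the number of the row holding the vector of that flag; the index
  -- i names a coordinate system, so that one form serves several types. Naturality of kernels
  -- follows from that of the code.
  record FlagCode : Set where
    field
      code : ℕ → List Point → List Point → ℕ
      code-natural : ∀ i φ S → SameOrder φ S → ∀ {T U} → T ⊆ S → U ⊆ S → code i (map φ T) (map φ U) ≡ code i T U
  open FlagCode

  evalForm : (List Point → ℕ) → Form → List Point → List Point → ℤ
  evalForm c (ws , rows) U U′ = dot ws (vec U) (vec U′)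
    where
    vec : List Point → List ℤ
    vec U = unpack (length ws) (at 0 rows (c U))

  -- The entry 8·i + j of types at typeCode T selects the form number i, with the flags read in the coordinates number j.
  kernel : FlagCode → List ℕ → List Form → Kernel
  kernel fc types forms T U U′ = select (at 999 types (typeCode T))
    where
    select : ℕ → ℤ
    select e = evalForm (code fc (e % 8) T) (at emptyForm forms (e / 8)) U U′

  kernel-PSD : ∀ fc types forms T → PSD (kernel fc types forms T)
  kernel-PSD fc types forms T with at 999 types (typeCode T)
  ... | e with at emptyForm forms (e / 8)
  ...   | ws , rows = dot-PSD ws (λ U → unpack (length ws) (at 0 rows (code fc (e % 8) T U)))

  kernel-natural : ∀ fc types forms → NaturalKernel (kernel fc types forms)
  kernel-natural fc types forms φ S o {T} {U} {U′} T⊆ U⊆ U′⊆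
    rewrite typeCode-natural φ T (SameOrder-⊆ T⊆ o) with at 999 types (typeCode T)
  ... | e with at emptyForm forms (e / 8)
  ...   | ws , rows rewrite code-natural fc (e % 8) φ S o T⊆ U⊆ | code-natural fc (e % 8) φ S o T⊆ U′⊆ = refl

  kernel-bound : ∀ fc types forms → ∃[ M ] (∀ T U U′ → ∣ kernel fc types forms T U U′ ∣ ℕ.≤ M)
  kernel-bound fc types forms with unpack-bound
  ... | c , vec≤c = a ℕ.* (b ℕ.* c ℕ.* (b ℕ.* c)) , bound
    where
    weight size : Form → ℕ
    weight (ws , _) = Σ[ ws ] (λ w → w)
    size (ws , _) = length ws
    a = Σ[ forms ] weight
    b = Σ[ forms ] size
    bound : ∀ T U U′ → ∣ kernel fc types forms T U U′ ∣ ℕ.≤ a ℕ.* (b ℕ.* c ℕ.* (b ℕ.* c))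
    bound T U U′ with at 999 types (typeCode T)
    ... | e with at emptyForm forms (e / 8) | at-bound weight emptyForm forms (e / 8) | at-bound size emptyForm forms (e / 8)
    ...   | ws , rows | wa | wb = ℕₚ.≤-trans (∣dot∣≤ ws _ _) (ℕₚ.*-mono-≤ wa (ℕₚ.*-mono-≤ (vec≤ _) (vec≤ _)))
      where
      vec≤ : ∀ x → ∥ unpack (length ws) x ∥ ℕ.≤ b ℕ.* c
      vec≤ x = ℕₚ.≤-trans (vec≤c (length ws) x) (ℕₚ.*-monoˡ-≤ c wb)

  -- The eight symmetries of the square acting on the (t+1)² cells cut out by t points.
  turn : ℕ → ℕ → ℕ → ℕ → ℕ
  turn t 0 a b = a ℕ.* suc t ℕ.+ b
  turn t 1 a b = a ℕ.* suc t ℕ.+ (t ℕ.∸ b)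
  turn t 2 a b = (t ℕ.∸ a) ℕ.* suc t ℕ.+ b
  turn t 3 a b = (t ℕ.∸ a) ℕ.* suc t ℕ.+ (t ℕ.∸ b)
  turn t 4 a b = b ℕ.* suc t ℕ.+ a
  turn t 5 a b = b ℕ.* suc t ℕ.+ (t ℕ.∸ a)
  turn t 6 a b = (t ℕ.∸ b) ℕ.* suc t ℕ.+ a
  turn t _ a b = (t ℕ.∸ b) ℕ.* suc t ℕ.+ (t ℕ.∸ a)

  -- A one-point flag is determined by its cell. The value 10000 lies beyond the rows of every form
  -- used here, so a U of another size gets the zero vector.
  cellCode : ℕ → FlagCode
  cellCode t = record { code = c ; code-natural = nat }
    where
    c : ℕ → List Point → List Point → ℕ
    c g T (y ∷ []) = turn t g (column T y) (row T y)
    c g T _ = 10000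
    nat : ∀ i φ S → SameOrder φ S → ∀ {T U} → T ⊆ S → U ⊆ S → c i (map φ T) (map φ U) ≡ c i T U
    nat i φ S o {U = []} T⊆ U⊆ = refl
    nat i φ S o {U = y ∷ []} T⊆ U⊆ = cong₂ (turn t i) (column-natural φ S o T⊆ (lookup U⊆ (here refl))) (row-natural φ S o T⊆ (lookup U⊆ (here refl)))
    nat i φ S o {U = _ ∷ _ ∷ _} T⊆ U⊆ = refl

  -- The index into a table combines the cells of y and z in the 3 × 3 grid cut out by two points
  -- with one bit telling whether the pair ascends.
  pairCode : List (List ℕ) → FlagCode
  pairCode tables = record { code = c ; code-natural = nat }
    where
    c : ℕ → List Point → List Point → ℕ
    c i T (y ∷ z ∷ []) = at 10000 (at [] tables i)
      (((column T y ℕ.* 3 ℕ.+ row T y) ℕ.* 9 ℕ.+ (column T z ℕ.* 3 ℕ.+ row T z)) ℕ.* 2 ℕ.+ ind (ordinate y ≤ᵇ ordinate z))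
    c i T _ = 10000
    nat : ∀ i φ S → SameOrder φ S → ∀ {T U} → T ⊆ S → U ⊆ S → c i (map φ T) (map φ U) ≡ c i T U
    nat i φ S o {U = []} T⊆ U⊆ = refl
    nat i φ S o {U = y ∷ []} T⊆ U⊆ = refl
    nat i φ S o {T} {y ∷ z ∷ []} T⊆ U⊆
      rewrite column-natural φ S o T⊆ (lookup U⊆ (here refl)) | row-natural φ S o T⊆ (lookup U⊆ (here refl))
            | column-natural φ S o T⊆ (lookup U⊆ (there (here refl))) | row-natural φ S o T⊆ (lookup U⊆ (there (here refl)))
            | same-y o (lookup U⊆ (here refl)) (lookup U⊆ (there (here refl))) = refl
    nat i φ S o {U = _ ∷ _ ∷ _ ∷ _} T⊆ U⊆ = refl

  -- Finite checks, and the lower bound for `gmin` that they yield.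

  allTrue : (A → Bool) → List A → Bool
  allTrue p []       = true
  allTrue p (x ∷ xs) = p x ∧ allTrue p xs

  -- A record, so that comparing types never re-runs the computation.
  record Checked (p : A → Bool) (xs : List A) : Set where
    constructor checked
    field all-true : allTrue p xs ≡ true

  checked-∈ : ∀ {p : A → Bool} {xs} → Checked p xs → ∀ {x} → x ∈ xs → p x ≡ true
  checked-∈ {p = p} {x ∷ xs} (checked e) (here refl) = proj₁ (∧-true {p x} e)
  checked-∈ {p = p} {x ∷ xs} (checked e) (there x∈) = checked-∈ (checked (proj₂ (∧-true {p x} e))) x∈

  ≤ᵇ⇒≤ℤ : ∀ {i j} → (i ℤ.≤ᵇ j) ≡ true → i ≤ j
  ≤ᵇ⇒≤ℤ e = ≤ᵇ⇒≤ (subst T (sym e) _)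

  gmin-lower : ∀ k b R D M (F : List Point → ℤ) → 0 ℕ.< D →
    (∀ P → 0ℤ ≤ ∑[ subs (suc k ℕ.+ b) P ] F + + (M ℕ.* length P ℕ.^ (k ℕ.+ b))) →
    (∀ S → length S ≡ suc k ℕ.+ b → AllPairs _left-of_ S → Unique (map ordinate S) →
       F S + + (D ℕ.* ((suc k ℕ.+ b) C suc k)) ≤ + (D ℕ.* (R ℕ.* m (suc k) (map ordinate S)))) →
    ∃[ c ] (∀ n → 2 ℕ.* (suc k ℕ.+ 2 ℕ.* b) ℕ.≤ n → n ℕ.* (n C suc k) ℕ.≤ n ℕ.* (R ℕ.* gmin (suc k) n) ℕ.+ c ℕ.* (n C suc k))
  gmin-lower k b R D M F D>0 bound local = c , lower
    where
    c = M ℕ.* (4 ℕ.^ b ℕ.* b !) ℕ.* (4 ℕ.^ suc k ℕ.* (suc k) !)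
    lower : ∀ n → 2 ℕ.* (suc k ℕ.+ 2 ℕ.* b) ℕ.≤ n → n ℕ.* (n C suc k) ℕ.≤ n ℕ.* (R ℕ.* gmin (suc k) n) ℕ.+ c ℕ.* (n C suc k)
    lower n large with gmin-attained (suc k) n
    ... | π , π↭ , e = ℕₚ.*-cancelˡ-≤ D {{>-nonZero D>0}} (ℕₚ.*-cancelˡ-≤ d {{>-nonZero d>0}} (begin
      d ℕ.* (D ℕ.* (n ℕ.* Cₙ)) ≡⟨ r₁ d D n Cₙ ⟩
      n ℕ.* (d ℕ.* (D ℕ.* Cₙ)) ≤⟨ ℕₚ.*-monoʳ-≤ n (subst₂ (λ l g → ((l ℕ.∸ suc k) C b) ℕ.* (D ℕ.* (l C suc k)) ℕ.≤ ((l ℕ.∸ suc k) C b) ℕ.* (D ℕ.* (R ℕ.* g)) ℕ.+ M ℕ.* l ℕ.^ (k ℕ.+ b)) len (sym e) cert) ⟩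
      n ℕ.* (d ℕ.* (D ℕ.* (R ℕ.* G)) ℕ.+ M ℕ.* n ℕ.^ (k ℕ.+ b)) ≡⟨ cong (λ z → n ℕ.* (d ℕ.* (D ℕ.* (R ℕ.* G)) ℕ.+ M ℕ.* z)) (ℕₚ.^-distribˡ-+-* n k b) ⟩
      n ℕ.* (d ℕ.* (D ℕ.* (R ℕ.* G)) ℕ.+ M ℕ.* (n ℕ.^ k ℕ.* n ℕ.^ b)) ≡⟨ r₂ n (d ℕ.* (D ℕ.* (R ℕ.* G))) M (n ℕ.^ k) (n ℕ.^ b) ⟩
      n ℕ.* (d ℕ.* (D ℕ.* (R ℕ.* G))) ℕ.+ M ℕ.* (n ℕ.^ b ℕ.* n ℕ.^ suc k)
        ≤⟨ ℕₚ.+-monoʳ-≤ _ (ℕₚ.*-monoʳ-≤ M (ℕₚ.*-mono-≤ (^≤C b n≤2r b≤r) (^≤C (suc k) (ℕₚ.m≤n*m n 2) k≤n))) ⟩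
      n ℕ.* (d ℕ.* (D ℕ.* (R ℕ.* G))) ℕ.+ M ℕ.* ((4 ℕ.^ b ℕ.* (b ! ℕ.* d)) ℕ.* (4 ℕ.^ suc k ℕ.* ((suc k) ! ℕ.* Cₙ)))
        ≡⟨ r₃ n d D (R ℕ.* G) M (4 ℕ.^ b) (b !) (4 ℕ.^ suc k) ((suc k) !) Cₙ ⟩
      d ℕ.* (D ℕ.* (n ℕ.* (R ℕ.* G)) ℕ.+ c ℕ.* Cₙ) ≤⟨ ℕₚ.*-monoʳ-≤ d (ℕₚ.+-monoʳ-≤ (D ℕ.* (n ℕ.* (R ℕ.* G))) (ℕₚ.m≤n*m (c ℕ.* Cₙ) D {{>-nonZero D>0}})) ⟩
      d ℕ.* (D ℕ.* (n ℕ.* (R ℕ.* G)) ℕ.+ D ℕ.* (c ℕ.* Cₙ)) ≡⟨ cong (d ℕ.*_) (sym (ℕₚ.*-distribˡ-+ D _ _)) ⟩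
      d ℕ.* (D ℕ.* (n ℕ.* (R ℕ.* G) ℕ.+ c ℕ.* Cₙ)) ∎))
      where
      open ℕₚ.≤-Reasoning
      Cₙ = n C suc k
      G = gmin (suc k) n
      r = n ℕ.∸ suc k
      d = r C b
      len : length π ≡ n
      len = trans (↭-length π↭) (Listₚ.length-upTo n)
      cert = certificate (suc k) b R D F (λ l → M ℕ.* l ℕ.^ (k ℕ.+ b)) bound local π (Unique-↭ (↭-sym π↭) (upTo⁺ n))
      k≤n : 2 ℕ.* suc k ℕ.≤ n
      k≤n = ℕₚ.≤-trans (ℕₚ.*-monoʳ-≤ 2 (ℕₚ.m≤m+n (suc k) (2 ℕ.* b))) large
      r≥ : suc k ℕ.+ 2 ℕ.* (2 ℕ.* b) ℕ.≤ r
      r≥ = ℕₚ.≤-trans (ℕₚ.≤-reflexive (sym (trans (cong (ℕ._∸ suc k) (split (suc k) b)) (ℕₚ.m+n∸m≡n (suc k) _)))) (ℕₚ.∸-monoˡ-≤ (suc k) large)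
        where
        split : ∀ k b → 2 ℕ.* (k ℕ.+ 2 ℕ.* b) ≡ k ℕ.+ (k ℕ.+ 2 ℕ.* (2 ℕ.* b))
        split = ℕ-Ring.solve-∀
      b≤r : 2 ℕ.* b ℕ.≤ r
      b≤r = ℕₚ.≤-trans (ℕₚ.≤-trans (ℕₚ.m≤n*m (2 ℕ.* b) 2) (ℕₚ.m≤n+m _ (suc k))) r≥
      n≤2r : n ℕ.≤ 2 ℕ.* r
      n≤2r = ℕₚ.≤-trans (ℕₚ.≤-reflexive (sym (ℕₚ.m∸n+n≡m {n} {suc k} (ℕₚ.≤-trans (ℕₚ.m≤n*m (suc k) 2) k≤n))))
        (ℕₚ.≤-trans (ℕₚ.+-monoʳ-≤ r (ℕₚ.≤-trans (ℕₚ.m≤m+n (suc k) _) r≥)) (ℕₚ.≤-reflexive (cong (r ℕ.+_) (sym (ℕₚ.+-identityʳ r)))))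
      d>0 : 0 ℕ.< d
      d>0 = C>0 {r} {b} (ℕₚ.≤-trans (ℕₚ.m≤n*m b 2) b≤r)
      r₁ : ∀ d D n Cₙ → d ℕ.* (D ℕ.* (n ℕ.* Cₙ)) ≡ n ℕ.* (d ℕ.* (D ℕ.* Cₙ))
      r₁ = ℕ-Ring.solve-∀
      r₂ : ∀ n x M p q → n ℕ.* (x ℕ.+ M ℕ.* (p ℕ.* q)) ≡ n ℕ.* x ℕ.+ M ℕ.* (q ℕ.* (n ℕ.* p))
      r₂ = ℕ-Ring.solve-∀
      r₃ : ∀ n d D x M p f q g Cₙ → n ℕ.* (d ℕ.* (D ℕ.* x)) ℕ.+ M ℕ.* ((p ℕ.* (f ℕ.* d)) ℕ.* (q ℕ.* (g ℕ.* Cₙ)))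
         ≡ d ℕ.* (D ℕ.* (n ℕ.* x) ℕ.+ M ℕ.* (p ℕ.* f) ℕ.* (q ℕ.* g) ℕ.* Cₙ)
      r₃ = ℕ-Ring.solve-∀

-- The certificates for k = 3 and k = 4.

module Certificates where

  open Counting
  open Minima
  open TieBreaking using (AllPairs-resp-⊆)
  open DecreasingBlocks using (gmin-upper)
  open Densities using (converges)
  open Flags
  open import Data.Bool using (Bool)
  open import Data.Nat as ℕ using (ℕ; suc; z≤n; s≤s; _⊔_)
  import Data.Nat.Properties as ℕₚ
  import Data.Nat.Tactic.RingSolver as ℕ-Ring
  open import Data.Nat.Combinatorics using (_C_; nC1≡n)
  open import Data.Integer as ℤ using (ℤ; +_; 0ℤ; _+_; _*_; _⊖_; ∣_∣; _≤_; +≤+)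
  open import Data.Integer.Properties
  open import Data.List using (List; []; _∷_; map; length; upTo)
  open import Data.List.Membership.Propositional using (_∈_)
  open import Data.List.Relation.Unary.AllPairs using (AllPairs)
  import Data.List.Relation.Unary.AllPairs.Properties as AllPairsₚ
  open import Data.List.Relation.Unary.Unique.Propositional using (Unique)
  open import Data.Product using (_×_; _,_; ∃-syntax)
  open import Function using (_∘_)
  open import Relation.Binary.PropositionalEquality using (_≡_; sym; trans; cong; cong₂; subst; subst₂; refl)

  -- The entry 999 marks a type without kernel: 999 / 8 lies beyond the list of forms, which selects
  -- the empty form.
  types₅ : List ℕ
  types₅ =
    0 ∷ 999 ∷ 999 ∷ 999 ∷ 999 ∷ 999 ∷ 999 ∷ 11 ∷ 999 ∷ 999 ∷ 27 ∷ 999 ∷ 43 ∷ 999 ∷ 999 ∷ 999 ∷ 83 ∷ 99 ∷ 73 ∷ 9 ∷ 999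
    ∷ 19 ∷ 999 ∷ 999 ∷ 49 ∷ 24 ∷ 999 ∷ 999 ∷ 51 ∷ 999 ∷ 32 ∷ 999 ∷ 999 ∷ 999 ∷ 999 ∷ 999 ∷ 999 ∷ 85 ∷ 65 ∷ 999 ∷ 999
    ∷ 68 ∷ 91 ∷ 100 ∷ 999 ∷ 999 ∷ 80 ∷ 101 ∷ 89 ∷ 999 ∷ 40 ∷ 96 ∷ 74 ∷ 69 ∷ 17 ∷ 999 ∷ 86 ∷ 66 ∷ 57 ∷ 999 ∷ 999 ∷ 56
    ∷ 67 ∷ 84 ∷ 999 ∷ 16 ∷ 71 ∷ 75 ∷ 97 ∷ 41 ∷ 999 ∷ 88 ∷ 103 ∷ 81 ∷ 999 ∷ 999 ∷ 102 ∷ 90 ∷ 70 ∷ 999 ∷ 999 ∷ 64 ∷ 87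
    ∷ 999 ∷ 999 ∷ 999 ∷ 999 ∷ 999 ∷ 999 ∷ 33 ∷ 999 ∷ 50 ∷ 999 ∷ 999 ∷ 25 ∷ 48 ∷ 999 ∷ 999 ∷ 18 ∷ 999 ∷ 8 ∷ 72 ∷ 98 ∷ 82
    ∷ 999 ∷ 999 ∷ 999 ∷ 42 ∷ 999 ∷ 26 ∷ 999 ∷ 999 ∷ 10 ∷ 999 ∷ 999 ∷ 999 ∷ 999 ∷ 999 ∷ 999 ∷ 1 ∷ []

  -- Each form has one row for each of the 36 cells cut out by five points, and as many coordinates
  -- as weights.
  forms₅ : List Form
  forms₅ =
    ( (217966718232332690496 ∷ 54491679558083172624 ∷ 54491679558083172624 ∷ 54491679558083172624
      ∷ 47346457024662045779217840 ∷ 17216680213676102192535690000 ∷ 27361278440484921422209729536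
      ∷ 27178427522851806480231950736 ∷ [])
      , (9999800000000000564491556 ∷ 83489064040623693146 ∷ 81516071691756992626 ∷ 97594009339088693900
        ∷ 100000000009717804222 ∷ 100000000009717804222 ∷ 83489064040623693146 ∷ 9999800000000000564491556
        ∷ 9633962652722290705 ∷ 9999900001000010000000000775788913598966 ∷ 24314 ∷ 100000000009717804222
        ∷ 81516071691756992626 ∷ 9633962652722290705 ∷ 9999800000000000564491556 ∷ 99992
        ∷ 9999999999000010000000000224228913598966 ∷ 2406990679088693900 ∷ 97594009339088693900
        ∷ 199999000010000000000775788913598966 ∷ 99992 ∷ 9999800000000000564491556 ∷ 90367037352722290705
        ∷ 18484928311756992626 ∷ 100000000009717804222 ∷ 24314 ∷ 100001000010000000000224228913598966
        ∷ 90367037352722290705 ∷ 9999800000000000564491556 ∷ 16511935960623693146 ∷ 100000000009717804222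
        ∷ 100000000009717804222 ∷ 2406990679088693900 ∷ 18484928311756992626 ∷ 16511935960623693146
        ∷ 9999800000000000564491556 ∷ []) )
    ∷ ( (54491679558083172624 ∷ 54491679558083172624 ∷ 54491679558083172624 ∷ 54491679558083172624
      ∷ 22056577400866857666823404 ∷ 54491679558083172624 ∷ [])
      , (84861783082336 ∷ 100000000309714705775 ∷ 100000000309714705775 ∷ 18470000099336011399646811453
        ∷ 9660000000738986998785509425 ∷ 978130000000157005890626095248 ∷ 100000000309714705775 ∷ 71180976688452
        ∷ 100000000309714705775 ∷ 100000000309714705775 ∷ 983420000001655001460153700410 ∷ 9999800000999400570688450
        ∷ 100000000309714705775 ∷ 100000000309714705775 ∷ 70380287208014 ∷ 971900000000900955410673977692
        ∷ 79490000098389987610438888541 ∷ 9999800000999400570688450 ∷ 981530000000664011399646811453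
        ∷ 100000000309714705775 ∷ 28100000099100955410673977692 ∷ 2088692640 ∷ 9999800000999400570688450
        ∷ 20500000099145996900384990893 ∷ 990340000099262986998785509425 ∷ 16580000098345001460153700410
        ∷ 920510000001611987610438888541 ∷ 9999800000999400570688450 ∷ 973101535483836 ∷ 14231039570447699390
        ∷ 21870000099843005890626095248 ∷ 9999800000999400570688450 ∷ 9999800000999400570688450
        ∷ 979500000000855996900384990893 ∷ 85769039570447699390 ∷ 48192 ∷ []) )
    ∷ ( (54491679558083172624 ∷ 54491679558083172624 ∷ 54491679558083172624 ∷ 54491679558083172624
      ∷ 61722552165576436650990024 ∷ 63494681836853209746917304 ∷ 78569260069801338621620664 ∷ [])
      , (936901226489884 ∷ 1999990000000000020569935099640 ∷ 1999990000000000020569935099640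
        ∷ 10000100000000000000017306 ∷ 99814007710083904898 ∷ 98618994439247913121 ∷ 1999990000000000020569935099640
        ∷ 787403588476096 ∷ 95586002331947016267 ∷ 10000100000000000000017306 ∷ 10000100000000000000017306
        ∷ 7329995539036199952 ∷ 1999990000000000020569935099640 ∷ 4414002331947016267 ∷ 10000100000000000000017306
        ∷ 94845019360944323011 ∷ 22118980141597722343 ∷ 99999000009999900000979440065083054
        ∷ 10000100000000000000017306 ∷ 10000100000000000000017306 ∷ 5155019360944323011 ∷ 896589884266126
        ∷ 23797239730503384898 ∷ 99999000009999900000979440065083054 ∷ 186007710083904898 ∷ 10000100000000000000017306
        ∷ 77882980141597722343 ∷ 76203239730503384898 ∷ 99999000009999900000979440065083054 ∷ 11369103770274583942
        ∷ 1382994439247913121 ∷ 92671995539036199952 ∷ 99999000009999900000979440065083054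
        ∷ 99999000009999900000979440065083054 ∷ 88631103770274583942 ∷ 4495800580 ∷ []) )
    ∷ ( (54491679558083172624 ∷ 54491679558083172624 ∷ 54491679558083172624 ∷ 54491679558083172624 ∷ 54491679558083172624
      ∷ 54491679558083172624 ∷ 54491679558083172624 ∷ 54491679558083172624 ∷ 54491679558083172624
      ∷ 54491679558083172624 ∷ 54491679558083172624 ∷ 54491679558083172624 ∷ [])
      , (2030800000920630000091761000009458400000000000000043945
        ∷ 914689835095307978500173116224027061117312614069299598115220
        ∷ 894779796595237973480037796121998360880306500052159810609816
        ∷ 110000298134000030105806944008170143603633027069939205874
        ∷ 962569927604435990560203501768977670378897885960799783498312
        ∷ 678000009078400000989640000001676955769434484646
        ∷ 904469815394377975920032315933025261204613020072179564814035 ∷ 239410000008524000000226700000286780468501470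
        ∷ 1450061773969279203695646048690606423376 ∷ 21830042204172005509960196592980369729607923964628971100805
        ∷ 96558000009110800000820580000098948958968673892796
        ∷ 37440072404435009440203598232977679621297885960799783498312
        ∷ 902609811700915975450079215597994081214683325975641195789750 ∷ 5305700000000004362299132
        ∷ 49800096200000012550000093310000009405824669026658120516090
        ∷ 2488000001114600000995280000014078037029118426216
        ∷ 978179957804172994509960103408980360270407923964628971100805
        ∷ 999899999898134999970105893056008179856403633027069939205874
        ∷ 902789812002920975499897794407005540771590722959950525489009
        ∷ 40000000000000010000099987164819999593887025711677790992 ∷ 3332000009777600000981900000006162963289107497288
        ∷ 950209903800000987450000006690000000594224669026658120516090 ∷ 1450038227969270796495646048690606423376
        ∷ 105230203595237026520037703879998369119706500052159810609816
        ∷ 31940061805639008050222204146986809794602105956819458499883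
        ∷ 3112000009713200000974440000003842958709221095102
        ∷ 999960000000000999990000000013164810000593887025711677790992 ∷ 4694300000000004362299132
        ∷ 760590000091476000009773300000286780468501470 ∷ 85320165095307021500173183776027068882712614069299598115220
        ∷ 99436000009084200000996160000001102968129607885446
        ∷ 968069938205639991950222295854986800205402105956819458499883
        ∷ 97220188002920024519897705593005549228590722959950525489009
        ∷ 97400188300915024550079284403994088785483325975641195789750
        ∷ 95540184794377024080032384067025268795413020072179564814035
        ∷ 7969200000079370000008239000000541600000000000000043945 ∷ []) )
    ∷ ( (54491679558083172624 ∷ 54491679558083172624 ∷ 54491679558083172624 ∷ 31538783490824559440654592
      ∷ 37259978834096543209465404 ∷ 217966718232332690496 ∷ 54491679558083172624 ∷ 54491679558083172624
      ∷ 217966718232332690496 ∷ 177836320821782338017055200 ∷ [])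
      , (1870000000000128680004420018 ∷ 99999000000000000000000009999999999830770000397969
        ∷ 99999000000000000000000009999999999830770000397969 ∷ 972719998507283999870000099999912789999592744
        ∷ 200002000009999404062 ∷ 97362000000000000000000000001097158
        ∷ 99999000000000000000000009999999999830770000397969 ∷ 32200000000930000000000128660004219998
        ∷ 55599996419274999690000000000104190000025322 ∷ 7725000000000000000000009993013190 ∷ 200002000009999404062
        ∷ 200002000009999404062 ∷ 99999000000000000000000009999999999830770000397969
        ∷ 944419996480726999690000000000104190000025322 ∷ 9996800000999720000000000177340038429970
        ∷ 200002000009999404062 ∷ 7725000000000000000000009993013190 ∷ 27290001507283000130000099999087229999592744
        ∷ 27299998592717999870000099999912789999592744 ∷ 92275000000000000000000009993013190 ∷ 200002000009999404062
        ∷ 3200000000280000000000822660038429970 ∷ 944410003619274000310000000000895810000025322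
        ∷ 1000000000000000000009999999999169230000397969 ∷ 200002000009999404062 ∷ 200002000009999404062
        ∷ 92275000000000000000000009993013190 ∷ 55590003680726000310000000000895810000025322
        ∷ 9967800000999070000000000871340004219998 ∷ 1000000000000000000009999999999169230000397969
        ∷ 2638000000000000000000000001097158 ∷ 200002000009999404062 ∷ 972710001592717000130000099999087229999592744
        ∷ 1000000000000000000009999999999169230000397969 ∷ 1000000000000000000009999999999169230000397969
        ∷ 998130000000000871320004420018 ∷ []) )
    ∷ ( (54491679558083172624 ∷ 54491679558083172624 ∷ 54491679558083172624 ∷ 54491679558083172624 ∷ 54491679558083172624
      ∷ 54491679558083172624 ∷ 54491679558083172624 ∷ 54491679558083172624 ∷ 86489793521218924270028016
      ∷ 86792100151935271757564184 ∷ [])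
      , (9998204400060820032204070 ∷ 11999481000289994798735981130352084612 ∷ 9751300101081490003099299966459715907680
        ∷ 1000000000092045026460000000000000000000016357 ∷ 8953707803010079999799303939769780989153
        ∷ 10000000000000000001298531948739796092948 ∷ 9988100519999729994798735981130352084612 ∷ 12108054209236092968
        ∷ 9100194908093390000000000210651071006057 ∷ 99999999990000092045026469998801469051270204090695
        ∷ 444494174076120016600502989118922606220 ∷ 193891409975710003898554948439594517032
        ∷ 248799899918510003099299966459715907680 ∷ 899905092906610000000000210651071006057 ∷ 36604334000967474408714
        ∷ 116502022171820007096567957629660499128 ∷ 99999999990000092045026469998801469051270204090695
        ∷ 9552603372051709984299869945590661595125 ∷ 1000000000007955973540000000000000000000016357
        ∷ 99999999990000007955973549998801469051270204090695 ∷ 9883597978828180007096567957629660499128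
        ∷ 1896876955129923292238 ∷ 166600079121489998402133004349928802899
        ∷ 99999999990000092045026469998801469051270204090695 ∷ 1046392197989939999799303939769780989153
        ∷ 9555605826923880016600502989118922606220 ∷ 99999999990000007955973549998801469051270204090695
        ∷ 9833499921878529998402133004349928802899 ∷ 9968496952020282207606774 ∷ 315920008504113093689620195248
        ∷ 10000000000000000001298531948739796092948 ∷ 9806208591024290003898554948439594517032
        ∷ 447496628948309984299869945590661595125 ∷ 99999999990000007955973549998801469051270204090695
        ∷ 684080008504113093689620195248 ∷ 4071201970 ∷ []) )
    ∷ ( (54491679558083172624 ∷ 54491679558083172624 ∷ 54491679558083172624 ∷ 54491679558083172624 ∷ 54491679558083172624
      ∷ 54491679558083172624 ∷ 50696234601451708629826072 ∷ 356297192622276579349878240 ∷ [])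
      , (3316088609985808320 ∷ 47340088797993006669730492414 ∷ 121200429597955994140047285715
        ∷ 905859604999262968040330091065 ∷ 9999900001946701129398761952670294193019 ∷ 842149731400000000000000037267
        ∷ 952669911397993006669730492414 ∷ 960052349872801282 ∷ 34840727710109973158733904573
        ∷ 54129523297068027530885395768 ∷ 121461480098507040790282102738 ∷ 29479210501287019981033519243
        ∷ 878809570597955994140047285715 ∷ 965169272310109973158733904573 ∷ 99998000000000002478094669411813962
        ∷ 830398667600000000001994415004 ∷ 47429583605198957710686814421 ∷ 163401540201341993929691706973
        ∷ 94150395199262968040330091065 ∷ 945880476897068027530885395768 ∷ 169611332400000000001994415004
        ∷ 99998000000000002478094669411813962 ∷ 7719704866915119621119675 ∷ 3399527401085978759275499250
        ∷ 100001053308870798761952670294193019 ∷ 878548520098507040790282102738 ∷ 952580416405198957710686814421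
        ∷ 2280304866915119621119675 ∷ 99998000000000002478094669411813962 ∷ 122879852000000166000807399912
        ∷ 157860268600000000000000037267 ∷ 970530789501287019981033519243 ∷ 836608459801341993929691706973
        ∷ 996610472601085978759275499250 ∷ 877130148000000166000807399912 ∷ 36090780273494640 ∷ []) )
    ∷ ( (54491679558083172624 ∷ 217966718232332690496 ∷ 54491679558083172624 ∷ 54491679558083172624
      ∷ 39758788624263779227020044 ∷ 142391973204648285026694132 ∷ [])
      , (99436002780557684450 ∷ 2805989299569911718 ∷ 999990000100000000009133809782 ∷ 999990000100000000009133809782
        ∷ 94638011159811697486 ∷ 95202920220000012504 ∷ 2805989299569911718 ∷ 999990000100000000009133809782
        ∷ 5859952330212095637 ∷ 9999800000000000000080436 ∷ 6142999960000073696 ∷ 94638011150188497486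
        ∷ 999990000100000000009133809782 ∷ 5859952330212095637 ∷ 191680000092958 ∷ 9999800000000000000080436
        ∷ 9999800000000000000080436 ∷ 10000100000000000866209782 ∷ 999990000100000000009133809782
        ∷ 9999800000000000000080436 ∷ 9999800000000000000080436 ∷ 191680000092958 ∷ 5859952339788095637
        ∷ 10000100000000000866209782 ∷ 94638011159811697486 ∷ 6142999960000073696 ∷ 9999800000000000000080436
        ∷ 5859952339788095637 ∷ 10000100000000000866209782 ∷ 2805989290430111718 ∷ 95202920220000012504
        ∷ 94638011150188497486 ∷ 10000100000000000866209782 ∷ 10000100000000000866209782 ∷ 2805989290430111718
        ∷ 99436002789442484450 ∷ []) )
    ∷ ( (54491679558083172624 ∷ 54491679558083172624 ∷ 54491679558083172624 ∷ 54491679558083172624 ∷ 54491679558083172624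
      ∷ 54491679558083172624 ∷ 59120113623549576517346688 ∷ 93167119289721329735576256 ∷ 116912196374274945857687304
      ∷ 115474250146934311721475816 ∷ [])
      , (15249998502349080620838491356 ∷ 410155300733953108684710736 ∷ 1000000000000000000000000016010
        ∷ 985710075993705009321740314897 ∷ 101011127599210915189126517199 ∷ 973280340212774889889356322608
        ∷ 66959920096086970701205203918 ∷ 1000000000000000000000000016010 ∷ 974490154595488015071704997181
        ∷ 1543488012097429765095128 ∷ 991579918208577928738615097920 ∷ 941660095590915012639102784748
        ∷ 1000000000000000000000000016010 ∷ 102429685215299064559841218664 ∷ 243639374294760
        ∷ 984679626596448070489692599841 ∷ 10000000000050000328300551880698644792863 ∷ 991920052180083950279659870670
        ∷ 977990179104465033540890310279 ∷ 3485693324 ∷ 1000009999900000018610190900871927881384293050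
        ∷ 10000000000050000328300551880698644792863 ∷ 24219278890820973948622899835
        ∷ 99999000000000199999981399809199129072128615890940 ∷ 981160472503509997921684707436
        ∷ 38348845300820055431995787711 ∷ 21325034571350186342 ∷ 5819859396477952298657592666
        ∷ 99999000000000199999981399809199129072128615890940 ∷ 30509820789317939978507803314
        ∷ 955730033701320843538855210728 ∷ 11049882496811973199433491087 ∷ 100000006469850994871978588929792772
        ∷ 992019557418188061460332489768 ∷ 999990000099999950009671799449119311355391127
        ∷ 86180550900928909079932794365 ∷ []) )
    ∷ ( (54491679558083172624 ∷ 12887788756257253408300488 ∷ 54491679558083172624 ∷ 54491679558083172624 ∷ [])
      , (107730 ∷ 107730 ∷ 107730 ∷ 107730 ∷ 192023650000011751 ∷ 4743911770000004762 ∷ 107730 ∷ 107730 ∷ 107730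
        ∷ 99821985700000016400 ∷ 13103207780000093638 ∷ 9999884540 ∷ 107730 ∷ 107730 ∷ 107730 ∷ 107730 ∷ 9999884540
        ∷ 9999884540 ∷ 107730 ∷ 179985700000016400 ∷ 107730 ∷ 771780000007026 ∷ 9999884540 ∷ 9999884540
        ∷ 99808023650000011751 ∷ 86897207780000093638 ∷ 9999884540 ∷ 9999884540 ∷ 779000000000212 ∷ 107730
        ∷ 95257911770000004762 ∷ 9999884540 ∷ 9999884540 ∷ 9999884540 ∷ 107730 ∷ 107730 ∷ []) )
    ∷ ( (54491679558083172624 ∷ 54491679558083172624 ∷ 54491679558083172624 ∷ 54491679558083172624 ∷ 54491679558083172624
      ∷ 54491679558083172624 ∷ 88032395939841353919410148 ∷ 86935437482338440585088028 ∷ 90049858552936867606973780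
      ∷ 87926637321248017995620072 ∷ 120891430716754972812104016 ∷ [])
      , (970430137581794949040145698952 ∷ 945059955390748028860339003962 ∷ 901771469199716135740529789835
        ∷ 75601441302691826480598910465 ∷ 13680835886365000879218205798
        ∷ 1000010000000000000000000000000000002360608864 ∷ 100000000000000000000036330727294684901868815984527
        ∷ 1805891174986589959195167 ∷ 908089520991501065500768205087 ∷ 1000000000000000000000000027666
        ∷ 938238919491887169889711322289 ∷ 986699256806630065491457695862 ∷ 960000491508473074568498499363
        ∷ 968091169500503974471611814554 ∷ 1000000000000000000000000027666 ∷ 976179720388347002369933204171
        ∷ 999999999900000000000000088359010799078501183 ∷ 49788710794069950360645590890
        ∷ 99999000000000100000000000000011641989218560989953 ∷ 972240780594711966811438311005
        ∷ 114780135500836992060123905722 ∷ 982059692197694043989472498721 ∷ 1098919998870974311454199348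
        ∷ 999999999900000000000000088359010799078501183 ∷ 56451080195953959810423609723
        ∷ 99999000000000100000000000000011641989218560989953 ∷ 68568784601473817758018101768
        ∷ 13990651607444875829507383223 ∷ 9999900000000000000099999963679272805316098141184187807
        ∷ 973439334698705068030526401570 ∷ 1000010000000000000000000000000000002360608864
        ∷ 52589363815090006149433789754 ∷ 68439305206468971429522200655
        ∷ 9999900000000000000099999963679272805316098141184187807 ∷ 5900854207571803959602690120 ∷ 285858818103732 ∷ []) )
    ∷ ( (54491679558083172624 ∷ 54491679558083172624 ∷ 54491679558083172624 ∷ 54491679558083172624 ∷ 54491679558083172624
      ∷ 54491679558083172624 ∷ 54491679558083172624 ∷ 86902233135054926578105321 ∷ 177155183406999756000420903 ∷ [])
      , (96207092670000005619000000000040730 ∷ 3407109520218991707990680843904566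
        ∷ 999999999900000000000000079289921630357810433 ∷ 96386883739484082281882590608711892
        ∷ 5507940490745998884979910213598793 ∷ 437200000898040175285304 ∷ 9312875488824883180011409792680887
        ∷ 999999999900000000000000079289921630357810433 ∷ 99267095129315504579973090706916756
        ∷ 99715000090000000257000001915718188 ∷ 1883200000103909494613862 ∷ 94493059510745901116979910213598793
        ∷ 778589929690062113138576391603 ∷ 91537058530226587757013530065685500 ∷ 90518127911143796075064059876208604
        ∷ 1766400000087549969213864 ∷ 285999910000099743000001915718188 ∷ 3614116279484017719882590608711892
        ∷ 93115079380223587706034890024287788 ∷ 95523883499702996467094418842100708
        ∷ 200000000000000000000156749284479134 ∷ 9482872091143703925064059876208604 ∷ 733904889315595421973090706916756
        ∷ 19999900000000000000020711921630357810433 ∷ 95360054660143395082990679733291905 ∷ 9557800000102067896896588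
        ∷ 4477116519702903533094418842100708 ∷ 8463941470226512243013530065685500
        ∷ 19999900000000000000020711921630357810433 ∷ 96593890480218908293990680843904566 ∷ 454400000897700208485056
        ∷ 4640945340143304918990679733291905 ∷ 6885920620223512294034890024287788 ∷ 221429929609938113138576391603
        ∷ 90688124528824816820011409792680887 ∷ 3793907330000094381000000000040730 ∷ []) )
    ∷ ( (54491679558083172624 ∷ 54491679558083172624 ∷ 54491679558083172624 ∷ 54491679558083172624 ∷ 54491679558083172624
      ∷ 54491679558083172624 ∷ 54491679558083172624 ∷ 57254006183862793478999784 ∷ 89491127220242793497235072 ∷ [])
      , (190969390710112832539233881940 ∷ 99378961739117793489039778010293137 ∷ 99252036011257197671062948892207146
        ∷ 2732206220069458650105380 ∷ 97830958269510391429943319134698636 ∷ 10000000125947749761494874073149321801348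
        ∷ 2826938390218691563828141016199731 ∷ 97828042840236288177019587845305094 ∷ 182960200406103409150408798199081
        ∷ 9999900000000000000000000000008588787671 ∷ 28261945618588995764 ∷ 1610969381489210179096410525302549
        ∷ 95134988510635113067971241796514946 ∷ 98952895940861496768960689598017193
        ∷ 94599064179505505261893418624909377 ∷ 195030648929923075996978456490689
        ∷ 9999900000000000000000000000008588787671 ∷ 10880104359743986138053219711687522
        ∷ 999990000199875052260238605126926862089510981 ∷ 100000000000000000000000000000018284
        ∷ 625050978612198185031659707702607 ∷ 386951638133994862036779536186574 ∷ 8861026150881696005118949056390739
        ∷ 9999900000000000000000000000008588787671 ∷ 1434027200335298262947229536101832
        ∷ 999990000199875052260238605126926862089510981 ∷ 99519038717874091445827531034498750
        ∷ 98735894029864100848059461100295321 ∷ 315910788193241 ∷ 910978730606608148007619582594671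
        ∷ 10000000125947749761494874073149321801348 ∷ 1411394045 ∷ 99839927250312506176970831225692790
        ∷ 99658021768073792974970501003606562 ∷ 94879979859250880005964492176011080
        ∷ 5731140879750721295957849030276131 ∷ []) )
    ∷ []

  types₄ : List ℕ
  types₄ =
    0 ∷ 11 ∷ 27 ∷ 999 ∷ 16 ∷ 31 ∷ 999 ∷ 25 ∷ 28 ∷ 999 ∷ 999 ∷ 9 ∷ 8 ∷ 999 ∷ 999 ∷ 30 ∷ 24 ∷ 999 ∷ 29 ∷ 17 ∷ 999 ∷ 26
    ∷ 10 ∷ 1 ∷ []

  forms₄ : List Form
  forms₄ =
    ( (54491679558083172624 ∷ 54491679558083172624 ∷ 54491679558083172624 ∷ [])
      , (85384 ∷ 15540017786799 ∷ 897219845901238 ∷ 7308 ∷ 7308 ∷ 15540017786799 ∷ 85384 ∷ 775340710097978 ∷ 142011972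
        ∷ 7308 ∷ 897219845901238 ∷ 775340710097978 ∷ 85384 ∷ 224660710097978 ∷ 102799845901238 ∷ 7308 ∷ 142011972
        ∷ 224660710097978 ∷ 85384 ∷ 984460017786799 ∷ 7308 ∷ 7308 ∷ 102799845901238 ∷ 984460017786799 ∷ 85384 ∷ []) )
    ∷ ( (15833743627110947716979960 ∷ 15511545620202001898775808 ∷ 4113105209861443933443526656 ∷ [])
      , (0 ∷ 0 ∷ 0 ∷ 999990000000001 ∷ 100000 ∷ 0 ∷ 0 ∷ 0 ∷ 0 ∷ 0 ∷ 0 ∷ 0 ∷ 0 ∷ 999999999999999 ∷ 0 ∷ 10000000001 ∷ 0
        ∷ 19999999999 ∷ 0 ∷ 999999999999999 ∷ 100000 ∷ 0 ∷ 0 ∷ 19999999999 ∷ 0 ∷ []) )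
    ∷ ( (54491679558083172624 ∷ 54491679558083172624 ∷ 25053221868870307247433136 ∷ [])
      , (302010926 ∷ 999999058701846 ∷ 999999058701846 ∷ 96308 ∷ 95754 ∷ 999999058701846 ∷ 916615194 ∷ 969500887 ∷ 96308
        ∷ 96308 ∷ 999999058701846 ∷ 969500887 ∷ 96308 ∷ 9030500887 ∷ 10941301846 ∷ 96308 ∷ 96308 ∷ 9030500887
        ∷ 9083415194 ∷ 10941301846 ∷ 95754 ∷ 96308 ∷ 10941301846 ∷ 10941301846 ∷ 9698010926 ∷ []) )
    ∷ ( (54491679558083172624 ∷ 54491679558083172624 ∷ 54491679558083172624 ∷ 9458885253661577605155232
      ∷ 17229704403766711779185916 ∷ 17778873099604342161281404 ∷ [])
      , (22679884083654 ∷ 1000001154603839 ∷ 999310896097821 ∷ 84350340298684 ∷ 989919664599781 ∷ 1000001154603839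
        ∷ 955649838679520 ∷ 10090335585998 ∷ 10000000000057219565795787 ∷ 990499838605561 ∷ 11720400907770
        ∷ 100000064509676796130 ∷ 10000000000057219565795787 ∷ 10090335585998 ∷ 9999999999935509168700031 ∷ 14221
        ∷ 10789439502398 ∷ 990839430395925 ∷ 9999999999935509168700031 ∷ 10090335585998 ∷ 989919664599781
        ∷ 729633802683 ∷ 10789439502398 ∷ 999990000099999942799279700374 ∷ 47410252686709 ∷ []) )
    ∷ []

  -- There are 72 flags of two points over a type of two points, numbered from 0 to 71; 99 marks
  -- combinations contradicting the order of the cells. The first table is for the ascending type.
  -- The second describes the flags of the descending type after reflection of left and right, so
  -- that both types share one form.
  pairFlags : List (List ℕ)
  pairFlags =
    (31 ∷ 5 ∷ 99 ∷ 15 ∷ 99 ∷ 23 ∷ 38 ∷ 14 ∷ 99 ∷ 4 ∷ 99 ∷ 10 ∷ 42 ∷ 19 ∷ 99 ∷ 9 ∷ 99 ∷ 3 ∷ 51 ∷ 99 ∷ 57 ∷ 39 ∷ 99 ∷ 45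
      ∷ 56 ∷ 99 ∷ 50 ∷ 30 ∷ 99 ∷ 35 ∷ 59 ∷ 99 ∷ 53 ∷ 34 ∷ 99 ∷ 29 ∷ 65 ∷ 99 ∷ 69 ∷ 99 ∷ 71 ∷ 61 ∷ 68 ∷ 99 ∷ 64 ∷ 99
      ∷ 67 ∷ 54 ∷ 70 ∷ 99 ∷ 66 ∷ 99 ∷ 63 ∷ 49 ∷ 99 ∷ 99 ∷ 99 ∷ 99 ∷ 99 ∷ 99 ∷ 55 ∷ 48 ∷ 99 ∷ 28 ∷ 99 ∷ 33 ∷ 58 ∷ 52
      ∷ 99 ∷ 32 ∷ 99 ∷ 27 ∷ 99 ∷ 99 ∷ 99 ∷ 99 ∷ 99 ∷ 99 ∷ 37 ∷ 99 ∷ 13 ∷ 2 ∷ 99 ∷ 8 ∷ 41 ∷ 99 ∷ 17 ∷ 7 ∷ 99 ∷ 1 ∷ 99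
      ∷ 99 ∷ 99 ∷ 99 ∷ 99 ∷ 99 ∷ 44 ∷ 99 ∷ 22 ∷ 99 ∷ 26 ∷ 18 ∷ 47 ∷ 99 ∷ 25 ∷ 99 ∷ 21 ∷ 12 ∷ 99 ∷ 99 ∷ 99 ∷ 99 ∷ 99
      ∷ 99 ∷ 99 ∷ 99 ∷ 99 ∷ 99 ∷ 99 ∷ 99 ∷ 62 ∷ 60 ∷ 99 ∷ 43 ∷ 99 ∷ 36 ∷ 99 ∷ 99 ∷ 99 ∷ 99 ∷ 99 ∷ 99 ∷ 99 ∷ 99 ∷ 99
      ∷ 99 ∷ 99 ∷ 99 ∷ 46 ∷ 99 ∷ 24 ∷ 20 ∷ 99 ∷ 11 ∷ 99 ∷ 99 ∷ 99 ∷ 99 ∷ 99 ∷ 99 ∷ 99 ∷ 99 ∷ 99 ∷ 99 ∷ 99 ∷ 99 ∷ 40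
      ∷ 99 ∷ 16 ∷ 99 ∷ 6 ∷ 0 ∷ [])
    ∷ (60 ∷ 62 ∷ 99 ∷ 46 ∷ 99 ∷ 40 ∷ 52 ∷ 58 ∷ 99 ∷ 41 ∷ 99 ∷ 47 ∷ 19 ∷ 42 ∷ 99 ∷ 59 ∷ 99 ∷ 70 ∷ 43 ∷ 99 ∷ 20 ∷ 24 ∷ 99
      ∷ 16 ∷ 32 ∷ 99 ∷ 7 ∷ 17 ∷ 99 ∷ 25 ∷ 9 ∷ 99 ∷ 34 ∷ 53 ∷ 99 ∷ 66 ∷ 36 ∷ 99 ∷ 11 ∷ 99 ∷ 0 ∷ 6 ∷ 27 ∷ 99 ∷ 1 ∷ 99
      ∷ 12 ∷ 21 ∷ 3 ∷ 99 ∷ 29 ∷ 99 ∷ 49 ∷ 63 ∷ 99 ∷ 99 ∷ 99 ∷ 99 ∷ 99 ∷ 99 ∷ 48 ∷ 55 ∷ 99 ∷ 37 ∷ 99 ∷ 44 ∷ 14 ∷ 38 ∷ 99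
      ∷ 56 ∷ 99 ∷ 68 ∷ 99 ∷ 99 ∷ 99 ∷ 99 ∷ 99 ∷ 99 ∷ 28 ∷ 99 ∷ 2 ∷ 13 ∷ 99 ∷ 22 ∷ 4 ∷ 99 ∷ 30 ∷ 50 ∷ 99 ∷ 64 ∷ 99 ∷ 99
      ∷ 99 ∷ 99 ∷ 99 ∷ 99 ∷ 33 ∷ 99 ∷ 8 ∷ 99 ∷ 18 ∷ 26 ∷ 10 ∷ 99 ∷ 35 ∷ 99 ∷ 54 ∷ 67 ∷ 99 ∷ 99 ∷ 99 ∷ 99 ∷ 99 ∷ 99 ∷ 99
      ∷ 99 ∷ 99 ∷ 99 ∷ 99 ∷ 99 ∷ 5 ∷ 31 ∷ 99 ∷ 51 ∷ 99 ∷ 65 ∷ 99 ∷ 99 ∷ 99 ∷ 99 ∷ 99 ∷ 99 ∷ 99 ∷ 99 ∷ 99 ∷ 99 ∷ 99 ∷ 99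
      ∷ 15 ∷ 99 ∷ 39 ∷ 57 ∷ 99 ∷ 69 ∷ 99 ∷ 99 ∷ 99 ∷ 99 ∷ 99 ∷ 99 ∷ 99 ∷ 99 ∷ 99 ∷ 99 ∷ 99 ∷ 99 ∷ 23 ∷ 99 ∷ 45 ∷ 99
      ∷ 61 ∷ 71 ∷ [])
    ∷ []

  forms₂ : List Form
  forms₂ =
    ( (54491679558083172624 ∷ 54491679558083172624 ∷ 54491679558083172624 ∷ 54491679558083172624 ∷ 217966718232332690496
      ∷ 234850936020073053471812 ∷ 31308957373610499995535936 ∷ 957097871308092765033552 ∷ 1070821705270256056257544
      ∷ 329257237229814719428955 ∷ 1816087995783917705087151 ∷ 1160042801771544031113532 ∷ 7131036983177306771199764
      ∷ 589693679646502981900024 ∷ 2032454000438194678386923 ∷ 8000328550904645113107636 ∷ 508224275769508179321097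
      ∷ 6393522915357644018217536 ∷ 10329618901699876725877920 ∷ 1228211314377067477891584 ∷ 12537837451147984295528384
      ∷ 46206329153873618085389056 ∷ [])
      , (9999200000000000000099992000000000000000000009440800000918489736097944
        ∷ 9999600000000000000000000000009999600000000000000099992000000000000000000009720400000959249910899372
        ∷ 9999200000000000000000000000000000000000000000000099992000000000000000000000000000000000000085600800
        ∷ 9999200000000000000099992000000000000000000000000000000000009736097944
        ∷ 9999600000000000000000000000009999600000000000000099992000000000000000000000279600000040769910899372
        ∷ 9999200000000000000099992000000000000000000000559200000081529736097944
        ∷ 20000800000999960000400000000049999600004000000000000000000000279600000040769763695224
        ∷ 1000009999900000999999999700000000010000000000999990000199999000010000100001999999995500639973079931297474
        ∷ 1000009999900000999999999700000000010000000000999990000199999999999999999999000019995599361973079931297474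
        ∷ 999990000000000999999999799999000019999900001999990000199999000010000100001999990123200639038149887597117
        ∷ 999990000000000999999999799999000019999900001999990000199999999999999999999000010123299361038149887597117
        ∷ 999990000000000999999999799999000019999900001999990000199999000010000100001999999983400639017769887597117
        ∷ 999990000000000999999999799999000019999900001999990000199999999999999999999000019983499361017769887597117
        ∷ 400000000020000800000999960000000000000049999600004000000000000000000000000000000000009588893796
        ∷ 10000000000999999999700001000019999999999999990000199999000019999999999999990016600639982249887597117
        ∷ 10000000000999999999700001000019999999999999990000199999999990000100001000010016699361982249887597117
        ∷ 99999000000000099999000000000299999000009999800004000020000100001999940060802285998299928096314
        ∷ 299999000000000099999000000000099999000009999800004000020000100001999949921002285977919840695600
        ∷ 99999000000000000001999980000000001000020000099998000020000100001999940079002285022099267495550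
        ∷ 99999000009999900000000019999900000999999999999999000010000000000999970069901664010199761500047
        ∷ 1000000000000001999980000000001000020000099998999989999999999000060079097715022099267495550
        ∷ 1000000000099999000000000299999000009999800004999989999999999000060060897715998299928096314
        ∷ 200001000000000099999000000000099999000009999800004999989999999999000069921097715977919840695600
        ∷ 1000009999900000000019999900000999999999999999999990000000000000030069998336010199761500047
        ∷ 10000000000000010000000000000000000000000000000000000000999969999699996000049867797444076900000010560
        ∷ 10000000000000010000000000000000000000000000000000000000000000000000000000009867700000076900000010560
        ∷ 10000000000000010000000000000000000000000000000000000000000040000400004999969867702556076900000010560
        ∷ 10000000000999999999700001000019999999999999990000199999000019999999999999999876800639961869887597117
        ∷ 99999000009999900000999999999700000000010000000000999990000199999000019999999999999990004500639026939931297474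
        ∷ 10000000000999999999700001000019999999999999990000199999999990000100001000019876899361961869887597117
        ∷ 99999000009999900000999999999700000000010000000000999990000199999999990000100001000010004599361026939931297474
        ∷ 20000800000999960000400000000049999600004000000000000000000009720400000959249763695224
        ∷ 200000000000000000000000000000000000000020000000000999980000001278000000343297594
        ∷ 200000000000000000000000000000000000000009999899998000000000000000000000343297594
        ∷ 200000000000000000000000000000000000000000000200002000000000000000000000343297594
        ∷ 200000000000000000000000000000000000999980000000000000020000098722000000343297594
        ∷ 99999000009999900000000019999900000999999999999999000010000000000999979930101664989819761500047
        ∷ 299999000000000000001000000000000001000009999800004000029999999999999940079002285022099840695600
        ∷ 99999000000000000001000000000200001000009999800004000029999999999999949939202285001719928096314
        ∷ 99999000000000099999999980000099999000020000099998000029999999999999949921002285977919267495550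
        ∷ 200000000000000000000000000000000000000020139800018020389734899490
        ∷ 200000000000000000000000000000000000000000000000000000000000000000000020000000018000009647498776
        ∷ 200000000000000000000000000000000000000029860200018979629734899490
        ∷ 1000000000000001000000000000000000000000200000000000000100001000000079098957958620357401986
        ∷ 20000000000000000000000000000009999599995000000000000000000000312697450
        ∷ 99999000000000099999000000000000000000000000200000000000000100001000009921001043041380357401986
        ∷ 1000000000000000999989999899998000040000098740063470111803238
        ∷ 1000000000000000000020000200002000000000001296063470111803238
        ∷ 1000000000099999999980000099999000020000099998999980000100001000069921097715977919267495550
        ∷ 1000009999900000000019999900000999999999999999999990000000000000039930198336989819761500047
        ∷ 200001000000000000001000000000000001000009999800004999980000100001000060079097715022099840695600
        ∷ 1000000000000001000000000200001000009999800004999980000100001000069939297715001719928096314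
        ∷ 1000000000099999000000000000000000000000200000000009999999999000009921098957041380357401986
        ∷ 20000000000000000000000000000000000500005000000000000000000000312697450
        ∷ 99999000000000000001000000000000000000000000200000000009999999999000000079001043958620357401986
        ∷ 999990000000000000010000000000000000000000000000000000000000999960000400004000040132397444923100000010560
        ∷ 999990000000000000010000000000000000000000000000000000000000000000000000000000000132300000923100000010560
        ∷ 999990000000000000010000000000000000000000000000000000000000000049999699996999960132302556923100000010560
        ∷ 99999000000000000000999980000200002000040000098740936530111803238
        ∷ 99999000000000000000000029999899998000000000001296936530111803238
        ∷ 999960000000004000000000000000999920000099928000000392801048
        ∷ 999960000000004000000000000000000080000000072000000392801048
        ∷ 40000000000000000000000000000040000000036000000269601000
        ∷ 200000000000000000000000000000000000999980139899982020389734899490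
        ∷ 200000000000000000000000000000000000000000000000000000000000000000999980000099982000009647498776
        ∷ 200000000000000000000000000000000000999989860299982979629734899490
        ∷ 1000000000000000999989999899998000000000098704063470111803238
        ∷ 1000000000000000000020000200002999960000001260063470111803238
        ∷ 99999000000000000000999980000200002000000000098704936530111803238
        ∷ 99999000000000000000000029999899998999960000001260936530111803238
        ∷ 40000000000000000000000000000000000000000000000269601000
        ∷ 40000000000000000000000000999960000099964000000269601000 ∷ []) )
    ∷ []

  -- Indexed by `typeCode`. The entry is the place of the pattern's value in `values₆`, which lists
  -- the values in increasing order.
  classes₆ : List ℕ
  classes₆ =
    112 ∷ 111 ∷ 108 ∷ 107 ∷ 109 ∷ 109 ∷ 110 ∷ 108 ∷ 89 ∷ 86 ∷ 93 ∷ 95 ∷ 104 ∷ 99 ∷ 63 ∷ 64 ∷ 74 ∷ 71 ∷ 103 ∷ 76 ∷ 50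
    ∷ 42 ∷ 36 ∷ 44 ∷ 109 ∷ 81 ∷ 23 ∷ 2 ∷ 8 ∷ 14 ∷ 105 ∷ 102 ∷ 99 ∷ 96 ∷ 90 ∷ 91 ∷ 104 ∷ 107 ∷ 86 ∷ 18 ∷ 60 ∷ 71 ∷ 101
    ∷ 96 ∷ 64 ∷ 14 ∷ 44 ∷ 36 ∷ 67 ∷ 72 ∷ 39 ∷ 19 ∷ 71 ∷ 74 ∷ 94 ∷ 69 ∷ 35 ∷ 6 ∷ 3 ∷ 64 ∷ 104 ∷ 77 ∷ 84 ∷ 73 ∷ 80 ∷ 62
    ∷ 37 ∷ 87 ∷ 51 ∷ 59 ∷ 41 ∷ 47 ∷ 55 ∷ 73 ∷ 42 ∷ 19 ∷ 52 ∷ 43 ∷ 58 ∷ 34 ∷ 21 ∷ 32 ∷ 95 ∷ 93 ∷ 80 ∷ 33 ∷ 16 ∷ 7 ∷ 12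
    ∷ 86 ∷ 107 ∷ 78 ∷ 40 ∷ 5 ∷ 2 ∷ 44 ∷ 87 ∷ 82 ∷ 61 ∷ 29 ∷ 25 ∷ 39 ∷ 73 ∷ 56 ∷ 75 ∷ 45 ∷ 38 ∷ 51 ∷ 42 ∷ 75 ∷ 97 ∷ 92
    ∷ 68 ∷ 53 ∷ 36 ∷ 35 ∷ 61 ∷ 68 ∷ 30 ∷ 89 ∷ 110 ∷ 100 ∷ 83 ∷ 87 ∷ 94 ∷ 91 ∷ 0 ∷ 83 ∷ 53 ∷ 51 ∷ 43 ∷ 52 ∷ 37 ∷ 84 ∷ 50
    ∷ 39 ∷ 47 ∷ 41 ∷ 67 ∷ 28 ∷ 46 ∷ 21 ∷ 71 ∷ 60 ∷ 90 ∷ 24 ∷ 20 ∷ 4 ∷ 17 ∷ 18 ∷ 104 ∷ 77 ∷ 76 ∷ 72 ∷ 65 ∷ 48 ∷ 103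
    ∷ 109 ∷ 93 ∷ 60 ∷ 10 ∷ 54 ∷ 67 ∷ 90 ∷ 74 ∷ 44 ∷ 62 ∷ 80 ∷ 26 ∷ 65 ∷ 47 ∷ 52 ∷ 91 ∷ 90 ∷ 65 ∷ 57 ∷ 33 ∷ 24 ∷ 9 ∷ 96
    ∷ 101 ∷ 15 ∷ 28 ∷ 34 ∷ 54 ∷ 10 ∷ 67 ∷ 94 ∷ 43 ∷ 41 ∷ 48 ∷ 65 ∷ 58 ∷ 80 ∷ 36 ∷ 71 ∷ 91 ∷ 94 ∷ 49 ∷ 54 ∷ 71 ∷ 95
    ∷ 109 ∷ 109 ∷ 54 ∷ 57 ∷ 69 ∷ 81 ∷ 78 ∷ 107 ∷ 96 ∷ 9 ∷ 11 ∷ 1 ∷ 4 ∷ 60 ∷ 72 ∷ 69 ∷ 16 ∷ 20 ∷ 11 ∷ 72 ∷ 34 ∷ 33 ∷ 35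
    ∷ 23 ∷ 40 ∷ 87 ∷ 21 ∷ 16 ∷ 61 ∷ 68 ∷ 85 ∷ 83 ∷ 71 ∷ 69 ∷ 82 ∷ 79 ∷ 98 ∷ 108 ∷ 108 ∷ 98 ∷ 85 ∷ 40 ∷ 23 ∷ 71 ∷ 83
    ∷ 79 ∷ 68 ∷ 38 ∷ 45 ∷ 19 ∷ 84 ∷ 66 ∷ 70 ∷ 25 ∷ 29 ∷ 59 ∷ 50 ∷ 70 ∷ 88 ∷ 97 ∷ 61 ∷ 51 ∷ 74 ∷ 6 ∷ 29 ∷ 38 ∷ 12 ∷ 86
    ∷ 99 ∷ 22 ∷ 31 ∷ 11 ∷ 20 ∷ 41 ∷ 76 ∷ 81 ∷ 7 ∷ 4 ∷ 1 ∷ 34 ∷ 28 ∷ 24 ∷ 6 ∷ 2 ∷ 5 ∷ 73 ∷ 46 ∷ 20 ∷ 29 ∷ 38 ∷ 40 ∷ 84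
    ∷ 47 ∷ 33 ∷ 56 ∷ 66 ∷ 22 ∷ 99 ∷ 63 ∷ 13 ∷ 70 ∷ 75 ∷ 16 ∷ 43 ∷ 50 ∷ 23 ∷ 45 ∷ 25 ∷ 11 ∷ 28 ∷ 42 ∷ 2 ∷ 8 ∷ 3 ∷ 9 ∷ 15
    ∷ 21 ∷ 4 ∷ 17 ∷ 12 ∷ 78 ∷ 77 ∷ 52 ∷ 24 ∷ 9 ∷ 22 ∷ 27 ∷ 102 ∷ 64 ∷ 3 ∷ 25 ∷ 45 ∷ 7 ∷ 93 ∷ 39 ∷ 35 ∷ 75 ∷ 70 ∷ 31
    ∷ 76 ∷ 19 ∷ 6 ∷ 3 ∷ 13 ∷ 22 ∷ 77 ∷ 32 ∷ 7 ∷ 12 ∷ 30 ∷ 98 ∷ 100 ∷ 95 ∷ 81 ∷ 78 ∷ 98 ∷ 106 ∷ 111 ∷ 111 ∷ 106 ∷ 98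
    ∷ 78 ∷ 81 ∷ 95 ∷ 100 ∷ 98 ∷ 30 ∷ 12 ∷ 7 ∷ 32 ∷ 77 ∷ 22 ∷ 13 ∷ 3 ∷ 6 ∷ 19 ∷ 76 ∷ 31 ∷ 70 ∷ 75 ∷ 35 ∷ 39 ∷ 93 ∷ 7
    ∷ 45 ∷ 25 ∷ 3 ∷ 64 ∷ 102 ∷ 27 ∷ 22 ∷ 9 ∷ 24 ∷ 52 ∷ 77 ∷ 78 ∷ 12 ∷ 17 ∷ 4 ∷ 21 ∷ 15 ∷ 9 ∷ 3 ∷ 8 ∷ 2 ∷ 42 ∷ 28 ∷ 11
    ∷ 25 ∷ 45 ∷ 23 ∷ 50 ∷ 43 ∷ 16 ∷ 75 ∷ 70 ∷ 13 ∷ 63 ∷ 99 ∷ 22 ∷ 66 ∷ 56 ∷ 33 ∷ 47 ∷ 84 ∷ 40 ∷ 38 ∷ 29 ∷ 20 ∷ 46 ∷ 73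
    ∷ 5 ∷ 2 ∷ 6 ∷ 24 ∷ 28 ∷ 34 ∷ 1 ∷ 4 ∷ 7 ∷ 81 ∷ 76 ∷ 41 ∷ 20 ∷ 11 ∷ 31 ∷ 22 ∷ 99 ∷ 86 ∷ 12 ∷ 38 ∷ 29 ∷ 6 ∷ 74 ∷ 51
    ∷ 61 ∷ 97 ∷ 88 ∷ 70 ∷ 50 ∷ 59 ∷ 29 ∷ 25 ∷ 70 ∷ 66 ∷ 84 ∷ 19 ∷ 45 ∷ 38 ∷ 68 ∷ 79 ∷ 83 ∷ 71 ∷ 23 ∷ 40 ∷ 85 ∷ 98 ∷ 108
    ∷ 108 ∷ 98 ∷ 79 ∷ 82 ∷ 69 ∷ 71 ∷ 83 ∷ 85 ∷ 68 ∷ 61 ∷ 16 ∷ 21 ∷ 87 ∷ 40 ∷ 23 ∷ 35 ∷ 33 ∷ 34 ∷ 72 ∷ 11 ∷ 20 ∷ 16 ∷ 69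
    ∷ 72 ∷ 60 ∷ 4 ∷ 1 ∷ 11 ∷ 9 ∷ 96 ∷ 107 ∷ 78 ∷ 81 ∷ 69 ∷ 57 ∷ 54 ∷ 109 ∷ 109 ∷ 95 ∷ 71 ∷ 54 ∷ 49 ∷ 94 ∷ 91 ∷ 71 ∷ 36
    ∷ 80 ∷ 58 ∷ 65 ∷ 48 ∷ 41 ∷ 43 ∷ 94 ∷ 67 ∷ 10 ∷ 54 ∷ 34 ∷ 28 ∷ 15 ∷ 101 ∷ 96 ∷ 9 ∷ 24 ∷ 33 ∷ 57 ∷ 65 ∷ 90 ∷ 91 ∷ 52
    ∷ 47 ∷ 65 ∷ 26 ∷ 80 ∷ 62 ∷ 44 ∷ 74 ∷ 90 ∷ 67 ∷ 54 ∷ 10 ∷ 60 ∷ 93 ∷ 109 ∷ 103 ∷ 48 ∷ 65 ∷ 72 ∷ 76 ∷ 77 ∷ 104 ∷ 18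
    ∷ 17 ∷ 4 ∷ 20 ∷ 24 ∷ 90 ∷ 60 ∷ 71 ∷ 21 ∷ 46 ∷ 28 ∷ 67 ∷ 41 ∷ 47 ∷ 39 ∷ 50 ∷ 84 ∷ 37 ∷ 52 ∷ 43 ∷ 51 ∷ 53 ∷ 83 ∷ 0
    ∷ 91 ∷ 94 ∷ 87 ∷ 83 ∷ 100 ∷ 110 ∷ 89 ∷ 30 ∷ 68 ∷ 61 ∷ 35 ∷ 36 ∷ 53 ∷ 68 ∷ 92 ∷ 97 ∷ 75 ∷ 42 ∷ 51 ∷ 38 ∷ 45 ∷ 75
    ∷ 56 ∷ 73 ∷ 39 ∷ 25 ∷ 29 ∷ 61 ∷ 82 ∷ 87 ∷ 44 ∷ 2 ∷ 5 ∷ 40 ∷ 78 ∷ 107 ∷ 86 ∷ 12 ∷ 7 ∷ 16 ∷ 33 ∷ 80 ∷ 93 ∷ 95 ∷ 32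
    ∷ 21 ∷ 34 ∷ 58 ∷ 43 ∷ 52 ∷ 19 ∷ 42 ∷ 73 ∷ 55 ∷ 47 ∷ 41 ∷ 59 ∷ 51 ∷ 87 ∷ 37 ∷ 62 ∷ 80 ∷ 73 ∷ 84 ∷ 77 ∷ 104 ∷ 64 ∷ 3
    ∷ 6 ∷ 35 ∷ 69 ∷ 94 ∷ 74 ∷ 71 ∷ 19 ∷ 39 ∷ 72 ∷ 67 ∷ 36 ∷ 44 ∷ 14 ∷ 64 ∷ 96 ∷ 101 ∷ 71 ∷ 60 ∷ 18 ∷ 86 ∷ 107 ∷ 104
    ∷ 91 ∷ 90 ∷ 96 ∷ 99 ∷ 102 ∷ 105 ∷ 14 ∷ 8 ∷ 2 ∷ 23 ∷ 81 ∷ 109 ∷ 44 ∷ 36 ∷ 42 ∷ 50 ∷ 76 ∷ 103 ∷ 71 ∷ 74 ∷ 64 ∷ 63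
    ∷ 99 ∷ 104 ∷ 95 ∷ 93 ∷ 86 ∷ 89 ∷ 108 ∷ 110 ∷ 109 ∷ 109 ∷ 107 ∷ 108 ∷ 111 ∷ 112 ∷ []

  values₆ : List ℕ
  values₆ =
    7114443954760933632626524160 ∷ 15453680082010718980465726892 ∷ 33240388094758870682471129704
    ∷ 34143557934320926075411152184 ∷ 37437193296816802733913677316 ∷ 38723975036200741283380551324
    ∷ 39779837290109884372530123108 ∷ 50094695973390831996707807512 ∷ 51594395286053122634495218720
    ∷ 51725147079239952046000086616 ∷ 52545927691846300202679514864 ∷ 54346810930837887094342221564
    ∷ 54781164802432029123604024664 ∷ 65292962338591174025839987632 ∷ 67369523484326541878312355808
    ∷ 68781172104187851455902533448 ∷ 69021747364975531282980116960 ∷ 70092648501506461154603149080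
    ∷ 71037760665213367397713218424 ∷ 71244407970188752190408515952 ∷ 71431890109070898318515268600
    ∷ 71821182879598141918159222896 ∷ 74411159410845397700805408344 ∷ 75238127596052254157679181136
    ∷ 75633901510218913073436060312 ∷ 79421762369540303377495180624 ∷ 80919870520279528863710672376
    ∷ 82549427198085824199165147264 ∷ 83745545211628935463407982192 ∷ 84008937137900321149192744644
    ∷ 84696394904817684327305715400 ∷ 84856247352812125636349151536 ∷ 86130027660983516678268455600
    ∷ 87029177390047024778871146912 ∷ 87193970614419437132407381104 ∷ 87267992878704238735283028088
    ∷ 87465008834417404165531558720 ∷ 87745743452983360153338692984 ∷ 89739540233923768309253794928
    ∷ 91374516609453781149776547120 ∷ 92355302132453521010911671312 ∷ 93277490645488177444840236116
    ∷ 93502459316266332467780774440 ∷ 93790143770853265933980075472 ∷ 94765261354290820552164424048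
    ∷ 95781742033535432175742506512 ∷ 96281878919289698586648686964 ∷ 97814913954383044866365576180
    ∷ 98420865932852135061242058960 ∷ 99199969085586207621118719712 ∷ 99218885245075624037335615484
    ∷ 100064248602012539933847905200 ∷ 100318126987363589593010734160 ∷ 101822059474708831995819120520
    ∷ 102722872754605736987866015024 ∷ 102956218206307109382399370928 ∷ 103358311657344839738246104628
    ∷ 103510865740904118961478751452 ∷ 104478117166527407132446919512 ∷ 106208404227909283970632428756
    ∷ 106547450848472415749723281732 ∷ 106771416613657926594173786032 ∷ 107495712550641869904292739088
    ∷ 109407202361943600194166946800 ∷ 112453967679307091658109300280 ∷ 113480919494597248471054243044
    ∷ 114868680023971087474941181972 ∷ 115022049515381573029314777968 ∷ 115755922533179667861160071208
    ∷ 117225302700736289587216184896 ∷ 120550175141175102297817520196 ∷ 121054509971071203990419209984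
    ∷ 122799944859700203181826141380 ∷ 124252591829876442730251162524 ∷ 125923290174656310190667357252
    ∷ 126523505073097039401167331632 ∷ 126819123229970655888200330952 ∷ 128036319413164731385234825824
    ∷ 128489464946974415372007681856 ∷ 128945165536323355713972838272 ∷ 130701003568298134948682836996
    ∷ 133215221234874128615053446160 ∷ 133746765993177995017628421152 ∷ 135031526653726360991051028448
    ∷ 136649503341705970664019949360 ∷ 138856498472231914753539294912 ∷ 139984526741878756347255437696
    ∷ 145626623131664527932552537960 ∷ 152092148613264810876795644976 ∷ 153298206759251500870033744216
    ∷ 154271773563542703249250133416 ∷ 155300085802429210905045846624 ∷ 155916014229007194281844776752
    ∷ 158650605044171123198529954920 ∷ 158951237100028127990355342760 ∷ 163514607666850044091507302304
    ∷ 165773565503002785840650273024 ∷ 169243856598892172184571786816 ∷ 169370605477774093055500971072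
    ∷ 189460205716687913318987785000 ∷ 202901450657210736046410059904 ∷ 205814440652176615086868190296
    ∷ 209401390509561795797412643584 ∷ 225032527490029254700940814448 ∷ 229894096948866342018233791288
    ∷ 272263401569945130952942489472 ∷ 273331861230466063174202046464 ∷ 296788331451731941169921184448
    ∷ 319442232924599691231197378808 ∷ 331103003438649855597196044160 ∷ 337960348498743849279470243968
    ∷ 431846049837227671460999269888 ∷ 632753779740921817248411867520 ∷ []

  -- The common factor D of the certificate for k = 4: divided by it, the seven-point inequality
  -- compares 35 = C(7, 4) with 27 times the number of monotone 4-subwords.
  scale : ℕ
  scale = 4904251160227485536160000000

  -- The values are stored with a shift that makes them natural numbers. `check₆` certifies that
  -- they are upper bounds for `F₆`.
  tableValue : ℕ → ℤ
  tableValue i = at 0 values₆ (at 999 classes₆ i) ⊖ 100000000000000000000000000000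

  κ₅ κ₄ κ₂ : Kernel
  κ₅ = kernel (cellCode 5) types₅ forms₅
  κ₄ = kernel (cellCode 4) types₄ forms₄
  κ₂ = kernel (pairCode pairFlags) (0 ∷ 1 ∷ []) forms₂

  F₆ F₇ : List Point → ℤ
  F₆ S = flagSum 4 1 κ₄ S + flagSum 2 2 κ₂ S
  F₇ S = flagSum 5 1 κ₅ S

  check₆ : List ℕ → Bool
  check₆ ρ = F₆ (points 0 ρ) ℤ.≤ᵇ tableValue (typeCode (points 0 ρ))

  -- Looking up the seven six-point sublists spares evaluating `κ₄` and `κ₂` again for each of the
  -- 5040 patterns.
  check₇ : List ℕ → Bool
  check₇ ρ = (∑[ subs 6 (points 0 ρ) ] (tableValue ∘ typeCode) + F₇ (points 0 ρ)) + + (scale ℕ.* 35) ℤ.≤ᵇ + (scale ℕ.* (27 ℕ.* m 4 ρ))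

  check₆-all : Checked check₆ (perms (upTo 6))
  check₆-all = checked refl

  check₇-all : Checked check₇ (perms (upTo 7))
  check₇-all = checked refl

  -- Goodman's argument: seen from a point, the other points get the sign +1 or -1 according to
  -- whether they form an ascent or a descent with it. In a monotone triple all three products of
  -- signs are +1; in any other triple one is +1 and two are -1.
  forms₃ : List Form
  forms₃ = (1 ∷ [] , 1 ∷ 99999 ∷ 99999 ∷ 1 ∷ []) ∷ []

  κ₃ : Kernel
  κ₃ = kernel (cellCode 1) (0 ∷ []) forms₃

  check₃ : List ℕ → Bool
  check₃ ρ = flagSum 1 1 κ₃ (points 0 ρ) + + 2 ℤ.≤ᵇ + (2 ℕ.* (4 ℕ.* m 3 ρ))

  check₃-all : Checked check₃ (perms (upTo 3))
  check₃-all = checked refl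

  -- From the finite checks to g(3) = 1/4 and g(4) = 1/27.

  local-from-patterns : ∀ k N (a D R : ℕ) (G : List Point → ℤ) → Natural G →
    (∀ ρ → ρ ∈ perms (upTo N) → G (points 0 ρ) + + (D ℕ.* a) ≤ + (D ℕ.* (R ℕ.* m k ρ))) →
    ∀ S → length S ≡ N → AllPairs _left-of_ S → Unique (map ordinate S) →
    G S + + (D ℕ.* a) ≤ + (D ℕ.* (R ℕ.* m k (map ordinate S)))
  local-from-patterns k N a D R G nat check S len inc u = subst₂ (λ x y → x + + (D ℕ.* a) ≤ + (D ℕ.* (R ℕ.* y)))
    (sym (natural-pattern G nat S inc)) (m-pattern k S) (check (pattern-of S) (pattern-∈ S len u))

  subs-sum-natural : ∀ j (h : List Point → ℤ) → Natural h → Natural (λ S → ∑[ subs j S ] h)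
  subs-sum-natural j h nat φ S o = trans (cong (λ l → ∑[ l ] h) (subs-map φ j S))
    (trans (∑-map (map φ) (subs j S) h) (∑-cong∈ (subs j S) (λ U U∈ → nat φ U (SameOrder-⊆ (subs-⊆ j S U∈) o))))

  local₃ : ∀ S → length S ≡ 3 → AllPairs _left-of_ S → Unique (map ordinate S) →
    flagSum 1 1 κ₃ S + + 2 ≤ + (2 ℕ.* (4 ℕ.* m 3 (map ordinate S)))
  local₃ = local-from-patterns 3 3 1 2 4 (flagSum 1 1 κ₃) (flagSum-natural 1 1 κ₃ (kernel-natural (cellCode 1) (0 ∷ []) forms₃))
    (λ ρ ρ∈ → ≤ᵇ⇒≤ℤ {flagSum 1 1 κ₃ (points 0 ρ) + + 2} {+ (2 ℕ.* (4 ℕ.* m 3 ρ))} (checked-∈ check₃-all ρ∈))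

  F₆-natural : Natural F₆
  F₆-natural φ S o = cong₂ _+_ (flagSum-natural 4 1 κ₄ (kernel-natural (cellCode 4) types₄ forms₄) φ S o)
    (flagSum-natural 2 2 κ₂ (kernel-natural (pairCode pairFlags) (0 ∷ 1 ∷ []) forms₂) φ S o)

  F₆≤table : ∀ S → length S ≡ 6 → AllPairs _left-of_ S → Unique (map ordinate S) → F₆ S ≤ tableValue (typeCode S)
  F₆≤table S len inc u = subst₂ _≤_ (sym (natural-pattern F₆ F₆-natural S inc)) (cong tableValue (sym (natural-pattern typeCode typeCode-natural S inc)))
    (≤ᵇ⇒≤ℤ {F₆ (points 0 (pattern-of S))} {tableValue (typeCode (points 0 (pattern-of S)))} (checked-∈ check₆-all (pattern-∈ S len u)))

  -- `F₄` is the function whose sum is nonnegative up to lower order terms; `G₄` dominates it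
  -- through the table and is the one evaluated in the finite check.
  F₄ G₄ : List Point → ℤ
  F₄ S = ∑[ subs 6 S ] F₆ + F₇ S
  G₄ S = ∑[ subs 6 S ] (tableValue ∘ typeCode) + F₇ S

  G₄-natural : Natural G₄
  G₄-natural φ S o = cong₂ _+_ (subs-sum-natural 6 (tableValue ∘ typeCode) (λ φ S o → cong tableValue (typeCode-natural φ S o)) φ S o)
    (flagSum-natural 5 1 κ₅ (kernel-natural (cellCode 5) types₅ forms₅) φ S o)

  local₄ : ∀ S → length S ≡ 7 → AllPairs _left-of_ S → Unique (map ordinate S) →
    F₄ S + + (scale ℕ.* 35) ≤ + (scale ℕ.* (27 ℕ.* m 4 (map ordinate S)))
  local₄ S len inc u = ≤-trans (+-monoˡ-≤ (+ (scale ℕ.* 35)) (+-monoˡ-≤ (F₇ S) (∑-mono∈ (subs 6 S) (λ U U∈ →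
      let U⊆ = subs-⊆ 6 S U∈ in F₆≤table U (subs-length 6 S U∈) (AllPairs-resp-⊆ U⊆ inc) (AllPairsₚ.map⁺ (AllPairs-resp-⊆ U⊆ (AllPairsₚ.map⁻ u)))))))
    (local-from-patterns 4 7 35 scale 27 G₄ G₄-natural
      (λ ρ ρ∈ → ≤ᵇ⇒≤ℤ {G₄ (points 0 ρ) + + (scale ℕ.* 35)} {+ (scale ℕ.* (27 ℕ.* m 4 ρ))} (checked-∈ check₇-all ρ∈)) S len inc u)

  nonneg-+ : ∀ {i j k l} → 0ℤ ≤ i + j → 0ℤ ≤ k + l → 0ℤ ≤ (i + k) + (j + l)
  nonneg-+ {i} {j} {k} {l} p q = subst (0ℤ ≤_) (Sums.interchange +-0-isCommutativeMonoid i j k l) (+-mono-≤ p q)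

  -- The six-point inequality is lifted to seven points: every six-point sublist lies in n - 6
  -- seven-point ones, and this factor times an error of order n^5 is again of order n^6.
  two-level : ∀ (κ κ′ κ″ : Kernel) M M′ M″ →
    (∀ T → PSD (κ T)) → (∀ T U U′ → ∣ κ T U U′ ∣ ℕ.≤ M) →
    (∀ T → PSD (κ′ T)) → (∀ T U U′ → ∣ κ′ T U U′ ∣ ℕ.≤ M′) →
    (∀ T → PSD (κ″ T)) → (∀ T U U′ → ∣ κ″ T U U′ ∣ ℕ.≤ M″) →
    ∀ P → 0ℤ ≤ ∑[ subs 7 P ] (λ S → ∑[ subs 6 S ] (λ U → flagSum 4 1 κ U + flagSum 2 2 κ′ U) + flagSum 5 1 κ″ S)
               + + ((M ℕ.+ 2 ℕ.* M′ ℕ.+ M″) ℕ.* length P ℕ.^ 6)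
  two-level κ κ′ κ″ M M′ M″ psd bd psd′ bd′ psd″ bd″ P = ≤-trans total (+-monoʳ-≤ (∑[ subs 7 P ] _) (+≤+ error))
    where
    n = length P
    c = (n ℕ.∸ 6) C 1
    H = λ U → flagSum 4 1 κ U + flagSum 2 2 κ′ U
    E = n ℕ.^ 4 ℕ.* (n ℕ.^ 1 ℕ.* (M ℕ.* (1 ℕ.* n ℕ.^ 0)))
    E′ = n ℕ.^ 2 ℕ.* (n ℕ.^ 2 ℕ.* (M′ ℕ.* (2 ℕ.* n ℕ.^ 1)))
    E″ = n ℕ.^ 5 ℕ.* (n ℕ.^ 1 ℕ.* (M″ ℕ.* (1 ℕ.* n ℕ.^ 0)))
    six : 0ℤ ≤ ∑[ subs 6 P ] H + + (E ℕ.+ E′)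
    six = subst (λ z → 0ℤ ≤ z + + (E ℕ.+ E′)) (sym (∑-+ (subs 6 P) (flagSum 4 1 κ) (flagSum 2 2 κ′))) (nonneg-+ {∑[ subs 6 P ] (flagSum 4 1 κ)} {+ E} {∑[ subs 6 P ] (flagSum 2 2 κ′)} {+ E′} (flagSum-bound 4 0 κ M psd bd P) (flagSum-bound 2 1 κ′ M′ psd′ bd′ P))
    lifted : 0ℤ ≤ ∑[ subs 7 P ] (λ S → ∑[ subs 6 S ] H) + + (c ℕ.* (E ℕ.+ E′))
    lifted = subst (0ℤ ≤_) (trans (*-distribˡ-+ (+ c) (∑[ subs 6 P ] H) (+ (E ℕ.+ E′))) (cong₂ _+_ (sym (∑-subs-of-subs 6 1 P H)) (sym (pos-* c (E ℕ.+ E′)))))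
      (subst (_≤ + c * (∑[ subs 6 P ] H + + (E ℕ.+ E′))) (*-zeroʳ (+ c)) (*-monoˡ-≤-nonNeg (+ c) six))
    total : 0ℤ ≤ ∑[ subs 7 P ] (λ S → ∑[ subs 6 S ] H + flagSum 5 1 κ″ S) + + (c ℕ.* (E ℕ.+ E′) ℕ.+ E″)
    total = subst (λ z → 0ℤ ≤ z + + (c ℕ.* (E ℕ.+ E′) ℕ.+ E″)) (sym (∑-+ (subs 7 P) (λ S → ∑[ subs 6 S ] H) (flagSum 5 1 κ″)))
      (nonneg-+ {∑[ subs 7 P ] (λ S → ∑[ subs 6 S ] H)} {+ (c ℕ.* (E ℕ.+ E′))} {∑[ subs 7 P ] (flagSum 5 1 κ″)} {+ E″} lifted (flagSum-bound 5 0 κ″ M″ psd″ bd″ P))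
    error : c ℕ.* (E ℕ.+ E′) ℕ.+ E″ ℕ.≤ (M ℕ.+ 2 ℕ.* M′ ℕ.+ M″) ℕ.* n ℕ.^ 6
    error = ℕₚ.≤-trans (ℕₚ.+-monoˡ-≤ E″ (ℕₚ.*-monoˡ-≤ (E ℕ.+ E′) (ℕₚ.≤-trans (ℕₚ.≤-reflexive (nC1≡n (n ℕ.∸ 6))) (ℕₚ.m∸n≤m n 6)))) (ℕₚ.≤-reflexive (ring n M M′ M″))
      where
      ring : ∀ n M M′ M″ → n ℕ.* ((n ℕ.* (n ℕ.* (n ℕ.* (n ℕ.* 1)))) ℕ.* ((n ℕ.* 1) ℕ.* (M ℕ.* (1 ℕ.* 1))) ℕ.+ (n ℕ.* (n ℕ.* 1)) ℕ.* ((n ℕ.* (n ℕ.* 1)) ℕ.* (M′ ℕ.* (2 ℕ.* (n ℕ.* 1)))))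
        ℕ.+ (n ℕ.* (n ℕ.* (n ℕ.* (n ℕ.* (n ℕ.* 1))))) ℕ.* ((n ℕ.* 1) ℕ.* (M″ ℕ.* (1 ℕ.* 1))) ≡ (M ℕ.+ 2 ℕ.* M′ ℕ.+ M″) ℕ.* (n ℕ.* (n ℕ.* (n ℕ.* (n ℕ.* (n ℕ.* (n ℕ.* 1))))))
      ring = ℕ-Ring.solve-∀

  one-level : ∀ (κ : Kernel) M → (∀ T → PSD (κ T)) → (∀ T U U′ → ∣ κ T U U′ ∣ ℕ.≤ M) →
    ∀ P → 0ℤ ≤ ∑[ subs 3 P ] (flagSum 1 1 κ) + + (M ℕ.* length P ℕ.^ 2)
  one-level κ M psd bd P = subst (λ z → 0ℤ ≤ ∑[ subs 3 P ] (flagSum 1 1 κ) + + z) (ring (length P) M) (flagSum-bound 1 0 κ M psd bd P)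
    where
    ring : ∀ n M → (n ℕ.* 1) ℕ.* ((n ℕ.* 1) ℕ.* (M ℕ.* (1 ℕ.* 1))) ≡ M ℕ.* (n ℕ.* (n ℕ.* 1))
    ring = ℕ-Ring.solve-∀

  -- The counterpart of `gmin-upper`; the two together give the limit J^(-J) of the density.
  LowerBound : ℕ → Set
  LowerBound J = ∃[ c ] ∃[ N ] (∀ n → N ℕ.≤ n → n ℕ.* (n C suc J) ℕ.≤ n ℕ.* (J ℕ.^ J ℕ.* gmin (suc J) n) ℕ.+ c ℕ.* (n C suc J))

  Bounded : Kernel → Set
  Bounded κ = ∃[ M ] (∀ T U U′ → ∣ κ T U U′ ∣ ℕ.≤ M)

  one-level-lower : ∀ κ D → 0 ℕ.< D → (∀ T → PSD (κ T)) → Bounded κ →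
    (∀ S → length S ≡ 3 → AllPairs _left-of_ S → Unique (map ordinate S) →
       flagSum 1 1 κ S + + (D ℕ.* 1) ≤ + (D ℕ.* (4 ℕ.* m 3 (map ordinate S)))) → LowerBound 2
  one-level-lower κ D D>0 psd (M , bd) local =
    let c , lo = gmin-lower 2 0 4 D M (flagSum 1 1 κ) D>0 (one-level κ M psd bd) local in c , 6 , lo

  -- Stated for variable kernels and a variable D, so that the argument is independent of the
  -- numerical tables and they enter only when it is instantiated.
  two-level-lower : ∀ κ κ′ κ″ D → 0 ℕ.< D → (∀ T → PSD (κ T)) → Bounded κ → (∀ T → PSD (κ′ T)) → Bounded κ′ → (∀ T → PSD (κ″ T)) → Bounded κ″ →
    (∀ S → length S ≡ 7 → AllPairs _left-of_ S → Unique (map ordinate S) →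
       (∑[ subs 6 S ] (λ U → flagSum 4 1 κ U + flagSum 2 2 κ′ U) + flagSum 5 1 κ″ S) + + (D ℕ.* 35) ≤ + (D ℕ.* (27 ℕ.* m 4 (map ordinate S)))) → LowerBound 3
  two-level-lower κ κ′ κ″ D D>0 psd (M , bd) psd′ (M′ , bd′) psd″ (M″ , bd″) local =
    -- Patterns have 7 = 4 + 3 points, 27 is 3^3, and 20 = 2(4 + 2 · 3) is the threshold in
    -- `gmin-lower`.
    let c , lo = gmin-lower 3 3 27 D (M ℕ.+ 2 ℕ.* M′ ℕ.+ M″) _ D>0 (two-level κ κ′ κ″ M M′ M″ psd bd psd′ bd′ psd″ bd″) local in c , 20 , lo

  lower₃ : LowerBound 2
  lower₃ = one-level-lower κ₃ 2 (s≤s z≤n) (kernel-PSD (cellCode 1) (0 ∷ []) forms₃) (kernel-bound (cellCode 1) (0 ∷ []) forms₃) local₃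

  lower₄ : LowerBound 3
  lower₄ = two-level-lower κ₄ κ₂ κ₅ scale (s≤s z≤n) (kernel-PSD (cellCode 4) types₄ forms₄) (kernel-bound (cellCode 4) types₄ forms₄)
    (kernel-PSD (pairCode pairFlags) (0 ∷ 1 ∷ []) forms₂) (kernel-bound (pairCode pairFlags) (0 ∷ 1 ∷ []) forms₂)
    (kernel-PSD (cellCode 5) types₅ forms₅) (kernel-bound (cellCode 5) types₅ forms₅) local₄

  g-converges : ∀ j → LowerBound (suc j) → Converges (g (suc (suc j))) (rk (suc (suc j)))
  g-converges j (c , N , lo) = converges (suc J) (J ℕ.^ J) (c ℕ.+ d) (N ⊔ 2 ℕ.* J) (ℕₚ.m^n>0 J J) (λ n le →
    let N≤n = ℕₚ.≤-trans (ℕₚ.m≤m⊔n N (2 ℕ.* J)) le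
        J≤n = ℕₚ.≤-trans (ℕₚ.m≤n⊔m N (2 ℕ.* J)) le
    in ℕₚ.≤-trans (ℕₚ.≤-trans (ℕₚ.+-monoˡ-≤ J {1} {J} (s≤s z≤n)) (ℕₚ.≤-reflexive (cong (J ℕ.+_) (sym (ℕₚ.+-identityʳ J))))) J≤n
     , ℕₚ.≤-trans (gmin-upper j n J≤n) (ℕₚ.+-monoʳ-≤ _ (ℕₚ.*-monoˡ-≤ (n C suc J) (ℕₚ.m≤n+m d c)))
     , ℕₚ.≤-trans (lo n N≤n) (ℕₚ.+-monoʳ-≤ _ (ℕₚ.*-monoˡ-≤ (n C suc J) (ℕₚ.m≤m+n c d))))
    where
    J = suc j
    d = J ℕ.* 4 ℕ.^ J ℕ.* (2 ℕ.* suc J)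

open import Data.Nat using (ℕ; _≤_; z≤n; s≤s)
open import Relation.Binary.PropositionalEquality using (_≡_; refl)
open import Data.Sum using (_⊎_; inj₁; inj₂)
open import Data.Product using (_×_; _,_)
open import Data.Rational using (_-_)
open Densities using (theta-g; theta-limit)
open Certificates using (g-converges; lower₃; lower₄)

theorem1p4 : (∀ (k : ℕ) → 3 ≤ k → ThetaInv (λ s n → f s k n - g k n))
    × (∀ (k : ℕ) → k ≡ 3 ⊎ k ≡ 4 → ThetaInv (λ s n → f s k n - rk k))
    × (∀ (k : ℕ) → 3 ≤ k → Converges (g k) (rk k) → ThetaInv (λ s n → f s k n - rk k))
theorem1p4 = theta-g
  , (λ { .3 (inj₁ refl) → theta-limit 3 (rk 3) (s≤s (s≤s (s≤s z≤n))) (g-converges 1 lower₃)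
       ; .4 (inj₂ refl) → theta-limit 4 (rk 4) (s≤s (s≤s (s≤s z≤n))) (g-converges 2 lower₄) })
  , (λ k → theta-limit k (rk k))
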